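{- Let $b,c\in\Gamma:=\{3\}\cup\bigcup_{k=1}^\infty \{k^2+1,\dots,k^2+k\}$ with $b<c$, and suppose at least one of the following holds: (i) $\lfloor \sqrt{b} \rfloor \neq \lfloor \sqrt{c} \rfloor$; (ii) $\gcd(b,c)>1$; (iii) $c=b+1$; (iv) $c=b+2$ and there exists an integer $k\geq 3$ such that $k^2<b\leq k^2+\sqrt{\frac{2k^2}{k-2}+1}-1$; (v) there exists an integer $k\geq 2$ such that $b=k^2+1$ and $c=k^2+k$; (vi) $b>1.185\times 10^{29}$. Then $T_b\cap T_c=\emptyset$.
   Context: Let $b\geq 2$ be an integer. A real number $x$ is a Trott number in base $b$ if $x\in(0,1)$ has an infinite continued fraction expansion $x=[0;a_1,a_2,a_3,\dots]$ with all $a_i$ positive integers, and the base-$b$ expansion of $x$ is $x=(0.\hat{a}_1\hat{a}_2\hat{a}_3\dots)_b$, where $\hat{a}_i$ denotes the string of base-$b$ digits of $a_i$ (without leading zeros) and the strings are concatenated. $T_b$ denotes the set of Trott numbers in base $b$. -}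

module Defs where

open import Data.Nat using (ℕ; zero; suc; _+_; _*_; _∸_; _^_; _≤_; _<_; _≤ᵇ_)
open import Data.Nat.DivMod using (_/_; _%_)
open import Data.Nat.GCD using (gcd)
open import Data.Bool using (if_then_else_)
open import Data.List using (List; []; _∷_; _++_; reverse; take; foldl)
open import Data.Product using (_×_; ∃-syntax)
open import Data.Sum using (_⊎_)
open import Relation.Binary.PropositionalEquality using (_≡_; _≢_)

-- Base-b digits of a natural number m ≥ 1, most significant digit first,
-- without leading zeros (this is  â  in the paper).  Fuel m suffices for b ≥ 2.

revDigits : (b fuel m : ℕ) → List ℕ
revDigits zero     _       _       = []
revDigits (suc b') zero    _       = []
revDigits (suc b') (suc f) zero    = []
revDigits (suc b') (suc f) (suc m) =
  (suc m % suc b') ∷ revDigits (suc b') f (suc m / suc b')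

digits : (b m : ℕ) → List ℕ
digits b m = reverse (revDigits b m m)

-- A continued fraction [0; a₁, a₂, …] is given by a : ℕ → ℕ with
-- a i = a_{i+1}  (so a 0 = a₁).

block : (b : ℕ) (a : ℕ → ℕ) (k : ℕ) → List ℕ
block b a zero    = []
block b a (suc k) = block b a k ++ digits b (a k)

-- The first n base-b digits of the concatenated string (each block is
-- nonempty, so the first n blocks contain at least n digits).
firstDigits : (b : ℕ) (a : ℕ → ℕ) (n : ℕ) → List ℕ
firstDigits b a n = take n (block b a n)

digitValue : (b : ℕ) → List ℕ → ℕ
digitValue b = foldl (λ acc d → acc * b + d) 0

-- Truncation numerator: (0.d₁…d_n)_b = truncNum b a n / bⁿ.
truncNum : (b : ℕ) (a : ℕ → ℕ) (n : ℕ) → ℕ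
truncNum b a n = digitValue b (firstDigits b a n)

record Conv : Set where
  constructor mkConv
  field
    p q p' q' : ℕ

conv : (a : ℕ → ℕ) → ℕ → Conv
conv a zero    = mkConv 0 1 1 0
conv a (suc n) with conv a n
... | mkConv p q p' q' = mkConv (a n * p + p') (a n * q + q') p q

convP convQ : (a : ℕ → ℕ) → ℕ → ℕ
convP a n = Conv.p (conv a n)
convQ a n = Conv.q (conv a n)

-- The value x = [0; a₁, a₂, …] (for a_i ≥ 1) lies in the closed interval
-- J_m between the consecutive convergents p_m/q_m and p_{m+1}/q_{m+1};
-- these nested intervals shrink to x.  The base-b digit string
-- d = â₁â₂… has value y with y ∈ I_n = [N_n/bⁿ , (N_n+1)/bⁿ],
-- N_n = truncNum b a n; these also shrink to y.  Hence x = y iff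
-- every I_n meets every J_m.  Two closed intervals meet iff the larger
-- endpoint of each is ≥ the smaller endpoint of the other.
-- (Comparisons of fractions by cross-multiplication.)

Meets : (b : ℕ) (a : ℕ → ℕ) (n m : ℕ) → Set
Meets b a n m =
  -- max(J_m) ≥ N/bⁿ
  ((N * convQ a m ≤ convP a m * B) ⊎ (N * convQ a (suc m) ≤ convP a (suc m) * B))
  ×
  -- min(J_m) ≤ (N+1)/bⁿ
  ((convP a m * B ≤ (suc N) * convQ a m) ⊎ (convP a (suc m) * B ≤ (suc N) * convQ a (suc m)))
  where
  N = truncNum b a n
  B = b ^ n

-- x = [0; a₁, a₂, …] is a Trott number in base b:
-- all a_i are positive integers and the base-b expansion of x is the
-- concatenation â₁â₂â₃…
IsTrottCF : (b : ℕ) (a : ℕ → ℕ) → Set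
IsTrottCF b a = (∀ i → 1 ≤ a i) × (∀ n m → Meets b a n m)

InΓ : ℕ → Set
InΓ b = (b ≡ 3) ⊎ (∃[ k ] (1 ≤ k × k * k + 1 ≤ b × b ≤ k * k + k))

isqrt : ℕ → ℕ
isqrt zero    = 0
isqrt (suc n) = if (suc r * suc r ≤ᵇ suc n) then suc r else r
  where r = isqrt n

-- Hypotheses (i)–(vi).
-- (iv): k² < b ≤ k² + √(2k²/(k−2)+1) − 1 with t = b − k² ≥ 1 is
-- equivalent (k ≥ 3) to (t+1)² ≤ 2k²/(k−2) + 1, i.e. t(t+2)(k−2) ≤ 2k².
-- (vi): 1.185 × 10²⁹ = 1185 × 10²⁶.
Cond : ℕ → ℕ → Set
Cond b c =
  (isqrt b ≢ isqrt c)
  ⊎ (1 < gcd b c)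
  ⊎ (c ≡ b + 1)
  ⊎ (c ≡ b + 2 × ∃[ k ] (3 ≤ k × k * k < b ×
        (b ∸ k * k) * (b ∸ k * k + 2) * (k ∸ 2) ≤ 2 * (k * k)))
  ⊎ (∃[ k ] (2 ≤ k × b ≡ k * k + 1 × c ≡ k * k + k))
  ⊎ (1185 * 10 ^ 26 < b)

{-# OPTIONS --safe #-}
-- A common element x = [0; k, a, …] of T_b and T_c has k = ⌊√b⌋ = ⌊√c⌋.  Write b = k² + s and
-- c = k² + t.  If a has n digits in base b and m digits in base c, comparing x ≈ 1/(k + 1/a) with
-- the digits of a shows that D = t cᵐ − s bⁿ satisfies |s t D + k² (t − s)| ≤ k s t, with m < n.
-- In cases (ii)–(v) this contradicts a congruence for D, modulo gcd(b,c)ᵐ, b and c, b + 1, or k².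
--
-- For large b no linear forms in logarithms are needed.  Since c/b = 1 + (t−s)/b with t − s < √b,
-- the divided difference W of x ↦ (c/b)ˣ over the nodes jm + h (j = 0, 1, 2; 0 ≤ h ≤ q ≈ m/4),
-- a Hermite–Padé form of type I in 1, (c/b)ᵐ, (c/b)²ᵐ, is tiny but not zero.  Replacing (c/b)ᵐ by
-- s bⁿ⁻ᵐ/t, to which it is extremely close, turns the cleared form t²W into an integer in (0, 1).
module Submission where

open import Defs
open import Data.Bool as Bool using (true; false)
open import Data.Empty using (⊥; ⊥-elim)
open import Data.Integer as ℤ using (ℤ; +_; 0ℤ; 1ℤ)
import Data.Integer.Properties as ℤ
open import Data.Integer.Tactic.RingSolver using () renaming (solve-∀ to ℤ-solve-∀)
open import Data.List using (List; []; _∷_; _++_; reverse; take; length; foldl)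
open import Data.List.Membership.DecPropositional using (_∈?_)
open import Data.List.Membership.Propositional using (_∈_)
open import Data.List.Properties as List using (foldl-++; unfold-reverse; length-reverse; length-++; ++-assoc)
import Data.List.Relation.Unary.All as All
open import Data.List.Relation.Unary.Any using (here)
open import Data.Nat using (ℕ; zero; suc; _+_; _*_; _∸_; _^_; _≤_; _<_; z≤n; s≤s; NonZero; >-nonZero; >-nonZero⁻¹; ≢-nonZero; _≤ᵇ_; _!)
open import Data.Nat.Combinatorics using (_C_; nCk+nC[k+1]≡[n+1]C[k+1]; k>n⇒nCk≡0; nC1≡n; nCk≡n!/k![n-k]!; k![n∸k]!∣n!; nCk≡nC[n∸k])
open import Data.Nat.Coprimality using (Coprime; coprime-divisor; coprime-/gcd)
open import Data.Nat.DivMod using (_/_; _%_; m≡m%n+[m/n]*n; m%n<n; m/n<m; m/n*n≡m; %-distribˡ-*; [m+kn]%n≡m%n)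
open import Data.Nat.Divisibility using (_∣_; divides; quotient; ∣⇒≤; ∣m+n∣m⇒∣n; ∣m∣n⇒∣m+n; m∣m*n; n∣m*n; *-cancelˡ-∣; *-monoʳ-∣; ∣-refl; ∣-trans; ∣-reflexive; 1∣_)
open import Data.Nat.GCD using (gcd; gcd[m,n]∣m; gcd[m,n]∣n)
open import Data.Nat.Properties
open import Data.Nat.Tactic.RingSolver using (solve-∀)
open import Data.Product using (_×_; _,_; proj₁; proj₂; ∃-syntax)
open import Data.Sum using (_⊎_; inj₁; inj₂; [_,_]′)
open import Data.Unit using (⊤; tt)
open import Relation.Binary.Definitions using (tri<; tri≈; tri>)
open import Relation.Binary.PropositionalEquality using (_≡_; refl; sym; trans; cong; cong₂; subst; subst₂; _≢_; module ≡-Reasoning)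
open import Relation.Nullary using (¬_; yes; no)
open import Relation.Nullary.Decidable using (from-no; from-yes)

-- Digits, convergents and digit intervals

-- Why three blocks and `q ≈ m/4`: put `d = t − s`, so `d² ≤ b` and `t² ≤ b`, and let `v + 1` be the
-- number of nodes. After division by `L/v!`, and up to powers of 2, `W` lies between `b^(2m−2q−2)`
-- and `b^(2m+q−v/2)`. Three blocks have `v = 3q + 2`, so `t²W/b²ᵐ` is at most about `b^(−q/2)`; the
-- same count for two blocks gives exponent 0, hence no gain. Replacing `t cᵐ` by `s bⁿ` costs about
-- `b^(m+q+2)`, which stays below `W` only if `m > 3q + 4`. The weights contribute powers of 2 with
-- exponents linear in `m`; for `b ≥ 2⁹⁶` these are absorbed when `q` lies roughly between `0.16 m`
-- and `0.29 m`. The same size of `b` gives `m ≥ 96`, because `(c/b)ᵐ > k` forces `k² < 2ᵐ`, so no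
-- small exponents are left over. Nonvanishing comes from positivity: divided differences of
-- binomial coefficients are nonnegative, so `W` is at least the first surviving term of its
-- expansion.

foldl-digits : ∀ b x xs → foldl (λ acc d → acc * b + d) x xs ≡ x * b ^ length xs + digitValue b xs
foldl-digits b x [] = sym (trans (+-identityʳ _) (*-identityʳ x))
foldl-digits b x (d ∷ xs)
  rewrite foldl-digits b (x * b + d) xs | foldl-digits b d xs =
  lemma x b d (b ^ length xs) (digitValue b xs)
  where
  lemma : ∀ x b d p v → (x * b + d) * p + v ≡ x * (b * p) + (d * p + v)
  lemma = solve-∀

digitValue-++ : ∀ b xs ys → digitValue b (xs ++ ys) ≡ digitValue b xs * b ^ length ys + digitValue b ys
digitValue-++ b xs ys = trans (foldl-++ _ 0 xs ys) (foldl-digits b (digitValue b xs) ys)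

m/b≤f : ∀ b'' f m → suc m ≤ suc f → suc m / suc (suc b'') ≤ f
m/b≤f b'' f m p = ≤-pred (≤-trans (m/n<m (suc m) (suc (suc b'')) (s≤s (s≤s z≤n))) p)

digitValue-revDigits : ∀ b f m → 2 ≤ b → m ≤ f → digitValue b (reverse (revDigits b f m)) ≡ m
digitValue-revDigits (suc (suc b'')) zero zero _ _ = refl
digitValue-revDigits (suc (suc b'')) (suc f) zero _ _ = refl
digitValue-revDigits b@(suc (suc b'')) (suc f) (suc m) 2≤b m≤f
  rewrite unfold-reverse (suc m % b) (revDigits b f (suc m / b))
        | digitValue-++ b (reverse (revDigits b f (suc m / b))) (suc m % b ∷ [])
        | digitValue-revDigits b f (suc m / b) 2≤b (m/b≤f b'' f m m≤f)
        | *-identityʳ b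
  = trans (+-comm (suc m / b * b) (suc m % b)) (sym (m≡m%n+[m/n]*n (suc m) b))
digitValue-revDigits (suc zero) _ _ (s≤s ()) _

digitValue-digits : ∀ {b} → 2 ≤ b → ∀ m → digitValue b (digits b m) ≡ m
digitValue-digits 2≤b m = digitValue-revDigits _ m m 2≤b ≤-refl

revDigits-length : ∀ b f m → 2 ≤ b → m ≤ f → m < b ^ length (revDigits b f m)
revDigits-length (suc (suc b'')) zero zero _ _ = s≤s z≤n
revDigits-length (suc (suc b'')) (suc f) zero _ _ = s≤s z≤n
revDigits-length b@(suc (suc b'')) (suc f) (suc m) 2≤b m≤f = begin-strict
  suc m ≡⟨ m≡m%n+[m/n]*n (suc m) b ⟩
  suc m % b + suc m / b * b <⟨ +-monoˡ-< (suc m / b * b) (m%n<n (suc m) b) ⟩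
  b + suc m / b * b ≤⟨ *-monoˡ-≤ b (revDigits-length b f (suc m / b) 2≤b (m/b≤f b'' f m m≤f)) ⟩
  b ^ length (revDigits b f (suc m / b)) * b ≡⟨ *-comm (b ^ length (revDigits b f (suc m / b))) b ⟩
  b * b ^ length (revDigits b f (suc m / b)) ∎
  where open ≤-Reasoning
revDigits-length (suc zero) _ _ (s≤s ()) _

revDigits-zero : ∀ b f → revDigits b f 0 ≡ []
revDigits-zero zero    f       = refl
revDigits-zero (suc b) zero    = refl
revDigits-zero (suc b) (suc f) = refl

length-revDigits : ∀ b f m → 2 ≤ b → m ≤ f → 1 ≤ m → b ^ length (revDigits b f m) ≤ m * b
length-revDigits b@(suc (suc b'')) (suc f) (suc m) 2≤b m≤f _ with suc m / b in eq
... | zero rewrite revDigits-zero b f = ≤-trans (≤-reflexive (^-identityʳ b)) (m≤m+n b (m * b))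
... | suc m' = begin
  b * b ^ length (revDigits b f (suc m')) ≤⟨ *-monoʳ-≤ b (length-revDigits b f (suc m') 2≤b m'≤f (s≤s z≤n)) ⟩
  b * (suc m' * b) ≡⟨ cong (λ z → b * (z * b)) (sym eq) ⟩
  b * (suc m / b * b) ≤⟨ *-monoʳ-≤ b (≤-trans (m≤n+m _ (suc m % b)) (≤-reflexive (sym (m≡m%n+[m/n]*n (suc m) b)))) ⟩
  b * suc m ≡⟨ *-comm b (suc m) ⟩
  suc m * b ∎
  where
  open ≤-Reasoning
  m'≤f : suc m' ≤ f
  m'≤f = subst (_≤ f) eq (m/b≤f b'' f m m≤f)
length-revDigits (suc zero) _ _ (s≤s ()) _ _

len : ℕ → ℕ → ℕ
len b m = length (digits b m)

<b^len : ∀ {b} → 2 ≤ b → ∀ m → m < b ^ len b m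
<b^len {b} 2≤b m = subst (λ l → m < b ^ l) (sym (length-reverse (revDigits b m m))) (revDigits-length b m m 2≤b ≤-refl)

b^len≤ : ∀ {b} → 2 ≤ b → ∀ m → 1 ≤ m → b ^ len b m ≤ m * b
b^len≤ {b} 2≤b m 1≤m = subst (λ l → b ^ l ≤ m * b) (sym (length-reverse (revDigits b m m))) (length-revDigits b m m 2≤b ≤-refl 1≤m)

1≤len : ∀ {b} → 2 ≤ b → ∀ m → 1 ≤ m → 1 ≤ len b m
1≤len {b} 2≤b m 1≤m with len b m | <b^len 2≤b m
... | zero  | m<1 = ⊥-elim (<-irrefl refl (≤-trans m<1 1≤m))
... | suc _ | _   = s≤s z≤n

take-length-++ : ∀ (xs ys : List ℕ) → take (length xs) (xs ++ ys) ≡ xs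
take-length-++ [] ys = refl
take-length-++ (x ∷ xs) ys = cong (x ∷_) (take-length-++ xs ys)

module _ {b : ℕ} {a : ℕ → ℕ} (2≤b : 2 ≤ b) (1≤a : ∀ i → 1 ≤ a i) where

  blockLength : ∀ i → i ≤ length (block b a i)
  blockLength zero = z≤n
  blockLength (suc i) = begin
    suc i ≡⟨ +-comm 1 i ⟩
    i + 1 ≤⟨ +-mono-≤ (blockLength i) (1≤len 2≤b (a i) (1≤a i)) ⟩
    length (block b a i) + len b (a i) ≡⟨ sym (length-++ (block b a i)) ⟩
    length (block b a i ++ digits b (a i)) ∎
    where open ≤-Reasoning

  block-prefix : ∀ i j → ∃[ ys ] block b a (j + i) ≡ block b a i ++ ys
  block-prefix i zero = [] , sym (List.++-identityʳ _)
  block-prefix i (suc j) with block-prefix i j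
  ... | ys , eq = ys ++ digits b (a (j + i)) ,
        trans (cong (_++ digits b (a (j + i))) eq) (++-assoc (block b a i) ys _)

  -- `firstDigits b a n` reads `n` blocks. With `n` the digit count of the first `i` blocks, `n ≥ i`
  -- because no block is empty, so what is read begins with exactly those `i` blocks.
  truncNum-block : ∀ i → truncNum b a (length (block b a i)) ≡ digitValue b (block b a i)
  truncNum-block i with block-prefix i (length (block b a i) ∸ i)
  ... | ys , eq rewrite m∸n+n≡m (blockLength i) | eq =
    cong (digitValue b) (take-length-++ (block b a i) ys)

module _ {a : ℕ → ℕ} (1≤a : ∀ i → 1 ≤ a i) where

  1≤convQ : ∀ n → 1 ≤ convQ a n
  1≤convQ zero          = s≤s z≤n
  1≤convQ (suc zero)    = subst (1 ≤_) (sym (trans (+-identityʳ _) (*-identityʳ (a 0)))) (1≤a 0)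
  1≤convQ (suc (suc n)) = ≤-trans (1≤convQ n) (m≤n+m _ _)

  -- Linear growth is enough: it brings neighbouring convergents closer together than any prescribed
  -- `1/(BG)`.
  n≤convQ : ∀ n → n ≤ convQ a n
  n≤convQ zero          = z≤n
  n≤convQ (suc zero)    = 1≤convQ 1
  n≤convQ (suc (suc n)) = begin
    suc (suc n) ≡⟨ +-comm 1 (suc n) ⟩
    suc n + 1 ≤⟨ +-mono-≤ (n≤convQ (suc n)) (1≤convQ n) ⟩
    convQ a (suc n) + convQ a n ≤⟨ +-monoˡ-≤ (convQ a n) (m≤n*m (convQ a (suc n)) (a (suc n)) {{>-nonZero (1≤a (suc n))}}) ⟩
    a (suc n) * convQ a (suc n) + convQ a n ∎
    where open ≤-Reasoning

-- The determinant of neighbouring convergents alternates between 1 and -1; over ℕ the two signs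
-- form a disjunction, so that no parity has to be tracked.
convergents-unimodular : ∀ a n →
  (convP a (suc n) * convQ a n ≡ convP a n * convQ a (suc n) + 1) ⊎
  (convP a n * convQ a (suc n) ≡ convP a (suc n) * convQ a n + 1)
convergents-unimodular a zero rewrite *-zeroʳ (a 0) = inj₁ refl
convergents-unimodular a (suc n) with convergents-unimodular a n
... | inj₁ eq = inj₂ (lemma (a (suc n)) _ _ _ _ eq)
  where
  lemma : ∀ x p q p' q' → p * q' ≡ p' * q + 1 → p * (x * q + q') ≡ (x * p + p') * q + 1
  lemma x p q p' q' eq = trans (solve₁ x p q q') (trans (cong (λ z → x * p * q + z) eq) (solve₂ x p q p'))
    where
    solve₁ : ∀ x p q q' → p * (x * q + q') ≡ x * p * q + p * q'
    solve₁ = solve-∀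
    solve₂ : ∀ x p q p' → x * p * q + (p' * q + 1) ≡ (x * p + p') * q + 1
    solve₂ = solve-∀
... | inj₂ eq = inj₁ (lemma (a (suc n)) _ _ _ _ eq)
  where
  lemma : ∀ x p q p' q' → p' * q ≡ p * q' + 1 → (x * p + p') * q ≡ p * (x * q + q') + 1
  lemma x p q p' q' eq = trans (solve₁ x p q p') (trans (cong (λ z → x * p * q + z) eq) (solve₂ x p q q'))
    where
    solve₁ : ∀ x p q p' → (x * p + p') * q ≡ x * p * q + p' * q
    solve₁ = solve-∀
    solve₂ : ∀ x p q q' → x * p * q + (p * q' + 1) ≡ p * (x * q + q') + 1
    solve₂ = solve-∀

-- Two fractions p/q ≤ M/G < N/B ≤ p'/q' differ by at least 1/(BG), but neighbouring
-- convergents by at most 1/(qq').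
gap-bound : ∀ p q p' q' N B M G → N * q' ≤ p' * B → p * G ≤ M * q → M * B < N * G →
            p' * q ≤ p * q' + 1 → q * q' ≤ B * G
gap-bound p q p' q' N B M G h₁ h₂ h₃ h₄ = +-cancelˡ-≤ (M * B * (q * q')) _ _ (begin
  M * B * (q * q') + q * q' ≡⟨ +-comm (M * B * (q * q')) (q * q') ⟩
  suc (M * B) * (q * q') ≤⟨ *-monoˡ-≤ (q * q') h₃ ⟩
  N * G * (q * q') ≡⟨ e₁ N G q q' ⟩
  N * q' * (G * q) ≤⟨ *-monoˡ-≤ (G * q) h₁ ⟩
  p' * B * (G * q) ≡⟨ e₂ p' B G q ⟩
  B * G * (p' * q) ≤⟨ *-monoʳ-≤ (B * G) h₄ ⟩
  B * G * (p * q' + 1) ≡⟨ e₃ B G p q' ⟩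
  p * G * (B * q') + B * G ≤⟨ +-monoˡ-≤ (B * G) (*-monoˡ-≤ (B * q') h₂) ⟩
  M * q * (B * q') + B * G ≡⟨ e₄ M q B q' G ⟩
  M * B * (q * q') + B * G ∎)
  where
  open ≤-Reasoning
  e₁ : ∀ N G q q' → N * G * (q * q') ≡ N * q' * (G * q)
  e₁ = solve-∀
  e₂ : ∀ p' B G q → p' * B * (G * q) ≡ B * G * (p' * q)
  e₂ = solve-∀
  e₃ : ∀ B G p q' → B * G * (p * q' + 1) ≡ p * G * (B * q') + B * G
  e₃ = solve-∀
  e₄ : ∀ M q B q' G → M * q * (B * q') + B * G ≡ M * B * (q * q') + B * G
  e₄ = solve-∀

-- Both digit intervals contain x, hence each lower end is at most the other upper end.
intervals-compatible : ∀ {b c a} → IsTrottCF b a → IsTrottCF c a → ∀ n n' →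
  truncNum b a n * c ^ n' ≤ suc (truncNum c a n') * b ^ n
intervals-compatible {b} {c} {a} (1≤a , meetsB) (_ , meetsC) n n'
  with truncNum b a n * c ^ n' ≤? suc (truncNum c a n') * b ^ n
... | yes p = p
... | no ¬p = ⊥-elim (cases (proj₁ (meetsB n m)) (proj₂ (meetsC n' m)))
  where
  N = truncNum b a n
  M = suc (truncNum c a n')
  B = b ^ n
  G = c ^ n'
  -- At this index `Q m > BG`, which violates the conclusion `qq' ≤ BG` of `gap-bound`.
  m = suc (B * G)
  P = convP a
  Q = convQ a
  m≤QQ : ∀ {i j} → m ≤ Q i → m ≤ Q i * Q j
  m≤QQ {i} {j} m≤ = ≤-trans m≤ (m≤m*n (Q i) (Q j) {{>-nonZero (1≤convQ 1≤a j)}})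
  m≤Qsm : m ≤ Q (suc m)
  m≤Qsm = ≤-trans (n≤1+n m) (n≤convQ 1≤a (suc m))
  absurd : ∀ i j → m ≤ Q i → N * Q j ≤ P j * B → P i * G ≤ M * Q i → P j * Q i ≤ P i * Q j + 1 → ⊥
  absurd i j m≤ h₁ h₂ h₄ =
    <-irrefl refl (≤-trans (m≤QQ {i} {j} m≤) (gap-bound (P i) (Q i) (P j) (Q j) N B M G h₁ h₂ (≰⇒> ¬p) h₄))
  near : (P (suc m) * Q m ≤ P m * Q (suc m) + 1) × (P m * Q (suc m) ≤ P (suc m) * Q m + 1)
  near with convergents-unimodular a m
  ... | inj₁ eq = ≤-reflexive eq , ≤-trans (m≤m+n _ 1) (≤-trans (≤-reflexive (sym eq)) (m≤m+n _ 1))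
  ... | inj₂ eq = ≤-trans (m≤m+n _ 1) (≤-trans (≤-reflexive (sym eq)) (m≤m+n _ 1)) , ≤-reflexive eq
  cases : (N * Q m ≤ P m * B ⊎ N * Q (suc m) ≤ P (suc m) * B) → (P m * G ≤ M * Q m ⊎ P (suc m) * G ≤ M * Q (suc m)) → ⊥
  cases (inj₁ h₁) (inj₁ h₂) = absurd m m (n≤convQ 1≤a m) h₁ h₂ (m≤m+n _ 1)
  cases (inj₁ h₁) (inj₂ h₂) = absurd (suc m) m m≤Qsm h₁ h₂ (proj₂ near)
  cases (inj₂ h₁) (inj₁ h₂) = absurd m (suc m) (n≤convQ 1≤a m) h₁ h₂ (proj₁ near)
  cases (inj₂ h₁) (inj₂ h₂) = absurd (suc m) (suc m) m≤Qsm h₁ h₂ (m≤m+n _ 1)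

convP₂ : ∀ a → convP a 2 ≡ a 1
convP₂ a = lemma (a 0) (a 1)
  where
  lemma : ∀ k e → e * (k * 0 + 1) + 0 ≡ e
  lemma = solve-∀

convQ₂ : ∀ a → convQ a 2 ≡ a 0 * a 1 + 1
convQ₂ a = lemma (a 0) (a 1)
  where
  lemma : ∀ k e → e * (k * 1 + 0) + 1 ≡ k * e + 1
  lemma = solve-∀

convP₃ : ∀ a → convP a 3 ≡ a 2 * a 1 + 1
convP₃ a = cong₂ _+_ (cong (a 2 *_) (convP₂ a)) (cong (_+ 1) (*-zeroʳ (a 0)))

convQ₃ : ∀ a → convQ a 3 ≡ a 2 * (a 0 * a 1 + 1) + a 0
convQ₃ a = cong₂ _+_ (cong (a 2 *_) (convQ₂ a)) (trans (+-identityʳ _) (*-identityʳ (a 0)))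

-- x ≤ 1/(k + 1/(e+1)), where a₁ = k and a₂ = e.
lower-end-bound : ∀ {b a} → IsTrottCF b a → ∀ n →
  truncNum b a n * (a 0 * suc (a 1) + 1) ≤ suc (a 1) * b ^ n
lower-end-bound {b} {a} (1≤a , meets) n = go (proj₁ (meets n 2))
  where
  N = truncNum b a n
  B = b ^ n
  k = a 0
  e = a 1
  f = a 2
  first : N * (k * e + 1) ≤ e * B → N * (k * suc e + 1) ≤ suc e * B
  first h = begin
    N * (k * suc e + 1) ≡⟨ e₁ N k e ⟩
    N * k + N * (k * e + 1) ≤⟨ +-mono-≤ (*-cancelˡ-≤ e {{>-nonZero (1≤a 1)}} h') h ⟩
    B + e * B ∎
    where
    open ≤-Reasoning
    e₁ : ∀ N k e → N * (k * suc e + 1) ≡ N * k + N * (k * e + 1)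
    e₁ = solve-∀
    e₂ : ∀ N k e → N * (k * e + 1) ≡ e * (N * k) + N
    e₂ = solve-∀
    h' : e * (N * k) ≤ e * B
    h' = ≤-trans (m≤m+n _ N) (≤-trans (≤-reflexive (sym (e₂ N k e))) h)
  -- The convergent `p₃/q₃` is a mediant of `f − 1` copies of `e/(ke+1)` and one copy of
  -- `(e+1)/(k(e+1)+1)`. A number at most the mediant but above the first fraction is at most the
  -- second.
  second : ∀ f → 1 ≤ f → N * (f * (k * e + 1) + k) ≤ (f * e + 1) * B → N * (k * suc e + 1) ≤ suc e * B
  second (suc f) _ h with N * (k * e + 1) ≤? e * B
  ... | yes h' = first h'
  ... | no ¬h' = +-cancelˡ-≤ (f * (e * B)) _ _ (begin
    f * (e * B) + N * (k * suc e + 1) ≤⟨ +-monoˡ-≤ _ (*-monoʳ-≤ f (<⇒≤ (≰⇒> ¬h'))) ⟩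
    f * (N * (k * e + 1)) + N * (k * suc e + 1) ≡⟨ e₁ f N k e ⟩
    N * (suc f * (k * e + 1) + k) ≤⟨ h ⟩
    (suc f * e + 1) * B ≡⟨ e₂ f e B ⟩
    f * (e * B) + suc e * B ∎)
    where
    open ≤-Reasoning
    e₁ : ∀ f N k e → f * (N * (k * e + 1)) + N * (k * suc e + 1) ≡ N * (suc f * (k * e + 1) + k)
    e₁ = solve-∀
    e₂ : ∀ f e B → (suc f * e + 1) * B ≡ f * (e * B) + suc e * B
    e₂ = solve-∀
  go : (N * convQ a 2 ≤ convP a 2 * B ⊎ N * convQ a 3 ≤ convP a 3 * B) → N * (k * suc e + 1) ≤ suc e * B
  go (inj₁ h) = first (subst₂ (λ q p → N * q ≤ p * B) (convQ₂ a) (convP₂ a) h)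
  go (inj₂ h) = second f (1≤a 2) (subst₂ (λ q p → N * q ≤ p * B) (convQ₃ a) (convP₃ a) h)

-- x ≥ 1/(k + 1/e).
upper-end-bound : ∀ {b a} → IsTrottCF b a → ∀ n →
  a 1 * b ^ n ≤ suc (truncNum b a n) * (a 0 * a 1 + 1)
upper-end-bound {b} {a} (1≤a , meets) n = go (proj₂ (meets n 2))
  where
  M = suc (truncNum b a n)
  B = b ^ n
  k = a 0
  e = a 1
  f = a 2
  -- Here `p₃/q₃` is a mediant of `f` copies of `e/(ke+1)` and one copy of `1/k`, and `1/k` is the
  -- larger fraction.
  second : (f * e + 1) * B ≤ M * (f * (k * e + 1) + k) → e * B ≤ M * (k * e + 1)
  second h with e * B ≤? M * (k * e + 1)
  ... | yes h' = h'
  ... | no ¬h' = begin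
    e * B ≤⟨ *-monoʳ-≤ e B≤Mk ⟩
    e * (M * k) ≤⟨ m≤m+n _ M ⟩
    e * (M * k) + M ≡⟨ e₁ e M k ⟩
    M * (k * e + 1) ∎
    where
    open ≤-Reasoning
    e₁ : ∀ e M k → e * (M * k) + M ≡ M * (k * e + 1)
    e₁ = solve-∀
    e₂ : ∀ f e B → f * (e * B) + B ≡ (f * e + 1) * B
    e₂ = solve-∀
    e₃ : ∀ f M k e → M * (f * (k * e + 1) + k) ≡ f * (M * (k * e + 1)) + M * k
    e₃ = solve-∀
    B≤Mk : B ≤ M * k
    B≤Mk = +-cancelˡ-≤ (f * (e * B)) _ _ (begin
      f * (e * B) + B ≡⟨ e₂ f e B ⟩
      (f * e + 1) * B ≤⟨ h ⟩
      M * (f * (k * e + 1) + k) ≡⟨ e₃ f M k e ⟩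
      f * (M * (k * e + 1)) + M * k ≤⟨ +-monoˡ-≤ (M * k) (*-monoʳ-≤ f (<⇒≤ (≰⇒> ¬h'))) ⟩
      f * (e * B) + M * k ∎)
  go : (convP a 2 * B ≤ M * convQ a 2 ⊎ convP a 3 * B ≤ M * convQ a 3) → e * B ≤ M * (k * e + 1)
  go (inj₁ h) = subst₂ (λ q p → p * B ≤ M * q) (convQ₂ a) (convP₂ a) h
  go (inj₂ h) = second (subst₂ (λ q p → p * B ≤ M * q) (convQ₃ a) (convP₃ a) h)

-- Square roots, the set Γ and the first two partial quotients

isqrt-spec : ∀ n → isqrt n * isqrt n ≤ n × n < suc (isqrt n) * suc (isqrt n)
isqrt-spec zero = z≤n , s≤s z≤n
isqrt-spec (suc n) with isqrt-spec n | suc (isqrt n) * suc (isqrt n) ≤ᵇ suc n in eq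
... | _  , hi | true  = ≤ᵇ⇒≤ _ _ (subst Bool.T (sym eq) tt) , (begin-strict
  suc n ≤⟨ hi ⟩
  suc r * suc r <⟨ m<m+n _ (s≤s z≤n) ⟩
  suc r * suc r + suc (r + suc r + 1) ≡⟨ lemma r ⟩
  suc (suc r) * suc (suc r) ∎)
  where
  open ≤-Reasoning
  r = isqrt n
  lemma : ∀ r → suc r * suc r + suc (r + suc r + 1) ≡ suc (suc r) * suc (suc r)
  lemma = solve-∀
... | lo , hi | false = ≤-trans lo (n≤1+n n) ,
  ≰⇒> (λ p → subst Bool.T eq (≤⇒≤ᵇ p))

square-cancel-< : ∀ {m n} → m * m < n * n → m < n
square-cancel-< {m} {n} p = ≰⇒> (λ n≤m → <⇒≱ p (*-mono-≤ n≤m n≤m))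

sqrt-unique : ∀ {b k r} → k * k ≤ b → b < suc k * suc k → r * r ≤ b → b < suc r * suc r → r ≡ k
sqrt-unique p p' q q' = ≤-antisym (≤-pred (square-cancel-< (≤-<-trans q p'))) (≤-pred (square-cancel-< (≤-<-trans p q')))

-- The excess `s` of `b` over `k²` is the parameter of all later estimates. Only `3 = 1 + 2`
-- violates `s ≤ k`, and it is carried along as an exception.
Γ-form : ∀ {b} → InΓ b → ∃[ k ] ∃[ s ] (b ≡ k * k + s × 1 ≤ k × 1 ≤ s × (s ≤ k ⊎ k ≡ 1 × s ≡ 2))
Γ-form (inj₁ refl) = 1 , 2 , refl , s≤s z≤n , s≤s z≤n , inj₂ (refl , refl)
Γ-form {b} (inj₂ (k , 1≤k , lo , hi)) = k , b ∸ k * k , sym (m+[n∸m]≡n kk≤b) , 1≤k ,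
  +-cancelˡ-≤ (k * k) _ _ (≤-trans lo (≤-reflexive (sym (m+[n∸m]≡n kk≤b)))) ,
  inj₁ (+-cancelˡ-≤ (k * k) _ _ (≤-trans (≤-reflexive (m+[n∸m]≡n kk≤b)) hi))
  where
  kk≤b : k * k ≤ b
  kk≤b = ≤-trans (m≤m+n _ 1) lo

Γ-upper : ∀ {k s} → 1 ≤ k → s ≤ k ⊎ k ≡ 1 × s ≡ 2 → k * k + s < suc k * suc k
Γ-upper {k} {s} _ (inj₁ s≤k) = begin-strict
  k * k + s ≤⟨ +-monoʳ-≤ (k * k) s≤k ⟩
  k * k + k <⟨ m<m+n _ (s≤s z≤n) ⟩
  k * k + k + suc k ≡⟨ lemma k ⟩
  suc k * suc k ∎
  where
  open ≤-Reasoning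
  lemma : ∀ k → k * k + k + suc k ≡ suc k * suc k
  lemma = solve-∀
Γ-upper _ (inj₂ (refl , refl)) = ≤-refl

module _ {b : ℕ} {a : ℕ → ℕ} (2≤b : 2 ≤ b) (trott : IsTrottCF b a) where
  private
    1≤a = proj₁ trott
    k = a 0
    e = a 1
    L = len b k
    n = len b e

  truncNum-first : truncNum b a L ≡ k
  truncNum-first = trans (truncNum-block 2≤b 1≤a 1) (digitValue-digits 2≤b k)

  first<b^ : k * k < b ^ L
  first<b^ = *-cancelˡ-< (suc e) _ _ (begin-strict
    suc e * (k * k) <⟨ m<m+n _ (1≤a 0) ⟩
    suc e * (k * k) + k ≡⟨ lemma k e ⟩
    k * (k * suc e + 1) ≡⟨ cong (_* (k * suc e + 1)) (sym truncNum-first) ⟩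
    truncNum b a L * (k * suc e + 1) ≤⟨ lower-end-bound trott L ⟩
    suc e * b ^ L ∎)
    where
    open ≤-Reasoning
    lemma : ∀ k e → suc e * (k * k) + k ≡ k * (k * suc e + 1)
    lemma = solve-∀

  b^≤first : b ^ L ≤ suc k * suc k
  b^≤first = *-cancelˡ-≤ e {{>-nonZero (1≤a 1)}} (begin
    e * b ^ L ≤⟨ upper-end-bound trott L ⟩
    suc (truncNum b a L) * (k * e + 1) ≡⟨ cong (λ z → suc z * (k * e + 1)) truncNum-first ⟩
    suc k * (k * e + 1) ≤⟨ *-monoʳ-≤ (suc k) (+-monoʳ-≤ (k * e) (1≤a 1)) ⟩
    suc k * (k * e + e) ≡⟨ lemma k e ⟩
    e * (suc k * suc k) ∎)
    where
    open ≤-Reasoning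
    lemma : ∀ k e → suc k * (k * e + e) ≡ e * (suc k * suc k)
    lemma = solve-∀

  -- The digit count turns `k² < b^L` into `k² < kb`, so the first partial quotient is a single
  -- digit. Then `L = 1`, and the two bounds on `b^L` become `first-sqrt`.
  first<b : k < b
  first<b = *-cancelˡ-< k _ _ (<-≤-trans first<b^ (b^len≤ 2≤b k (1≤a 0)))

  len-small : ∀ x → 1 ≤ x → x < b → len b x ≡ 1
  len-small x 1≤x x<b with len b x | 1≤len 2≤b x 1≤x | b^len≤ 2≤b x 1≤x
  ... | suc zero    | _ | _ = refl
  ... | suc (suc l) | _ | p = ⊥-elim (<-irrefl refl (begin-strict
    b * 1 ≤⟨ *-monoʳ-≤ b (m^n>0 b {{>-nonZero (≤-trans (s≤s z≤n) 2≤b)}} l) ⟩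
    b * b ^ l ≤⟨ *-cancelˡ-≤ b {{>-nonZero (≤-trans (s≤s z≤n) 2≤b)}} (≤-trans p (≤-reflexive (*-comm x b))) ⟩
    x <⟨ x<b ⟩
    b ≡⟨ sym (*-identityʳ b) ⟩
    b * 1 ∎))
    where open ≤-Reasoning

  first-sqrt : k * k < b × b ≤ suc k * suc k
  first-sqrt = subst (k * k <_) b^L first<b^ , subst (_≤ suc k * suc k) b^L b^≤first
    where
    b^L : b ^ L ≡ b
    b^L = trans (cong (b ^_) (len-small k (1≤a 0) first<b)) (*-identityʳ b)

  truncNum-second : truncNum b a (suc n) ≡ k * b ^ n + e
  truncNum-second = trans (cong (truncNum b a) (sym len₂)) (trans (truncNum-block 2≤b 1≤a 2)
    (trans (digitValue-++ b (digits b k) (digits b e))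
      (cong₂ (λ x y → x * b ^ n + y) (digitValue-digits 2≤b k) (digitValue-digits 2≤b e))))
    where
    len₂ : length (block b a 2) ≡ suc n
    len₂ = trans (length-++ (digits b k)) (cong (_+ n) (len-small k (1≤a 0) first<b))

-- These are `lower-end-bound` and `upper-end-bound` for the truncation after the first two blocks,
-- `(kβ + e)/(bβ)` with `b = k² + s`, after cancelling the terms with `k²β`. To first order both say
-- `sβ ≈ ke`.
Bracket : (k s e β : ℕ) → Set
Bracket k s e β = (k * β + e * (k * suc e + 1) ≤ suc e * (s * β)) × (e * (s * β) ≤ k * β + suc e * (k * e + 1))

second-bracket : ∀ {b a s} → 2 ≤ b → IsTrottCF b a → b ≡ a 0 * a 0 + s → Bracket (a 0) s (a 1) (b ^ len b (a 1))
second-bracket {b} {a} {s} 2≤b trott eq =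
  +-cancelˡ-≤ (suc e * (k * k * β)) _ _ (begin
    suc e * (k * k * β) + (k * β + e * (k * suc e + 1)) ≡⟨ e₁ k e β ⟩
    (k * β + e) * (k * suc e + 1) ≡⟨ cong (_* (k * suc e + 1)) (sym N≡) ⟩
    truncNum b a (suc n) * (k * suc e + 1) ≤⟨ lower-end-bound trott (suc n) ⟩
    suc e * (b * β) ≡⟨ cong (λ z → suc e * (z * β)) eq ⟩
    suc e * ((k * k + s) * β) ≡⟨ e₂ k e β s ⟩
    suc e * (k * k * β) + suc e * (s * β) ∎) ,
  +-cancelˡ-≤ (e * (k * k * β)) _ _ (begin
    e * (k * k * β) + e * (s * β) ≡⟨ e₃ k e β s ⟩
    e * ((k * k + s) * β) ≡⟨ cong (λ z → e * (z * β)) (sym eq) ⟩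
    e * (b * β) ≤⟨ upper-end-bound trott (suc n) ⟩
    suc (truncNum b a (suc n)) * (k * e + 1) ≡⟨ cong (λ z → suc z * (k * e + 1)) N≡ ⟩
    suc (k * β + e) * (k * e + 1) ≡⟨ e₄ k e β ⟩
    e * (k * k * β) + (k * β + suc e * (k * e + 1)) ∎)
  where
  open ≤-Reasoning
  k = a 0
  e = a 1
  n = len b e
  β = b ^ n
  N≡ = truncNum-second 2≤b trott
  e₁ : ∀ k e β → suc e * (k * k * β) + (k * β + e * (k * suc e + 1)) ≡ (k * β + e) * (k * suc e + 1)
  e₁ = solve-∀
  e₂ : ∀ k e β s → suc e * ((k * k + s) * β) ≡ suc e * (k * k * β) + suc e * (s * β)
  e₂ = solve-∀
  e₃ : ∀ k e β s → e * (k * k * β) + e * (s * β) ≡ e * ((k * k + s) * β)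
  e₃ = solve-∀
  e₄ : ∀ k e β → suc (k * β + e) * (k * e + 1) ≡ e * (k * k * β) + (k * β + suc e * (k * e + 1))
  e₄ = solve-∀

module _ {b c : ℕ} {a : ℕ → ℕ} (2≤b : 2 ≤ b) (b<c : b < c) (trottB : IsTrottCF b a) (trottC : IsTrottCF c a) where
  private
    k = a 0
    e = a 1
    n = len b e
    m = len c e
    1≤a = proj₁ trottB
    2≤c : 2 ≤ c
    2≤c = ≤-trans 2≤b (<⇒≤ b<c)

  second-compatible : (k * b ^ n + e) * c ^ suc m ≤ suc (k * c ^ m + e) * b ^ suc n
  second-compatible = subst₂ (λ x y → x * c ^ suc m ≤ suc y * b ^ suc n)
    (truncNum-second 2≤b trottB) (truncNum-second 2≤c trottC)
    (intervals-compatible trottB trottC (suc n) (suc m))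

  -- If `e < b`, then `k` and `e` are single digits in both bases, and the two-digit number they
  -- form in the smaller base `b` already exceeds the upper end `(kc + e + 1)/c²` allowed by base
  -- `c`.
  second≥b : b ≤ e
  second≥b = ≮⇒≥ λ e<b → <-irrefl refl (begin-strict
    b * (b * c * k) + (b * b + e * (b * b)) <⟨ +-monoʳ-< (b * (b * c * k)) (+-monoˡ-< (e * (b * b)) (*-monoʳ-< b {{>-nonZero (≤-trans (s≤s z≤n) 2≤b)}} b<c)) ⟩
    b * (b * c * k) + (b * c + e * (b * b)) ≤⟨ +-monoʳ-≤ (b * (b * c * k)) (+-mono-≤ (m≤m*n (b * c) k {{>-nonZero (1≤a 0)}}) (*-monoʳ-≤ e (*-mono-≤ (<⇒≤ b<c) (<⇒≤ b<c)))) ⟩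
    b * (b * c * k) + (b * c * k + e * (c * c)) ≡⟨ e₁ b c k e ⟩
    suc b * (b * c * k) + e * (c * c) ≤⟨ +-monoˡ-≤ (e * (c * c)) (*-monoˡ-≤ (b * c * k) b<c) ⟩
    c * (b * c * k) + e * (c * c) ≡⟨ e₂ b c k e ⟩
    (k * b ^ 1 + e) * c ^ 2 ≤⟨ subst₂ (λ x y → (k * b ^ x + e) * c ^ suc y ≤ suc (k * c ^ y + e) * b ^ suc x)
                                                            (len-small 2≤b trottB e (1≤a 1) e<b) (len-small 2≤c trottC e (1≤a 1) (<-trans e<b b<c)) second-compatible ⟩
    suc (k * c ^ 1 + e) * b ^ 2 ≡⟨ e₃ b c k e ⟩
    b * (b * c * k) + (b * b + e * (b * b)) ∎)
    where
    open ≤-Reasoning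
    e₁ : ∀ b c k e → b * (b * c * k) + (b * c * k + e * (c * c)) ≡ suc b * (b * c * k) + e * (c * c)
    e₁ = solve-∀
    e₂ : ∀ b c k e → c * (b * c * k) + e * (c * c) ≡ (k * (b * 1) + e) * (c * (c * 1))
    e₂ = solve-∀
    e₃ : ∀ b c k e → suc (k * (c * 1) + e) * (b * (b * 1)) ≡ b * (b * c * k) + (b * b + e * (b * b))
    e₃ = solve-∀

-- This settles the exceptional element 3. The base 3 bracket leaves `e ≤ 2`, and for these `e` the
-- digit intervals in the two bases do not meet.
no-common-2-3 : ∀ {a} → IsTrottCF 2 a → IsTrottCF 3 a → a 0 ≡ 1 → ⊥
no-common-2-3 {a} trott₂ trott₃ a₀ = go (a 1) refl e≤2
  where
  e = a 1
  γ = 3 ^ len 3 e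
  2≤3 : 2 ≤ 3
  2≤3 = s≤s (s≤s z≤n)
  bracket : Bracket 1 2 e γ
  bracket = subst (λ k → Bracket k 2 e γ) a₀ (second-bracket 2≤3 trott₃ (cong (λ k → k * k + 2) (sym a₀)))
  e<γ : e < γ
  e<γ = <b^len 2≤3 e
  e≤2 : e ≤ 2
  e≤2 = +-cancelˡ-≤ e _ _ (*-cancelʳ-≤ (e + e) (e + 2) γ {{>-nonZero (≤-trans (s≤s z≤n) e<γ)}} (begin
    (e + e) * γ ≡⟨ e₁ e γ ⟩
    e * (2 * γ) ≤⟨ proj₂ bracket ⟩
    1 * γ + suc e * (1 * e + 1) ≡⟨ e₂ e γ ⟩
    γ + suc e * suc e ≤⟨ +-monoʳ-≤ γ (*-monoʳ-≤ (suc e) e<γ) ⟩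
    γ + suc e * γ ≡⟨ e₃ e γ ⟩
    (e + 2) * γ ∎))
    where
    open ≤-Reasoning
    e₁ : ∀ e γ → (e + e) * γ ≡ e * (2 * γ)
    e₁ = solve-∀
    e₂ : ∀ e γ → 1 * γ + suc e * (1 * e + 1) ≡ γ + suc e * suc e
    e₂ = solve-∀
    e₃ : ∀ e γ → γ + suc e * γ ≡ (e + 2) * γ
    e₃ = solve-∀
  Compatible : ℕ → Set
  Compatible x = (1 * 2 ^ len 2 x + x) * 3 ^ suc (len 3 x) ≤ suc (1 * 3 ^ len 3 x + x) * 2 ^ suc (len 2 x)
  compatible : Compatible e
  compatible = subst (λ k → (k * 2 ^ len 2 e + e) * 3 ^ suc (len 3 e) ≤ suc (k * 3 ^ len 3 e + e) * 2 ^ suc (len 2 e)) a₀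
    (second-compatible ≤-refl ≤-refl trott₂ trott₃)
  go : ∀ x → e ≡ x → x ≤ 2 → ⊥
  go 0 eq _ = <⇒≱ (proj₁ trott₂ 1) (≤-reflexive eq)
  go 1 eq _ = from-no (27 ≤? 20) (subst Compatible eq compatible)
  go 2 eq _ = from-no (54 ≤? 48) (subst Compatible eq compatible)
  go (suc (suc (suc _))) _ (s≤s (s≤s ()))

-- From the brackets to two nearly equal multiples of powers

crude : ℕ → ℕ
crude k = 2 * (k * k) + 2 * k + 3

-- Polynomial inequalities are refuted by certificates: after substitutions such as `e = 2k + f` the
-- difference has natural coefficients, and the ring solver checks the identity.
excess-absurd : ∀ {A B} D → A ≡ B + suc D → A ≤ B → ⊥
excess-absurd {A} {B} D eq A≤B = <⇒≱ (m<m+n B (s≤s z≤n)) (≤-trans (≤-reflexive (sym eq)) A≤B)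

module _ {k s e β : ℕ} (bracket : Bracket k s e β) where

  bracket-lower : k * e ≤ s * β
  bracket-lower = *-cancelˡ-≤ (suc e) (begin
    suc e * (k * e) ≤⟨ m≤m+n _ (k * β + e) ⟩
    suc e * (k * e) + (k * β + e) ≡⟨ lemma k e β ⟩
    k * β + e * (k * suc e + 1) ≤⟨ proj₁ bracket ⟩
    suc e * (s * β) ∎)
    where
    open ≤-Reasoning
    lemma : ∀ k e β → suc e * (k * e) + (k * β + e) ≡ k * β + e * (k * suc e + 1)
    lemma = solve-∀

  -- Bounding `kβ` by `k(sβ)` gives `sβ ≤ (e+1)(ke+1)/(e−k)`. The excess of this over `ke` is
  -- `((k²+k+1)e+1)/(e−k)`, which decreases in `e`; `crude k` is its value at `e = 2k`, rounded up.
  bracket-crude : 1 ≤ s → 1 ≤ k → 2 * k ≤ e → s * β ≤ k * e + crude k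
  bracket-crude 1≤s (s≤s {n = j} _) 2k≤e = ≮⇒≥ λ h →
    absurd (e ∸ 2 * k) (s * β ∸ suc (k * e + crude k)) (sym (m+[n∸m]≡n 2k≤e)) (sym (m+[n∸m]≡n h))
    where
    main : e * (s * β) ≤ k * (s * β) + suc e * (k * e + 1)
    main = ≤-trans (proj₂ bracket) (+-monoˡ-≤ _ (*-monoʳ-≤ k (m≤n*m β s {{>-nonZero 1≤s}})))
    identity : ∀ j f z → let k = suc j; e = 2 * k + f; Y = suc (k * e + (2 * (k * k) + 2 * k + 3)) + z in
      e * Y ≡ k * Y + suc e * (k * e + 1) + suc (k * k * f + 2 * j + k * f + 3 * f + (k + f) * z)
    identity = solve-∀
    absurd : ∀ f z → e ≡ 2 * k + f → s * β ≡ suc (k * e + crude k) + z → ⊥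
    absurd f z refl Y≡ = excess-absurd _
      (subst (λ Y → e * Y ≡ k * Y + suc e * (k * e + 1) + suc (k * k * f + 2 * j + k * f + 3 * f + (k + f) * z))
        (sym Y≡) (identity j f z))
      main

-- As soon as e exceeds k·crude k + s, the brackets pin down s²β up to an error sk.
Approximation : (k s e β : ℕ) → Set
Approximation k s e β = (s * (k * e) + (k * k + s) ≤ s * (s * β)) × (s * (s * β) ≤ s * (k * e) + (k * k + s + s * k))

-- Multiply the brackets by `s` and insert the first-order bounds `ke ≤ sβ ≤ ke + crude k` into the
-- term `skβ`. The remaining errors are `(k² + s)/(e+1)` and `(k·crude k + s)/e`; both are below 1,
-- so integrality removes them.
approximation : ∀ {k s e β} → Bracket k s e β → s * β ≤ k * e + crude k → k * crude k + s < e → Approximation k s e β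
approximation {k} {s} {e} {β} bracket bound large = ≮⇒≥ (λ h → lower (m+[n∸m]≡n h)) , ≮⇒≥ (λ h → upper (m+[n∸m]≡n h))
  where
  open ≤-Reasoning
  Y = s * β
  lower : suc (s * Y) + (s * (k * e) + (k * k + s) ∸ suc (s * Y)) ≡ s * (k * e) + (k * k + s) → ⊥
  lower h = <⇒≱ large (≤-trans (≤-pred step) bnd)
    where
    z = s * (k * e) + (k * k + s) ∸ suc (s * Y)
    bnd : k * k + s ≤ k * crude k + s
    bnd = +-monoˡ-≤ s (*-monoʳ-≤ k (≤-trans (m≤m+n k (k + 0)) (≤-trans (m≤n+m (2 * k) (2 * (k * k))) (m≤m+n _ 3))))
    e₁ : ∀ k s e → suc e * (s * (k * e)) + e * (k * k) + s * e + suc e ≡ k * (k * e) + s * (e * (k * suc e + 1)) + suc e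
    e₁ = solve-∀
    e₂ : ∀ k s e β → k * (s * β) + s * (e * (k * suc e + 1)) + suc e ≡ s * (k * β + e * (k * suc e + 1)) + suc e
    e₂ = solve-∀
    e₃ : ∀ s e Y → s * (suc e * Y) + suc e ≡ suc e * suc (s * Y)
    e₃ = solve-∀
    e₄ : ∀ k s e → suc e * (s * (k * e) + (k * k + s)) ≡ suc e * (s * (k * e)) + e * (k * k) + s * e + (k * k + s)
    e₄ = solve-∀
    step : suc e ≤ suc (k * k + s)
    step = ≤-trans (+-cancelˡ-≤ (suc e * (s * (k * e)) + e * (k * k) + s * e) _ _ (begin
      suc e * (s * (k * e)) + e * (k * k) + s * e + suc e ≡⟨ e₁ k s e ⟩
      k * (k * e) + s * (e * (k * suc e + 1)) + suc e ≤⟨ +-monoˡ-≤ (suc e) (+-monoˡ-≤ _ (*-monoʳ-≤ k (bracket-lower {k} {s} {e} {β} bracket))) ⟩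
      k * (s * β) + s * (e * (k * suc e + 1)) + suc e ≡⟨ e₂ k s e β ⟩
      s * (k * β + e * (k * suc e + 1)) + suc e ≤⟨ +-monoˡ-≤ (suc e) (*-monoʳ-≤ s (proj₁ bracket)) ⟩
      s * (suc e * Y) + suc e ≡⟨ e₃ s e Y ⟩
      suc e * suc (s * Y) ≤⟨ *-monoʳ-≤ (suc e) (m≤m+n _ z) ⟩
      suc e * (suc (s * Y) + z) ≡⟨ cong (suc e *_) h ⟩
      suc e * (s * (k * e) + (k * k + s)) ≡⟨ e₄ k s e ⟩
      suc e * (s * (k * e)) + e * (k * k) + s * e + (k * k + s) ∎)) (n≤1+n _)
  upper : suc (s * (k * e) + (k * k + s + s * k)) + (s * Y ∸ suc (s * (k * e) + (k * k + s + s * k))) ≡ s * Y → ⊥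
  upper h = <⇒≱ large (+-cancelˡ-≤ (e * (s * (k * e) + (k * k + s + s * k))) _ _ (begin
      e * (s * (k * e) + (k * k + s + s * k)) + e ≡⟨ e₁ e (s * (k * e) + (k * k + s + s * k)) ⟩
      e * suc (s * (k * e) + (k * k + s + s * k)) ≤⟨ *-monoʳ-≤ e (m≤m+n _ z) ⟩
      e * (suc (s * (k * e) + (k * k + s + s * k)) + z) ≡⟨ cong (e *_) h ⟩
      e * (s * Y) ≡⟨ e₂ e s Y ⟩
      s * (e * Y) ≤⟨ *-monoʳ-≤ s (proj₂ bracket) ⟩
      s * (k * β + suc e * (k * e + 1)) ≡⟨ e₃ s k β e ⟩
      k * (s * β) + s * (suc e * (k * e + 1)) ≤⟨ +-monoˡ-≤ _ (*-monoʳ-≤ k bound) ⟩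
      k * (k * e + crude k) + s * (suc e * (k * e + 1)) ≡⟨ e₄ k e (crude k) s ⟩
      e * (s * (k * e) + (k * k + s + s * k)) + (k * crude k + s) ∎))
    where
    z = s * Y ∸ suc (s * (k * e) + (k * k + s + s * k))
    e₁ : ∀ e X → e * X + e ≡ e * suc X
    e₁ = solve-∀
    e₂ : ∀ e s Y → e * (s * Y) ≡ s * (e * Y)
    e₂ = solve-∀
    e₃ : ∀ s k β e → s * (k * β + suc e * (k * e + 1)) ≡ k * (s * β) + s * (suc e * (k * e + 1))
    e₃ = solve-∀
    e₄ : ∀ k e y s → k * (k * e + y) + s * (suc e * (k * e + 1)) ≡ e * (s * (k * e) + (k * k + s + s * k)) + (k * y + s)
    e₄ = solve-∀

-- With D = t cᵐ − s bⁿ, where b = k² + s and c = k² + t, the two bounds say |s t D + k² (t − s)| ≤ k s t.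
record NearPowers (k s t m n : ℕ) : Set where
  field
    2≤k : 2 ≤ k
    1≤s : 1 ≤ s
    s<t : s < t
    t≤k : t ≤ k
    2<m : 2 < m
    m<n : m < n
    D-lower : s * t * (s * (k * k + s) ^ n) + s * (k * k) ≤ s * t * (t * (k * k + t) ^ m) + (t * (k * k) + s * t * k)
    D-upper : s * t * (t * (k * k + t) ^ m) + t * (k * k) ≤ s * t * (s * (k * k + s) ^ n) + (s * (k * k) + s * t * k)

^-cancel-exponent : ∀ {b i j} → 2 ≤ b → b ^ i < b ^ j → i < j
^-cancel-exponent {b} {i} {j} 2≤b p = ≰⇒> λ j≤i → <⇒≱ p (^-monoʳ-≤ b {{>-nonZero (≤-trans (s≤s z≤n) 2≤b)}} j≤i)

square-bound : ∀ {k s} → 2 ≤ k → 1 ≤ s → let b = k * k + s in k * b + (k * k * k + k * k + 2) ≤ b * b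
square-bound (s≤s (s≤s {n = j} _)) (s≤s {n = u} _) = ≤-trans (m≤m+n _ _) (≤-reflexive (sym (identity j u)))
  where
  identity : ∀ j u → let k = suc (suc j); b = k * k + suc u in
    b * b ≡ k * b + (k * k * k + k * k + 2) + (u * u + u * (2 * (j * j) + 7 * j + 8) + (k * k * k * j + (j * j + 3 * j + 1)))
  identity = solve-∀

crude<k⁴ : ∀ {k} → 2 ≤ k → crude k < k * k * (k * k)
crude<k⁴ (s≤s (s≤s {n = j} _)) = ≤-trans (m≤m+n _ _) (≤-reflexive (sym (identity j)))
  where
  identity : ∀ j → let k = suc (suc j) in
    k * k * (k * k) ≡ suc (2 * (k * k) + 2 * k + 3) + (j * j * (j * j) + 8 * (j * j * j) + 22 * (j * j) + 22 * j)
  identity = solve-∀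

cube-bound : ∀ {k} → 2 ≤ k → let d = k * k + k in k * (d * d) + crude k < (k * k + 1) * ((k * k + 1) * (k * k + 1))
cube-bound (s≤s (s≤s {n = j} _)) = ≤-trans (m≤m+n _ _) (≤-reflexive (sym (identity j)))
  where
  identity : ∀ j → let k = suc (suc j); d = k * k + k in
    (k * k + 1) * ((k * k + 1) * (k * k + 1)) ≡ suc (k * (d * d) + (2 * (k * k) + 2 * k + 3)) + (37 + 134 * (j) + 179 * (j * j) + 127 * (j * j * j) + 51 * (j * j * j * j) + 11 * (j * j * j * j * j) + 1 * (j * j * j * j * j * j))
  identity = solve-∀

fourth-bound : ∀ {k s} → 2 ≤ k → s ≤ k → k * crude k + s < (k * k + 2) * (k * k + 2)
fourth-bound {k} {s} 2≤k s≤k = ≤-trans (s≤s (+-monoʳ-≤ (k * crude k) s≤k)) (go 2≤k)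
  where
  identity : ∀ j → let k = suc (suc j) in
    (k * k + 2) * (k * k + 2) ≡ suc (k * (2 * (k * k) + 2 * k + 3) + k) + (3 + 12 * (j) + 14 * (j * j) + 6 * (j * j * j) + 1 * (j * j * j * j))
  identity = solve-∀
  go : ∀ {k} → 2 ≤ k → k * crude k + k < (k * k + 2) * (k * k + 2)
  go (s≤s (s≤s {n = j} _)) = ≤-trans (m≤m+n _ _) (≤-reflexive (sym (identity j)))

module _ {k s t e n m : ℕ} (2≤k : 2 ≤ k) (1≤s : 1 ≤ s) (s<t : s < t) (t≤k : t ≤ k)
         (bracketB : Bracket k s e ((k * k + s) ^ n)) (bracketC : Bracket k t e ((k * k + t) ^ m))
         (e<bⁿ : e < (k * k + s) ^ n) (bⁿ≤ : (k * k + s) ^ n ≤ e * (k * k + s))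
         (e<cᵐ : e < (k * k + t) ^ m) (cᵐ≤ : (k * k + t) ^ m ≤ e * (k * k + t)) (b≤e : k * k + s ≤ e) where
  private
    b c β γ : ℕ
    b = k * k + s
    c = k * k + t
    β = b ^ n
    γ = c ^ m
    1≤k : 1 ≤ k
    1≤k = ≤-trans (s≤s z≤n) 2≤k
    1≤t : 1 ≤ t
    1≤t = ≤-trans 1≤s (<⇒≤ s<t)
    b<c : b < c
    b<c = +-monoʳ-< (k * k) s<t
    kk<b : k * k < b
    kk<b = m<m+n (k * k) 1≤s
    2k≤b : 2 * k ≤ b
    2k≤b = ≤-trans (*-monoˡ-≤ k 2≤k) (<⇒≤ kk<b)
    2≤b : 2 ≤ b
    2≤b = ≤-trans 2≤k (≤-trans (m≤m+n k (k + 0)) 2k≤b)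
    2≤c : 2 ≤ c
    2≤c = ≤-trans 2≤b (<⇒≤ b<c)
    b-nonZero = >-nonZero (≤-trans (s≤s z≤n) 2≤b)
    c-nonZero = >-nonZero (≤-trans (s≤s z≤n) 2≤c)
    s≤k : s ≤ k
    s≤k = ≤-trans (<⇒≤ s<t) t≤k

  -- Needed for `m ≥ 2`. If `e < c ≤ b²`, the digit counts leave only `n = 2`; then `square-bound`
  -- and the base `b` bracket give `e ≤ 1`, against `b ≤ e`.
  second≥c : c ≤ e
  second≥c = ≮⇒≥ λ e<c → <⇒≱ (<-≤-trans (s≤s (s≤s z≤n)) (≤-trans 2≤b b≤e)) (e≤1 e<c)
    where
    open ≤-Reasoning
    n≡2 : e < c → n ≡ 2
    n≡2 e<c = ≤-antisym (≤-pred (^-cancel-exponent 2≤b (begin-strict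
        b ^ n ≤⟨ bⁿ≤ ⟩
        e * b <⟨ *-monoˡ-< b {{b-nonZero}} (<-≤-trans e<c c≤bb) ⟩
        b * b * b ≡⟨ cube b ⟩
        b ^ 3 ∎)))
      (^-cancel-exponent 2≤b (≤-<-trans (≤-trans (≤-reflexive (*-identityʳ b)) b≤e) e<bⁿ))
      where
      cube : ∀ b → b * b * b ≡ b * (b * (b * 1))
      cube = solve-∀
      c≤bb : c ≤ b * b
      c≤bb = begin
        k * k + t ≤⟨ +-mono-≤ (<⇒≤ kk<b) (≤-trans t≤k (≤-trans (m≤m*n k k {{>-nonZero 1≤k}}) (<⇒≤ kk<b))) ⟩
        b + b ≡⟨ cong (λ z → b + z) (sym (+-identityʳ b)) ⟩
        2 * b ≤⟨ *-monoˡ-≤ b 2≤b ⟩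
        b * b ∎
    e≤1 : e < c → e ≤ 1
    e≤1 e<c = +-cancelˡ-≤ (k * (b * b) + e * (k * k * k + k * k + 1)) _ _ (begin
      k * (b * b) + e * (k * k * k + k * k + 1) + e ≡⟨ e₁ k b e ⟩
      b * (k * b) + e * (k * k * k + k * k + 2) ≤⟨ +-monoˡ-≤ _ (*-monoˡ-≤ (k * b) b≤e) ⟩
      e * (k * b) + e * (k * k * k + k * k + 2) ≡⟨ sym (*-distribˡ-+ e (k * b) _) ⟩
      e * (k * b + (k * k * k + k * k + 2)) ≤⟨ *-monoʳ-≤ e (square-bound 2≤k 1≤s) ⟩
      e * (b * b) ≤⟨ *-monoʳ-≤ e (m≤n*m (b * b) s {{>-nonZero 1≤s}}) ⟩
      e * (s * (b * b)) ≤⟨ subst (λ x → e * (s * x) ≤ k * x + suc e * (k * e + 1)) b²≡ (proj₂ bracketB) ⟩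
      k * (b * b) + suc e * (k * e + 1) ≡⟨ e₂ k (b * b) e ⟩
      k * (b * b) + (e * (k * suc e + 1) + 1) ≤⟨ +-monoʳ-≤ (k * (b * b)) (+-monoˡ-≤ 1 (*-monoʳ-≤ e (+-monoˡ-≤ 1 (*-monoʳ-≤ k (≤-trans e<c (+-monoʳ-≤ (k * k) t≤k)))))) ⟩
      k * (b * b) + (e * (k * (k * k + k) + 1) + 1) ≡⟨ e₃ k (b * b) e ⟩
      k * (b * b) + e * (k * k * k + k * k + 1) + 1 ∎)
      where
      b²≡ : b ^ n ≡ b * b
      b²≡ = trans (cong (b ^_) (n≡2 e<c)) (cong (b *_) (*-identityʳ b))
      e₁ : ∀ k b e → k * (b * b) + e * (k * k * k + k * k + 1) + e ≡ b * (k * b) + e * (k * k * k + k * k + 2)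
      e₁ = solve-∀
      e₂ : ∀ k B e → k * B + suc e * (k * e + 1) ≡ k * B + (e * (k * suc e + 1) + 1)
      e₂ = solve-∀
      e₃ : ∀ k B e → k * B + (e * (k * (k * k + k) + 1) + 1) ≡ k * B + e * (k * k * k + k * k + 1) + 1
      e₃ = solve-∀

  private
    2k≤e : 2 * k ≤ e
    2k≤e = ≤-trans 2k≤b b≤e
    sβ≤ : s * β ≤ k * e + crude k
    sβ≤ = bracket-crude {k} {s} {e} {β} bracketB 1≤s 1≤k 2k≤e
    tγ≤ : t * γ ≤ k * e + crude k
    tγ≤ = bracket-crude {k} {t} {e} {γ} bracketC 1≤t 1≤k 2k≤e
    1<m : 1 < m
    1<m = ^-cancel-exponent 2≤c (≤-<-trans (≤-trans (≤-reflexive (*-identityʳ c)) second≥c) e<cᵐ)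

  -- If `n ≤ m`, then `bⁿ ≤ cᵐ`. As `t cᵐ ≤ s bⁿ + crude k` and `t > s`, this leaves `cᵐ ≤ crude k`,
  -- although `cᵐ ≥ k⁴`.
  exponents-ordered : m < n
  exponents-ordered = ≰⇒> λ n≤m → <⇒≱ (crude<k⁴ 2≤k) (begin
    k * k * (k * k) ≤⟨ *-mono-≤ (m≤m+n (k * k) t) (≤-trans (m≤m+n (k * k) t) (≤-reflexive (sym (*-identityʳ c)))) ⟩
    c ^ 2 ≤⟨ ^-monoʳ-≤ c {{c-nonZero}} 1<m ⟩
    γ ≤⟨ +-cancelˡ-≤ (s * γ) _ _ (begin
       s * γ + γ ≡⟨ +-comm (s * γ) γ ⟩
       suc s * γ ≤⟨ *-monoˡ-≤ γ s<t ⟩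
       t * γ ≤⟨ tγ≤ ⟩
       k * e + crude k ≤⟨ +-monoˡ-≤ (crude k) (bracket-lower {k} {s} {e} {β} bracketB) ⟩
       s * β + crude k ≤⟨ +-monoˡ-≤ (crude k) (*-monoʳ-≤ s (≤-trans (^-monoˡ-≤ n (<⇒≤ b<c)) (^-monoʳ-≤ c {{c-nonZero}} n≤m))) ⟩
       s * γ + crude k ∎) ⟩
    crude k ∎)
    where open ≤-Reasoning

  -- For `m = 2` one has `n ≥ 3`, so `b³ ≤ s bⁿ ≤ ke + crude k` with `e < c²`: order `k⁶` against
  -- order `k⁵`. Having `m ≥ 3` yields `e ≥ c²`, large enough for `approximation`.
  exponent>2 : 2 < m
  exponent>2 = ≤∧≢⇒< 1<m λ 2≡m → <⇒≱ (cube-bound 2≤k) (begin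
    (k * k + 1) * ((k * k + 1) * (k * k + 1)) ≡⟨ cube (k * k + 1) ⟩
    (k * k + 1) ^ 3 ≤⟨ ^-monoˡ-≤ 3 (+-monoʳ-≤ (k * k) 1≤s) ⟩
    b ^ 3 ≤⟨ ^-monoʳ-≤ b {{b-nonZero}} (subst (_< n) (sym 2≡m) exponents-ordered) ⟩
    β ≤⟨ m≤n*m β s {{>-nonZero 1≤s}} ⟩
    s * β ≤⟨ sβ≤ ⟩
    k * e + crude k ≤⟨ +-monoˡ-≤ (crude k) (*-monoʳ-≤ k (<⇒≤ e<cᵐ)) ⟩
    k * c ^ m + crude k ≡⟨ cong (λ x → k * c ^ x + crude k) (sym 2≡m) ⟩
    k * (c * (c * 1)) + crude k ≤⟨ +-monoˡ-≤ (crude k) (*-monoʳ-≤ k (*-mono-≤ c≤ (≤-trans (≤-reflexive (*-identityʳ c)) c≤))) ⟩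
    k * ((k * k + k) * (k * k + k)) + crude k ∎)
    where
    open ≤-Reasoning
    c≤ : c ≤ k * k + k
    c≤ = +-monoʳ-≤ (k * k) t≤k
    cube : ∀ b → b * (b * b) ≡ b * (b * (b * 1))
    cube = solve-∀

  -- The unknown `e` is eliminated: `t` times `approxB` and `s` times `approxC` both approximate
  -- `stke`.
  nearPowers : NearPowers k s t m n
  nearPowers = record
    { 2≤k = 2≤k ; 1≤s = 1≤s ; s<t = s<t ; t≤k = t≤k ; 2<m = exponent>2 ; m<n = exponents-ordered
    ; D-lower = begin
        s * t * (s * β) + s * (k * k) ≡⟨ e₁ s t (s * β) k ⟩
        t * (s * (s * β)) + s * (k * k) ≤⟨ +-monoˡ-≤ (s * (k * k)) (*-monoʳ-≤ t (proj₂ approxB)) ⟩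
        t * (s * (k * e) + (k * k + s + s * k)) + s * (k * k) ≡⟨ e₂ t s k e ⟩
        s * (t * (k * e) + (k * k + t)) + (t * (k * k) + s * t * k) ≤⟨ +-monoˡ-≤ _ (*-monoʳ-≤ s (proj₁ approxC)) ⟩
        s * (t * (t * γ)) + (t * (k * k) + s * t * k) ≡⟨ cong (_+ (t * (k * k) + s * t * k)) (sym (*-assoc s t (t * γ))) ⟩
        s * t * (t * γ) + (t * (k * k) + s * t * k) ∎
    ; D-upper = begin
        s * t * (t * γ) + t * (k * k) ≡⟨ cong (_+ t * (k * k)) (*-assoc s t (t * γ)) ⟩
        s * (t * (t * γ)) + t * (k * k) ≤⟨ +-monoˡ-≤ (t * (k * k)) (*-monoʳ-≤ s (proj₂ approxC)) ⟩
        s * (t * (k * e) + (k * k + t + t * k)) + t * (k * k) ≡⟨ e₃ t s k e ⟩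
        t * (s * (k * e) + (k * k + s)) + (s * (k * k) + s * t * k) ≤⟨ +-monoˡ-≤ _ (*-monoʳ-≤ t (proj₁ approxB)) ⟩
        t * (s * (s * β)) + (s * (k * k) + s * t * k) ≡⟨ e₄ t s (s * β) k ⟩
        s * t * (s * β) + (s * (k * k) + s * t * k) ∎
    }
    where
    open ≤-Reasoning
    e₁ : ∀ s t Y k → s * t * Y + s * (k * k) ≡ t * (s * Y) + s * (k * k)
    e₁ = solve-∀
    e₂ : ∀ t s k e → t * (s * (k * e) + (k * k + s + s * k)) + s * (k * k) ≡ s * (t * (k * e) + (k * k + t)) + (t * (k * k) + s * t * k)
    e₂ = solve-∀
    e₃ : ∀ t s k e → s * (t * (k * e) + (k * k + t + t * k)) + t * (k * k) ≡ t * (s * (k * e) + (k * k + s)) + (s * (k * k) + s * t * k)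
    e₃ = solve-∀
    e₄ : ∀ t s Y k → t * (s * Y) + (s * (k * k) + s * t * k) ≡ s * t * Y + (s * (k * k) + s * t * k)
    e₄ = solve-∀
    c²≤e : c * c ≤ e
    c²≤e = *-cancelˡ-≤ c {{c-nonZero}} (begin
      c * (c * c) ≡⟨ cong (λ x → c * (c * x)) (sym (*-identityʳ c)) ⟩
      c ^ 3 ≤⟨ ^-monoʳ-≤ c {{c-nonZero}} exponent>2 ⟩
      c ^ m ≤⟨ cᵐ≤ ⟩
      e * c ≡⟨ *-comm e c ⟩
      c * e ∎)
    c≥ : k * k + 2 ≤ c
    c≥ = +-monoʳ-≤ (k * k) (≤-trans (s≤s 1≤s) s<t)
    large : ∀ {x} → x ≤ k → k * crude k + x < e
    large x≤k = <-≤-trans (fourth-bound 2≤k x≤k) (≤-trans (*-mono-≤ c≥ c≥) c²≤e)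
    approxB : Approximation k s e β
    approxB = approximation {k} {s} {e} {β} bracketB sβ≤ (large s≤k)
    approxC : Approximation k t e γ
    approxC = approximation {k} {t} {e} {γ} bracketC tγ≤ (large t≤k)

common-trott : ∀ {b c a} → InΓ b → InΓ c → b < c → IsTrottCF b a → IsTrottCF c a →
  isqrt b ≡ isqrt c × ∃[ k ] ∃[ s ] ∃[ t ] ∃[ m ] ∃[ n ] (b ≡ k * k + s × c ≡ k * k + t × NearPowers k s t m n)
common-trott {b} {c} {a} Γb Γc b<c trottB trottC with Γ-form Γb | Γ-form Γc
... | k , s , refl , 1≤k , 1≤s , s≤k | k' , t , refl , 1≤k' , 1≤t , t≤k' =
  trans (isqrt≡ 1≤k s≤k) (trans (trans (sym a₀≡k) a₀≡k') (sym (isqrt≡ 1≤k' t≤k'))) , result (trans (sym a₀≡k) a₀≡k')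
  where
  base≥2 : ∀ {k s} → 1 ≤ k → 1 ≤ s → 2 ≤ k * k + s
  base≥2 1≤k 1≤s = +-mono-≤ (*-mono-≤ 1≤k 1≤k) 1≤s
  2≤b = base≥2 1≤k 1≤s
  2≤c = base≥2 1≤k' 1≤t
  isqrt≡ : ∀ {k s} → 1 ≤ k → s ≤ k ⊎ k ≡ 1 × s ≡ 2 → isqrt (k * k + s) ≡ k
  isqrt≡ {k} {s} 1≤k s≤k = sqrt-unique (m≤m+n _ s) (Γ-upper 1≤k s≤k) (proj₁ (isqrt-spec _)) (proj₂ (isqrt-spec _))
  first≡ : ∀ {k s} → 1 ≤ k → 1 ≤ s → s ≤ k ⊎ k ≡ 1 × s ≡ 2 → IsTrottCF (k * k + s) a → a 0 ≡ k
  first≡ {k} {s} 1≤k 1≤s s≤k trott with first-sqrt (base≥2 1≤k 1≤s) trott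
  ... | lo , hi = ≤-antisym
    (≤-pred (square-cancel-< (<-trans lo (Γ-upper 1≤k s≤k))))
    (≤-pred (square-cancel-< (<-≤-trans (m<m+n (k * k) 1≤s) hi)))
  a₀≡k = first≡ 1≤k 1≤s s≤k trottB
  a₀≡k' = first≡ 1≤k' 1≤t t≤k' trottC
  e = a 1
  1≤e = proj₁ trottB 1
  result : k ≡ k' → ∃[ K ] ∃[ s' ] ∃[ t' ] ∃[ m ] ∃[ n ] (k * k + s ≡ K * K + s' × k' * k' + t ≡ K * K + t' × NearPowers K s' t' m n)
  result refl = k , s , t , len c e , len b e , refl , refl ,
    nearPowers (proj₁ k-large) 1≤s s<t (proj₂ k-large)
      (subst (λ x → Bracket x s e (b ^ len b e)) a₀≡k (second-bracket 2≤b trottB (cong (λ x → x * x + s) (sym a₀≡k))))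
      (subst (λ x → Bracket x t e (c ^ len c e)) a₀≡k (second-bracket 2≤c trottC (cong (λ x → x * x + t) (sym a₀≡k))))
      (<b^len 2≤b e) (b^len≤ 2≤b e 1≤e) (<b^len 2≤c e) (b^len≤ 2≤c e 1≤e) (second≥b 2≤b b<c trottB trottC)
    where
    s<t : s < t
    s<t = +-cancelˡ-< (k * k) s t b<c
    k-large : 2 ≤ k × t ≤ k
    k-large = go k s t 1≤k 1≤s s<t s≤k t≤k' trottB trottC a₀≡k
      where
      -- The excess exceeds `k` only for the element 3. Since `s < t`, here 3 can only be `c`, and
      -- then `b = 2`.
      go : ∀ k s t → 1 ≤ k → 1 ≤ s → s < t → s ≤ k ⊎ k ≡ 1 × s ≡ 2 → t ≤ k ⊎ k ≡ 1 × t ≡ 2 →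
        IsTrottCF (k * k + s) a → IsTrottCF (k * k + t) a → a 0 ≡ k → 2 ≤ k × t ≤ k
      go k s t _ 1≤s s<t _ (inj₁ t≤k) _ _ _ = ≤-trans (s≤s 1≤s) (≤-trans s<t t≤k) , t≤k
      go _ 1 _ _ _ _ _ (inj₂ (refl , refl)) trottB trottC a₀ = ⊥-elim (no-common-2-3 trottB trottC a₀)
      go _ (suc (suc s)) _ _ _ (s≤s (s≤s ())) _ (inj₂ (refl , refl)) _ _ _

-- Divided differences

ℤ-*-nonNeg : ∀ {x y} → 0ℤ ℤ.≤ x → 0ℤ ℤ.≤ y → 0ℤ ℤ.≤ x ℤ.* y
ℤ-*-nonNeg {x} {y} 0≤x 0≤y = subst (ℤ._≤ x ℤ.* y) (ℤ.*-zeroʳ x) (ℤ.*-monoˡ-≤-nonNeg x {{ℤ.nonNegative 0≤x}} 0≤y)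

binom : ℕ → ℕ → ℤ
binom i x = + (x C i)

-- The usual absorption identity (i+1) C(x,i+1) = (x−i) C(x,i), over ℤ so that it also holds for x < i.
binom-step : ∀ i x → + suc i ℤ.* binom (suc i) x ≡ (+ x ℤ.- + i) ℤ.* binom i x
binom-step zero x = begin
  1ℤ ℤ.* + (x C 1) ≡⟨ cong (λ z → 1ℤ ℤ.* + z) (nC1≡n x) ⟩
  1ℤ ℤ.* + x ≡⟨ lemma (+ x) ⟩
  (+ x ℤ.- 0ℤ) ℤ.* 1ℤ ∎
  where
  open ≡-Reasoning
  lemma : ∀ x → 1ℤ ℤ.* x ≡ (x ℤ.- 0ℤ) ℤ.* 1ℤ
  lemma = ℤ-solve-∀
binom-step (suc i) zero = trans (ℤ.*-zeroʳ (+ suc (suc i))) (sym (ℤ.*-zeroʳ (0ℤ ℤ.- + suc i)))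
binom-step (suc i) (suc x) = begin
  + suc (suc i) ℤ.* binom (suc (suc i)) (suc x) ≡⟨ cong (+ suc (suc i) ℤ.*_) (pascal (suc i)) ⟩
  + suc (suc i) ℤ.* (B ℤ.+ E) ≡⟨ cong (ℤ._* (B ℤ.+ E)) (ℤ.pos-+ 1 (suc i)) ⟩
  (1ℤ ℤ.+ + suc i) ℤ.* (B ℤ.+ E) ≡⟨ e₁ (+ suc i) B E ⟩
  (1ℤ ℤ.+ + suc i) ℤ.* B ℤ.+ (1ℤ ℤ.+ + suc i) ℤ.* E ≡⟨ cong (λ z → (1ℤ ℤ.+ + suc i) ℤ.* B ℤ.+ z ℤ.* E) (sym (ℤ.pos-+ 1 (suc i))) ⟩
  (1ℤ ℤ.+ + suc i) ℤ.* B ℤ.+ + suc (suc i) ℤ.* E ≡⟨ cong (ℤ._+_ ((1ℤ ℤ.+ + suc i) ℤ.* B)) (binom-step (suc i) x) ⟩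
  (1ℤ ℤ.+ + suc i) ℤ.* B ℤ.+ (+ x ℤ.- + suc i) ℤ.* B ≡⟨ e₂ (+ suc i) B (+ x) ⟩
  + suc i ℤ.* B ℤ.+ (+ x ℤ.- + suc i ℤ.+ 1ℤ) ℤ.* B ≡⟨ cong₂ ℤ._+_ (binom-step i x) (cong (λ z → (+ x ℤ.- z ℤ.+ 1ℤ) ℤ.* B) (ℤ.pos-+ 1 i)) ⟩
  (+ x ℤ.- + i) ℤ.* A ℤ.+ (+ x ℤ.- (1ℤ ℤ.+ + i) ℤ.+ 1ℤ) ℤ.* B ≡⟨ e₃ (+ x) (+ i) A B ⟩
  ((1ℤ ℤ.+ + x) ℤ.- (1ℤ ℤ.+ + i)) ℤ.* (A ℤ.+ B) ≡⟨ cong₂ (λ y z → (y ℤ.- z) ℤ.* (A ℤ.+ B)) (sym (ℤ.pos-+ 1 x)) (sym (ℤ.pos-+ 1 i)) ⟩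
  (+ suc x ℤ.- + suc i) ℤ.* (A ℤ.+ B) ≡⟨ cong ((+ suc x ℤ.- + suc i) ℤ.*_) (sym (pascal i)) ⟩
  (+ suc x ℤ.- + suc i) ℤ.* binom (suc i) (suc x) ∎
  where
  open ≡-Reasoning
  A = binom i x
  B = binom (suc i) x
  E = binom (suc (suc i)) x
  pascal : ∀ i → binom (suc i) (suc x) ≡ binom i x ℤ.+ binom (suc i) x
  pascal i = trans (cong +_ (sym (nCk+nC[k+1]≡[n+1]C[k+1] x i))) (ℤ.pos-+ (x C i) (x C suc i))
  e₁ : ∀ i B E → (1ℤ ℤ.+ i) ℤ.* (B ℤ.+ E) ≡ (1ℤ ℤ.+ i) ℤ.* B ℤ.+ (1ℤ ℤ.+ i) ℤ.* E
  e₁ = ℤ-solve-∀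
  e₂ : ∀ i B x → (1ℤ ℤ.+ i) ℤ.* B ℤ.+ (x ℤ.- i) ℤ.* B ≡ i ℤ.* B ℤ.+ (x ℤ.- i ℤ.+ 1ℤ) ℤ.* B
  e₂ = ℤ-solve-∀
  e₃ : ∀ x i A B → (x ℤ.- i) ℤ.* A ℤ.+ (x ℤ.- (1ℤ ℤ.+ i) ℤ.+ 1ℤ) ℤ.* B ≡ ((1ℤ ℤ.+ x) ℤ.- (1ℤ ℤ.+ i)) ℤ.* (A ℤ.+ B)
  e₃ = ℤ-solve-∀

C-monoˡ-≤ : ∀ k {m n} → m ≤ n → m C k ≤ n C k
C-monoˡ-≤ k {m} {n} m≤n = subst (λ x → m C k ≤ x C k) (m∸n+n≡m m≤n) (go (n ∸ m))
  where
  step : ∀ k n → n C k ≤ suc n C k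
  step zero    n = ≤-refl
  step (suc k) n = ≤-trans (m≤n+m _ (n C k)) (≤-reflexive (nCk+nC[k+1]≡[n+1]C[k+1] n k))
  go : ∀ d → m C k ≤ (d + m) C k
  go zero    = ≤-refl
  go (suc d) = ≤-trans (go d) (step k (d + m))

-- Weighted nodes (x , w).  If w · ∏_{y ≠ x} (x − y) = L for every node, the functional f ↦ Σ w f(x)
-- is L times the divided difference of f over the nodes.  The factor π absorbs nodes already removed.
weigh : (ℤ → ℤ) → List (ℕ × ℤ) → (ℕ → ℤ) → ℤ
weigh π [] f = 0ℤ
weigh π ((x , w) ∷ S) f = w ℤ.* π (+ x) ℤ.* f x ℤ.+ weigh π S f

nodePoly : List (ℕ × ℤ) → ℤ → ℤ
nodePoly [] z = 1ℤ
nodePoly ((y , _) ∷ S) z = (z ℤ.- + y) ℤ.* nodePoly S z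

_∙[_] : (ℤ → ℤ) → ℕ → ℤ → ℤ
(π ∙[ s ]) z = π z ℤ.* (z ℤ.- + s)

data Weights (L : ℤ) : (ℤ → ℤ) → List (ℕ × ℤ) → Set where
  []  : ∀ {π} → Weights L π []
  _∷_ : ∀ {π x w S} → w ℤ.* π (+ x) ℤ.* nodePoly S (+ x) ≡ L → Weights L (π ∙[ x ]) S → Weights L π ((x , w) ∷ S)

weights-tail : ∀ {L π x w S} → Weights L π ((x , w) ∷ S) → Weights L (π ∙[ x ]) S
weights-tail (_ ∷ ws) = ws

-- Decreasing order puts the largest node `s` at the head. In the inductions below either
-- `s − i ≥ 0`, or every node is below `i` and the binomials vanish on all of them.
Below : ℕ → List (ℕ × ℤ) → Set
Below N [] = ⊤
Below N ((x , _) ∷ S) = (x < N) × Below x S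

Below-≤ : ∀ {M N} S → M ≤ N → Below M S → Below N S
Below-≤ [] M≤N _ = tt
Below-≤ (_ ∷ S) M≤N (x<M , desc) = <-≤-trans x<M M≤N , desc

weigh-cong : ∀ {π ρ} S {f g} → (∀ z → π z ≡ ρ z) → (∀ x → f x ≡ g x) → weigh π S f ≡ weigh ρ S g
weigh-cong [] _ _ = refl
weigh-cong ((x , w) ∷ S) p q = cong₂ ℤ._+_ (cong₂ (λ y z → w ℤ.* y ℤ.* z) (p (+ x)) (q x)) (weigh-cong S p q)

weigh-linear : ∀ π S a b f g → weigh π S (λ x → a ℤ.* f x ℤ.+ b ℤ.* g x) ≡ a ℤ.* weigh π S f ℤ.+ b ℤ.* weigh π S g
weigh-linear π [] a b f g = lemma a b
  where
  lemma : ∀ a b → 0ℤ ≡ a ℤ.* 0ℤ ℤ.+ b ℤ.* 0ℤ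
  lemma = ℤ-solve-∀
weigh-linear π ((x , w) ∷ S) a b f g = trans (cong (ℤ._+_ (w ℤ.* π (+ x) ℤ.* (a ℤ.* f x ℤ.+ b ℤ.* g x))) (weigh-linear π S a b f g))
  (lemma (w ℤ.* π (+ x)) a b (f x) (g x) (weigh π S f) (weigh π S g))
  where
  lemma : ∀ p a b f g F G → p ℤ.* (a ℤ.* f ℤ.+ b ℤ.* g) ℤ.+ (a ℤ.* F ℤ.+ b ℤ.* G) ≡ a ℤ.* (p ℤ.* f ℤ.+ F) ℤ.+ b ℤ.* (p ℤ.* g ℤ.+ G)
  lemma = ℤ-solve-∀

weigh-absorb : ∀ π S s f → weigh π S (λ x → (+ x ℤ.- + s) ℤ.* f x) ≡ weigh (π ∙[ s ]) S f
weigh-absorb π [] s f = refl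
weigh-absorb π ((x , w) ∷ S) s f = cong₂ ℤ._+_ (lemma w (π (+ x)) (+ x ℤ.- + s) (f x)) (weigh-absorb π S s f)
  where
  lemma : ∀ w p d f → w ℤ.* p ℤ.* (d ℤ.* f) ≡ w ℤ.* (p ℤ.* d) ℤ.* f
  lemma = ℤ-solve-∀

-- The factor `x − s` kills the node `s` and multiplies every other weight by just what restores the
-- normalisation `L` on the smaller node set. This drives all the inductions on nodes.
weigh-remove : ∀ π s w S f → weigh π ((s , w) ∷ S) (λ x → (+ x ℤ.- + s) ℤ.* f x) ≡ weigh (π ∙[ s ]) S f
weigh-remove π s w S f = trans (cong (ℤ._+ weigh π S _) (lemma (w ℤ.* π (+ s)) (+ s) (f s))) (trans (ℤ.+-identityˡ _) (weigh-absorb π S s f))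
  where
  lemma : ∀ p s f → p ℤ.* ((s ℤ.- s) ℤ.* f) ≡ 0ℤ
  lemma = ℤ-solve-∀

Weights-cong : ∀ {L π ρ} S → (∀ z → π z ≡ ρ z) → Weights L π S → Weights L ρ S
Weights-cong [] _ _ = []
Weights-cong ((x , w) ∷ S) p (eq ∷ ws) =
  trans (cong (λ y → w ℤ.* y ℤ.* nodePoly S (+ x)) (sym (p (+ x)))) eq ∷
  Weights-cong S (λ z → cong (ℤ._* (z ℤ.- + x)) (p z)) ws

Weights-remove-second : ∀ {L π} s w s' w' S → Weights L π ((s , w) ∷ (s' , w') ∷ S) → Weights L (π ∙[ s' ]) ((s , w) ∷ S)
Weights-remove-second {L} {π} s w s' w' S (eq ∷ _ ∷ ws) =
  trans (lemma w (π (+ s)) (+ s ℤ.- + s') (nodePoly S (+ s))) eq ∷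
  Weights-cong S (λ z → swap (π z) (z ℤ.- + s) (z ℤ.- + s')) ws
  where
  lemma : ∀ w p d P → w ℤ.* (p ℤ.* d) ℤ.* P ≡ w ℤ.* p ℤ.* (d ℤ.* P)
  lemma = ℤ-solve-∀
  swap : ∀ p d d' → p ℤ.* d ℤ.* d' ≡ p ℤ.* d' ℤ.* d
  swap = ℤ-solve-∀

one : ℕ → ℤ
one _ = 1ℤ

weigh-single : ∀ {L π} s w f → Weights L π ((s , w) ∷ []) → weigh π ((s , w) ∷ []) f ≡ L ℤ.* f s
weigh-single {L} {π} s w f (eq ∷ _) = trans (lemma (w ℤ.* π (+ s)) (f s)) (cong (ℤ._* f s) eq)
  where
  lemma : ∀ p f → p ℤ.* f ℤ.+ 0ℤ ≡ p ℤ.* 1ℤ ℤ.* f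
  lemma = ℤ-solve-∀

-- Removing either of two nodes s > s' gives the same value on constants, and the two
-- removals differ by (s' − s) times the functional.
weigh-one : ∀ {L N} π s w s' w' S → Weights L π ((s , w) ∷ (s' , w') ∷ S) → Below N ((s , w) ∷ (s' , w') ∷ S) →
                 weigh π ((s , w) ∷ (s' , w') ∷ S) one ≡ 0ℤ
weigh-one {L} {N} π s w s' w' S ws (s<N , s'<s , desc) =
  [ (λ s-s'≡0 → ⊥-elim (<-irrefl (sym (ℤ.+-injective (ℤ.i-j≡0⇒i≡j (+ s) (+ s') s-s'≡0))) s'<s)) , (λ F≡0 → F≡0) ]′
    (ℤ.i*j≡0⇒i≡0∨j≡0 (+ s ℤ.- + s') {weigh π T one} main)
  where
  T = (s , w) ∷ (s' , w') ∷ S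
  A = weigh (π ∙[ s ]) ((s' , w') ∷ S) one
  B = weigh (π ∙[ s' ]) ((s , w) ∷ S) one
  tails : ∀ S → Weights L π ((s , w) ∷ (s' , w') ∷ S) → Below s' S →
          weigh (π ∙[ s ]) ((s' , w') ∷ S) one ≡ weigh (π ∙[ s' ]) ((s , w) ∷ S) one
  tails [] ws _ = trans (weigh-single s' w' one (weights-tail ws)) (sym (weigh-single s w one (Weights-remove-second s w s' w' [] ws)))
  tails ((r , u) ∷ S) ws (r<s' , desc) = trans
    (weigh-one (π ∙[ s ]) s' w' r u S (weights-tail ws) (s'<s , r<s' , desc))
    (sym (weigh-one (π ∙[ s' ]) s w r u S (Weights-remove-second s w s' w' ((r , u) ∷ S) ws) (s<N , <-trans r<s' s'<s , desc)))
  removeSecond : weigh π T (λ x → (+ x ℤ.- + s') ℤ.* 1ℤ) ≡ B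
  removeSecond = trans (cong (λ z → w ℤ.* π (+ s) ℤ.* ((+ s ℤ.- + s') ℤ.* 1ℤ) ℤ.+ z) (weigh-remove π s' w' S one))
    (cong (ℤ._+ weigh (π ∙[ s' ]) S one) (lemma w (π (+ s)) (+ s ℤ.- + s')))
    where
    lemma : ∀ w p d → w ℤ.* p ℤ.* (d ℤ.* 1ℤ) ≡ w ℤ.* (p ℤ.* d) ℤ.* 1ℤ
    lemma = ℤ-solve-∀
  main : (+ s ℤ.- + s') ℤ.* weigh π T one ≡ 0ℤ
  main = begin
    (+ s ℤ.- + s') ℤ.* weigh π T one ≡⟨ e₁ (+ s ℤ.- + s') (weigh π T one) ⟩
    0ℤ ℤ.* weigh π T one ℤ.+ (+ s ℤ.- + s') ℤ.* weigh π T one ≡⟨ sym (weigh-linear π T 0ℤ (+ s ℤ.- + s') one one) ⟩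
    weigh π T (λ x → 0ℤ ℤ.* 1ℤ ℤ.+ (+ s ℤ.- + s') ℤ.* 1ℤ) ≡⟨ weigh-cong T (λ _ → refl) (λ x → e₂ (+ x) (+ s) (+ s')) ⟩
    weigh π T (λ x → 1ℤ ℤ.* ((+ x ℤ.- + s') ℤ.* 1ℤ) ℤ.+ ℤ.- 1ℤ ℤ.* ((+ x ℤ.- + s) ℤ.* 1ℤ))
      ≡⟨ weigh-linear π T 1ℤ (ℤ.- 1ℤ) _ _ ⟩
    1ℤ ℤ.* weigh π T (λ x → (+ x ℤ.- + s') ℤ.* 1ℤ) ℤ.+ ℤ.- 1ℤ ℤ.* weigh π T (λ x → (+ x ℤ.- + s) ℤ.* 1ℤ)
      ≡⟨ cong₂ (λ y z → 1ℤ ℤ.* y ℤ.+ ℤ.- 1ℤ ℤ.* z) removeSecond (trans (weigh-remove π s w ((s' , w') ∷ S) one) (tails S ws desc)) ⟩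
    1ℤ ℤ.* B ℤ.+ ℤ.- 1ℤ ℤ.* B ≡⟨ e₃ B ⟩
    0ℤ ∎
    where
    open ≡-Reasoning
    e₁ : ∀ d F → d ℤ.* F ≡ 0ℤ ℤ.* F ℤ.+ d ℤ.* F
    e₁ = ℤ-solve-∀
    e₂ : ∀ x s s' → 0ℤ ℤ.* 1ℤ ℤ.+ (s ℤ.- s') ℤ.* 1ℤ ≡ 1ℤ ℤ.* ((x ℤ.- s') ℤ.* 1ℤ) ℤ.+ ℤ.- 1ℤ ℤ.* ((x ℤ.- s) ℤ.* 1ℤ)
    e₂ = ℤ-solve-∀
    e₃ : ∀ B → 1ℤ ℤ.* B ℤ.+ ℤ.- 1ℤ ℤ.* B ≡ 0ℤ
    e₃ = ℤ-solve-∀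

-- Split `x − i = (x − s) + (s − i)` in the absorption identity: the first summand removes the node
-- `s`, the second keeps all nodes.
weigh-recurrence : ∀ π s w S i → let T = (s , w) ∷ S in
  + suc i ℤ.* weigh π T (binom (suc i)) ≡ weigh (π ∙[ s ]) S (binom i) ℤ.+ (+ s ℤ.- + i) ℤ.* weigh π T (binom i)
weigh-recurrence π s w S i = begin
  + suc i ℤ.* weigh π T (binom (suc i)) ≡⟨ e₁ (+ suc i) (weigh π T (binom (suc i))) ⟩
  + suc i ℤ.* weigh π T (binom (suc i)) ℤ.+ 0ℤ ℤ.* weigh π T (binom (suc i)) ≡⟨ sym (weigh-linear π T (+ suc i) 0ℤ (binom (suc i)) (binom (suc i))) ⟩
  weigh π T (λ x → + suc i ℤ.* binom (suc i) x ℤ.+ 0ℤ ℤ.* binom (suc i) x) ≡⟨ weigh-cong T (λ _ → refl) pointwise ⟩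
  weigh π T (λ x → 1ℤ ℤ.* ((+ x ℤ.- + s) ℤ.* binom i x) ℤ.+ (+ s ℤ.- + i) ℤ.* binom i x) ≡⟨ weigh-linear π T 1ℤ (+ s ℤ.- + i) (λ x → (+ x ℤ.- + s) ℤ.* binom i x) (binom i) ⟩
  1ℤ ℤ.* weigh π T (λ x → (+ x ℤ.- + s) ℤ.* binom i x) ℤ.+ (+ s ℤ.- + i) ℤ.* weigh π T (binom i)
    ≡⟨ cong (ℤ._+ (+ s ℤ.- + i) ℤ.* weigh π T (binom i)) (trans (ℤ.*-identityˡ _) (weigh-remove π s w S (binom i))) ⟩
  weigh (π ∙[ s ]) S (binom i) ℤ.+ (+ s ℤ.- + i) ℤ.* weigh π T (binom i) ∎
  where
  open ≡-Reasoning
  T = (s , w) ∷ S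
  e₁ : ∀ i F → i ℤ.* F ≡ i ℤ.* F ℤ.+ 0ℤ ℤ.* F
  e₁ = ℤ-solve-∀
  e₂ : ∀ x s i B → (x ℤ.- i) ℤ.* B ℤ.+ 0ℤ ≡ 1ℤ ℤ.* ((x ℤ.- s) ℤ.* B) ℤ.+ (s ℤ.- i) ℤ.* B
  e₂ = ℤ-solve-∀
  pointwise : ∀ x → + suc i ℤ.* binom (suc i) x ℤ.+ 0ℤ ℤ.* binom (suc i) x ≡ 1ℤ ℤ.* ((+ x ℤ.- + s) ℤ.* binom i x) ℤ.+ (+ s ℤ.- + i) ℤ.* binom i x
  pointwise x = trans (cong₂ ℤ._+_ (binom-step i x) (ℤ.*-zeroˡ (binom (suc i) x))) (e₂ (+ x) (+ s) (+ i) (binom i x))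

weigh-below : ∀ π S i N → Below N S → N ≤ i → weigh π S (binom i) ≡ 0ℤ
weigh-below π [] i N _ _ = refl
weigh-below π ((x , w) ∷ S) i N (x<N , desc) N≤i =
  trans (cong₂ (λ y z → w ℤ.* π (+ x) ℤ.* + y ℤ.+ z) (k>n⇒nCk≡0 x<i) (weigh-below π S i x desc (<⇒≤ x<i)))
    (trans (ℤ.+-identityʳ _) (ℤ.*-zeroʳ (w ℤ.* π (+ x))))
  where x<i = <-≤-trans x<N N≤i

module _ {L : ℤ} (0≤L : 0ℤ ℤ.≤ L) where

  -- A divided difference of order `v` annihilates polynomials of degree below `v`, and `binom i`
  -- has degree `i`.
  weigh-vanish : ∀ i {N} π S → Weights L π S → Below N S → suc i < length S → weigh π S (binom i) ≡ 0ℤ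
  weigh-vanish _ π (_ ∷ []) _ _ (s≤s ())
  weigh-vanish zero π ((s , w) ∷ (s' , w') ∷ S) ws desc _ = weigh-one π s w s' w' S ws desc
  weigh-vanish (suc i) π T@((s , w) ∷ S) ws desc (s≤s i<) = ℤ.*-cancelˡ-≡ (+ suc i) _ _ (begin
    + suc i ℤ.* weigh π T (binom (suc i)) ≡⟨ weigh-recurrence π s w S i ⟩
    weigh (π ∙[ s ]) S (binom i) ℤ.+ (+ s ℤ.- + i) ℤ.* weigh π T (binom i)
      ≡⟨ cong₂ (λ y z → y ℤ.+ (+ s ℤ.- + i) ℤ.* z) (weigh-vanish i (π ∙[ s ]) S (weights-tail ws) (proj₂ desc) i<)
           (weigh-vanish i π T ws desc (s≤s (<-trans ≤-refl i<))) ⟩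
    0ℤ ℤ.+ (+ s ℤ.- + i) ℤ.* 0ℤ ≡⟨ lemma (+ s ℤ.- + i) (+ suc i) ⟩
    + suc i ℤ.* 0ℤ ∎)
    where
    open ≡-Reasoning
    lemma : ∀ d i → 0ℤ ℤ.+ d ℤ.* 0ℤ ≡ i ℤ.* 0ℤ
    lemma = ℤ-solve-∀

  weigh-leading : ∀ i {N} π S → Weights L π S → Below N S → length S ≡ suc i → + (i !) ℤ.* weigh π S (binom i) ≡ L
  weigh-leading zero π ((s , w) ∷ []) ws _ _ = trans (ℤ.*-identityˡ _) (trans (weigh-single s w (binom 0) ws) (ℤ.*-identityʳ L))
  weigh-leading (suc i) π T@((s , w) ∷ S) ws desc len≡ = begin
    + (suc i * i !) ℤ.* F ≡⟨ cong (ℤ._* F) (ℤ.pos-* (suc i) (i !)) ⟩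
    + suc i ℤ.* + (i !) ℤ.* F ≡⟨ e₁ (+ suc i) (+ (i !)) F ⟩
    + (i !) ℤ.* (+ suc i ℤ.* F) ≡⟨ cong (+ (i !) ℤ.*_) (weigh-recurrence π s w S i) ⟩
    + (i !) ℤ.* (weigh (π ∙[ s ]) S (binom i) ℤ.+ (+ s ℤ.- + i) ℤ.* weigh π T (binom i))
      ≡⟨ cong (λ z → + (i !) ℤ.* (weigh (π ∙[ s ]) S (binom i) ℤ.+ (+ s ℤ.- + i) ℤ.* z))
          (weigh-vanish i π T ws desc (≤-reflexive (sym len≡))) ⟩
    + (i !) ℤ.* (weigh (π ∙[ s ]) S (binom i) ℤ.+ (+ s ℤ.- + i) ℤ.* 0ℤ) ≡⟨ e₂ (+ (i !)) (weigh (π ∙[ s ]) S (binom i)) (+ s ℤ.- + i) ⟩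
    + (i !) ℤ.* weigh (π ∙[ s ]) S (binom i) ≡⟨ weigh-leading i (π ∙[ s ]) S (weights-tail ws) (proj₂ desc) (suc-injective len≡) ⟩
    L ∎
    where
    open ≡-Reasoning
    F = weigh π T (binom (suc i))
    e₁ : ∀ a b F → a ℤ.* b ℤ.* F ≡ b ℤ.* (a ℤ.* F)
    e₁ = ℤ-solve-∀
    e₂ : ∀ a F d → a ℤ.* (F ℤ.+ d ℤ.* 0ℤ) ≡ a ℤ.* F
    e₂ = ℤ-solve-∀

  -- When the head satisfies `s ≥ i`, both terms of the recurrence are nonnegative; otherwise the
  -- binomial is zero at every node.
  weigh-nonNeg : ∀ i {N} π S → Weights L π S → Below N S → 0ℤ ℤ.≤ weigh π S (binom i)
  weigh-nonNeg _ π [] _ _ = ℤ.≤-refl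
  weigh-nonNeg zero π ((s , w) ∷ []) ws _ = subst (0ℤ ℤ.≤_) (sym (trans (weigh-single s w (binom 0) ws) (ℤ.*-identityʳ L))) 0≤L
  weigh-nonNeg zero π ((s , w) ∷ (s' , w') ∷ S) ws desc = ℤ.≤-reflexive (sym (weigh-one π s w s' w' S ws desc))
  weigh-nonNeg (suc i) π T@((s , w) ∷ S) ws desc with <-≤-connex s i
  ... | inj₁ s<i = ℤ.≤-reflexive (sym (weigh-below π T (suc i) (suc s) (≤-refl , proj₂ desc) (≤-trans s<i (n≤1+n i))))
  ... | inj₂ i≤s = ℤ.*-cancelˡ-≤-pos 0ℤ (weigh π T (binom (suc i))) (+ suc i)
    (subst₂ ℤ._≤_ (sym (ℤ.*-zeroʳ (+ suc i))) (sym (weigh-recurrence π s w S i))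
      (ℤ.+-mono-≤ (weigh-nonNeg i (π ∙[ s ]) S (weights-tail ws) (proj₂ desc))
        (ℤ-*-nonNeg (ℤ.i≤j⇒0≤j-i (ℤ.+≤+ i≤s)) (weigh-nonNeg i π T ws desc))))

  -- A discrete mean value estimate: the `v`-th forward difference of `C(x,v+j)` is `C(x,j)`, which
  -- is largest at the upper bound `M` for the nodes.
  weigh-upper : ∀ v j M π S → Weights L π S → Below (suc M) S → length S ≡ suc v →
                     + (v !) ℤ.* weigh π S (binom (v + j)) ℤ.≤ L ℤ.* binom j M
  weigh-upper zero j M π ((s , w) ∷ []) ws (s≤s s≤M , _) _ = begin
    1ℤ ℤ.* weigh π ((s , w) ∷ []) (binom j) ≡⟨ trans (ℤ.*-identityˡ _) (weigh-single s w (binom j) ws) ⟩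
    L ℤ.* binom j s ≤⟨ ℤ.*-monoˡ-≤-nonNeg L {{ℤ.nonNegative 0≤L}} (ℤ.+≤+ (C-monoˡ-≤ j s≤M)) ⟩
    L ℤ.* binom j M ∎
    where open ℤ.≤-Reasoning
  weigh-upper (suc v) zero M π S ws desc len≡ = ℤ.≤-reflexive (trans
    (cong (λ i → + (suc v !) ℤ.* weigh π S (binom i)) (+-identityʳ (suc v)))
    (trans (weigh-leading (suc v) π S ws desc len≡) (sym (ℤ.*-identityʳ L))))
  weigh-upper (suc v) (suc j) M π T@((s , w) ∷ S) ws desc@(s≤s s≤M , desc') len≡ with <-≤-connex s (v + suc j)
  ... | inj₁ s<i = subst (ℤ._≤ L ℤ.* binom (suc j) M)
    (sym (trans (cong (+ (suc v !) ℤ.*_) (weigh-below π T (suc (v + suc j)) (suc s) (≤-refl , desc') (≤-trans s<i (n≤1+n _)))) (ℤ.*-zeroʳ (+ (suc v !)))))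
    (ℤ-*-nonNeg 0≤L (ℤ.+≤+ z≤n))
  ... | inj₂ i≤s = ℤ.*-cancelˡ-≤-pos _ _ (+ suc i) (begin
    + suc i ℤ.* (V ℤ.* weigh π T (binom (suc i))) ≡⟨ e₁ (+ suc i) V (weigh π T (binom (suc i))) ⟩
    V ℤ.* (+ suc i ℤ.* weigh π T (binom (suc i))) ≡⟨ cong (V ℤ.*_) (weigh-recurrence π s w S i) ⟩
    V ℤ.* (F' ℤ.+ (+ s ℤ.- + i) ℤ.* F) ≡⟨ ℤ.*-distribˡ-+ V F' ((+ s ℤ.- + i) ℤ.* F) ⟩
    V ℤ.* F' ℤ.+ V ℤ.* ((+ s ℤ.- + i) ℤ.* F) ≡⟨ cong₂ ℤ._+_ (trans (cong (ℤ._* F') (ℤ.pos-* (suc v) (v !))) (ℤ.*-assoc (+ suc v) (+ (v !)) F')) (e₁ V (+ s ℤ.- + i) F) ⟩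
    + suc v ℤ.* (+ (v !) ℤ.* F') ℤ.+ (+ s ℤ.- + i) ℤ.* (V ℤ.* F)
      ≤⟨ ℤ.+-mono-≤ (ℤ.*-monoˡ-≤-nonNeg (+ suc v) (weigh-upper v (suc j) M (π ∙[ s ]) S (weights-tail ws) (Below-≤ S (≤-trans s≤M (n≤1+n M)) desc') (suc-injective len≡)))
                    (ℤ.*-monoˡ-≤-nonNeg (+ s ℤ.- + i) {{ℤ.nonNegative (ℤ.i≤j⇒0≤j-i (ℤ.+≤+ i≤s))}} F-bound) ⟩
    + suc v ℤ.* (L ℤ.* B') ℤ.+ (+ s ℤ.- + i) ℤ.* (L ℤ.* B)
      ≤⟨ ℤ.+-monoʳ-≤ (+ suc v ℤ.* (L ℤ.* B')) (ℤ.*-monoʳ-≤-nonNeg (L ℤ.* B) {{ℤ.nonNegative (ℤ-*-nonNeg 0≤L (ℤ.+≤+ z≤n))}}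
           (ℤ.+-monoˡ-≤ (ℤ.- + i) (ℤ.+≤+ s≤M))) ⟩
    + suc v ℤ.* (L ℤ.* B') ℤ.+ (+ M ℤ.- + i) ℤ.* (L ℤ.* B)
      ≡⟨ cong (λ z → + suc v ℤ.* (L ℤ.* B') ℤ.+ (+ M ℤ.- z) ℤ.* (L ℤ.* B)) (trans (cong +_ (+-suc v j)) (ℤ.pos-+ (suc v) j)) ⟩
    + suc v ℤ.* (L ℤ.* B') ℤ.+ (+ M ℤ.- (+ suc v ℤ.+ + j)) ℤ.* (L ℤ.* B) ≡⟨ e₂ (+ suc v) L B' (+ M) (+ j) B ⟩
    -- Writing `M − i` as `(M − j) − (v + 1)` lets absorption act on `(M − j) C(M,j)`; the rest is
    -- negative and is dropped.
    + suc v ℤ.* (L ℤ.* B') ℤ.+ L ℤ.* ((+ M ℤ.- + j) ℤ.* B) ℤ.- + suc v ℤ.* (L ℤ.* B)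
      ≡⟨ cong (λ z → + suc v ℤ.* (L ℤ.* B') ℤ.+ L ℤ.* z ℤ.- + suc v ℤ.* (L ℤ.* B)) (sym (binom-step j M)) ⟩
    + suc v ℤ.* (L ℤ.* B') ℤ.+ L ℤ.* (+ suc j ℤ.* B') ℤ.- + suc v ℤ.* (L ℤ.* B)
      ≤⟨ ℤ.i≤j⇒i-k≤j (+ suc v ℤ.* (L ℤ.* B)) {{ℤ.nonNegative (ℤ-*-nonNeg {+ suc v} (ℤ.+≤+ z≤n) (ℤ-*-nonNeg 0≤L (ℤ.+≤+ z≤n)))}} ℤ.≤-refl ⟩
    + suc v ℤ.* (L ℤ.* B') ℤ.+ L ℤ.* (+ suc j ℤ.* B') ≡⟨ e₃ (+ suc v) L B' (+ suc j) ⟩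
    (+ suc v ℤ.+ + suc j) ℤ.* (L ℤ.* B') ≡⟨ cong (ℤ._* (L ℤ.* B')) (sym (ℤ.pos-+ (suc v) (suc j))) ⟩
    + suc i ℤ.* (L ℤ.* B') ∎)
    where
    open ℤ.≤-Reasoning
    i = v + suc j
    V = + (suc v !)
    F = weigh π T (binom i)
    F' = weigh (π ∙[ s ]) S (binom i)
    B = binom j M
    B' = binom (suc j) M
    F-bound : V ℤ.* F ℤ.≤ L ℤ.* B
    F-bound = subst (λ x → V ℤ.* weigh π T (binom x) ℤ.≤ L ℤ.* B) (sym (+-suc v j)) (weigh-upper (suc v) j M π T ws desc len≡)
    e₁ : ∀ a b c → a ℤ.* (b ℤ.* c) ≡ b ℤ.* (a ℤ.* c)
    e₁ = ℤ-solve-∀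
    e₂ : ∀ v L B' M j B → v ℤ.* (L ℤ.* B') ℤ.+ (M ℤ.- (v ℤ.+ j)) ℤ.* (L ℤ.* B) ≡ v ℤ.* (L ℤ.* B') ℤ.+ L ℤ.* ((M ℤ.- j) ℤ.* B) ℤ.- v ℤ.* (L ℤ.* B)
    e₂ = ℤ-solve-∀
    e₃ : ∀ v L B' j → v ℤ.* (L ℤ.* B') ℤ.+ L ℤ.* (j ℤ.* B') ≡ (v ℤ.+ j) ℤ.* (L ℤ.* B')
    e₃ = ℤ-solve-∀

binom-nonNeg : ∀ i x → 0ℤ ℤ.≤ binom i x
binom-nonNeg i x = ℤ.+≤+ z≤n

ℤ-*-monoˡ : ∀ n {x y} → x ℤ.≤ y → + n ℤ.* x ℤ.≤ + n ℤ.* y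
ℤ-*-monoˡ n = ℤ.*-monoˡ-≤-nonNeg (+ n)

-- Binomial expansion of `(b+d)ˣ` in powers of `d`, cleared of denominators

module Horner (b d : ℕ) where

  -- horner N g = Σ_{i ≤ N} g(i) dⁱ b^(N−i)
  horner : ℕ → (ℕ → ℤ) → ℤ
  horner zero    g = g 0
  horner (suc N) g = + (b ^ suc N) ℤ.* g 0 ℤ.+ + d ℤ.* horner N (λ i → g (suc i))

  horner-cong : ∀ N {f g} → (∀ i → f i ≡ g i) → horner N f ≡ horner N g
  horner-cong zero    p = p 0
  horner-cong (suc N) p = cong₂ (λ x y → + (b ^ suc N) ℤ.* x ℤ.+ + d ℤ.* y) (p 0) (horner-cong N (λ i → p (suc i)))

  horner-+ : ∀ N f g → horner N (λ i → f i ℤ.+ g i) ≡ horner N f ℤ.+ horner N g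
  horner-+ zero    f g = refl
  horner-+ (suc N) f g = trans (cong (λ z → + (b ^ suc N) ℤ.* (f 0 ℤ.+ g 0) ℤ.+ + d ℤ.* z) (horner-+ N (λ i → f (suc i)) (λ i → g (suc i))))
    (lemma (+ (b ^ suc N)) (+ d) (f 0) (g 0) _ _)
    where
    lemma : ∀ B d x y X Y → B ℤ.* (x ℤ.+ y) ℤ.+ d ℤ.* (X ℤ.+ Y) ≡ (B ℤ.* x ℤ.+ d ℤ.* X) ℤ.+ (B ℤ.* y ℤ.+ d ℤ.* Y)
    lemma = ℤ-solve-∀

  horner-scale : ∀ N a f → horner N (λ i → a ℤ.* f i) ≡ a ℤ.* horner N f
  horner-scale zero    a f = refl
  horner-scale (suc N) a f = trans (cong (λ z → + (b ^ suc N) ℤ.* (a ℤ.* f 0) ℤ.+ + d ℤ.* z) (horner-scale N a (λ i → f (suc i))))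
    (lemma (+ (b ^ suc N)) (+ d) a (f 0) _)
    where
    lemma : ∀ B d a x X → B ℤ.* (a ℤ.* x) ℤ.+ d ℤ.* (a ℤ.* X) ≡ a ℤ.* (B ℤ.* x ℤ.+ d ℤ.* X)
    lemma = ℤ-solve-∀

  horner-zero : ∀ N → horner N (λ _ → 0ℤ) ≡ 0ℤ
  horner-zero N = trans (horner-scale N 0ℤ (λ _ → 0ℤ)) (ℤ.*-zeroˡ (horner N (λ _ → 0ℤ)))

  horner-mono : ∀ N {f g} → (∀ i → f i ℤ.≤ g i) → horner N f ℤ.≤ horner N g
  horner-mono zero    p = p 0
  horner-mono (suc N) p = ℤ.+-mono-≤ (ℤ-*-monoˡ (b ^ suc N) (p 0)) (ℤ-*-monoˡ d (horner-mono N (λ i → p (suc i))))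

  horner-nonNeg : ∀ N {f} → (∀ i → 0ℤ ℤ.≤ f i) → 0ℤ ℤ.≤ horner N f
  horner-nonNeg N p = ℤ.≤-trans (ℤ.≤-reflexive (sym (horner-zero N))) (horner-mono N p)

  horner-binom : ∀ x y → horner (x + y) (λ i → binom i x) ≡ + ((b + d) ^ x * b ^ y)
  horner-binom zero zero = refl
  horner-binom zero (suc y) = trans
    (cong₂ (λ u v → u ℤ.+ + d ℤ.* v) (ℤ.*-identityʳ (+ (b ^ suc y))) (horner-zero y))
    (trans (cong (λ z → + (b ^ suc y) ℤ.+ z) (ℤ.*-zeroʳ (+ d))) (trans (ℤ.+-identityʳ _) (cong +_ (sym (+-identityʳ (b ^ suc y))))))
  horner-binom (suc x) y = begin
    + (b ^ suc (x + y)) ℤ.* 1ℤ ℤ.+ + d ℤ.* horner (x + y) (λ i → binom (suc i) (suc x))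
      ≡⟨ cong (λ z → + (b ^ suc (x + y)) ℤ.* 1ℤ ℤ.+ + d ℤ.* z) (trans (horner-cong (x + y) pascal) (horner-+ (x + y) (λ i → binom i x) (λ i → binom (suc i) x))) ⟩
    + (b ^ suc (x + y)) ℤ.* 1ℤ ℤ.+ + d ℤ.* (horner (x + y) (λ i → binom i x) ℤ.+ horner (x + y) (λ i → binom (suc i) x))
      ≡⟨ e₁ (+ (b ^ suc (x + y)) ℤ.* 1ℤ) (+ d) _ _ ⟩
    horner (suc (x + y)) (λ i → binom i x) ℤ.+ + d ℤ.* horner (x + y) (λ i → binom i x)
      ≡⟨ cong₂ (λ u v → u ℤ.+ + d ℤ.* v) (trans (cong (λ N → horner N (λ i → binom i x)) (sym (+-suc x y))) (horner-binom x (suc y))) (horner-binom x y) ⟩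
    + ((b + d) ^ x * b ^ suc y) ℤ.+ + d ℤ.* + ((b + d) ^ x * b ^ y)
      ≡⟨ cong (ℤ._+_ (+ ((b + d) ^ x * b ^ suc y))) (sym (ℤ.pos-* d ((b + d) ^ x * b ^ y))) ⟩
    + ((b + d) ^ x * b ^ suc y) ℤ.+ + (d * ((b + d) ^ x * b ^ y))
      ≡⟨ sym (ℤ.pos-+ ((b + d) ^ x * b ^ suc y) (d * ((b + d) ^ x * b ^ y))) ⟩
    + ((b + d) ^ x * b ^ suc y + d * ((b + d) ^ x * b ^ y))
      ≡⟨ cong +_ (e₂ ((b + d) ^ x) b (b ^ y) d) ⟩
    + ((b + d) ^ suc x * b ^ y) ∎
    where
    open ≡-Reasoning
    pascal : ∀ i → binom (suc i) (suc x) ≡ binom i x ℤ.+ binom (suc i) x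
    pascal i = trans (cong +_ (sym (nCk+nC[k+1]≡[n+1]C[k+1] x i))) (ℤ.pos-+ (x C i) (x C suc i))
    e₁ : ∀ B d X Y → B ℤ.+ d ℤ.* (X ℤ.+ Y) ≡ (B ℤ.+ d ℤ.* Y) ℤ.+ d ℤ.* X
    e₁ = ℤ-solve-∀
    e₂ : ∀ p b q d → p * (b * q) + d * (p * q) ≡ (b + d) * p * q
    e₂ = solve-∀

  horner-shift : ∀ v y g → (∀ i → i < v → g i ≡ 0ℤ) → horner (v + y) g ≡ + (d ^ v) ℤ.* horner y (λ j → g (v + j))
  horner-shift zero y g _ = sym (ℤ.*-identityˡ (horner y g))
  horner-shift (suc v) y g zeros = begin
    + (b ^ suc (v + y)) ℤ.* g 0 ℤ.+ + d ℤ.* horner (v + y) (λ i → g (suc i))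
      ≡⟨ cong₂ (λ u w → + (b ^ suc (v + y)) ℤ.* u ℤ.+ + d ℤ.* w) (zeros 0 (s≤s z≤n)) (horner-shift v y (λ i → g (suc i)) (λ i i<v → zeros (suc i) (s≤s i<v))) ⟩
    + (b ^ suc (v + y)) ℤ.* 0ℤ ℤ.+ + d ℤ.* (+ (d ^ v) ℤ.* H) ≡⟨ lemma (+ (b ^ suc (v + y))) (+ d) (+ (d ^ v)) H ⟩
    + d ℤ.* + (d ^ v) ℤ.* H ≡⟨ cong (ℤ._* H) (sym (ℤ.pos-* d (d ^ v))) ⟩
    + (d ^ suc v) ℤ.* H ∎
    where
    open ≡-Reasoning
    H = horner y (λ j → g (suc v + j))
    lemma : ∀ B d D H → B ℤ.* 0ℤ ℤ.+ d ℤ.* (D ℤ.* H) ≡ d ℤ.* D ℤ.* H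
    lemma = ℤ-solve-∀

  horner-lower : ∀ y g → (∀ i → 0ℤ ℤ.≤ g i) → + (b ^ y) ℤ.* g 0 ℤ.≤ horner y g
  horner-lower zero    g _  = ℤ.≤-reflexive (ℤ.*-identityˡ (g 0))
  horner-lower (suc y) g 0≤ = ℤ.≤-trans (ℤ.≤-reflexive (sym (ℤ.+-identityʳ _)))
    (ℤ.+-monoʳ-≤ (+ (b ^ suc y) ℤ.* g 0) (ℤ-*-nonNeg {+ d} (ℤ.+≤+ z≤n) (horner-nonNeg y (λ i → 0≤ (suc i)))))

  -- Raising the degree multiplies the old terms by `b^v` and adds nonnegative ones. This completes
  -- the truncated sum in `divided-upper` to the full binomial expansion.
  horner-extend : ∀ v y g → (∀ i → 0ℤ ℤ.≤ g i) → + (b ^ v) ℤ.* horner y g ℤ.≤ horner (v + y) g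
  horner-extend zero y g _ = ℤ.≤-reflexive (ℤ.*-identityˡ (horner y g))
  horner-extend (suc v) y g 0≤ = ℤ.≤-trans
    (ℤ.≤-reflexive (trans (cong (ℤ._* horner y g) (ℤ.pos-* b (b ^ v))) (ℤ.*-assoc (+ b) (+ (b ^ v)) (horner y g))))
    (ℤ.≤-trans (ℤ-*-monoˡ b (horner-extend v y g 0≤)) (step (v + y) g 0≤))
    where
    step : ∀ y g → (∀ i → 0ℤ ℤ.≤ g i) → + b ℤ.* horner y g ℤ.≤ horner (suc y) g
    step zero g 0≤ = ℤ.≤-trans (ℤ.≤-reflexive (trans (cong (λ z → + z ℤ.* g 0) (sym (*-identityʳ b))) (sym (ℤ.+-identityʳ _))))
      (ℤ.+-monoʳ-≤ (+ (b ^ 1) ℤ.* g 0) (ℤ-*-nonNeg {+ d} (ℤ.+≤+ z≤n) (0≤ 1)))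
    step (suc y) g 0≤ = ℤ.≤-trans
      (ℤ.≤-reflexive (trans (lemma (+ b) (+ (b ^ suc y)) (g 0) (+ d) _) (cong (λ z → z ℤ.* g 0 ℤ.+ + d ℤ.* (+ b ℤ.* horner y (λ i → g (suc i)))) (sym (ℤ.pos-* b (b ^ suc y))))))
      (ℤ.+-monoʳ-≤ (+ (b ^ suc (suc y)) ℤ.* g 0) (ℤ-*-monoˡ d (step y (λ i → g (suc i)) (λ i → 0≤ (suc i)))))
      where
      lemma : ∀ b B g d H → b ℤ.* (B ℤ.* g ℤ.+ d ℤ.* H) ≡ b ℤ.* B ℤ.* g ℤ.+ d ℤ.* (b ℤ.* H)
      lemma = ℤ-solve-∀

  weigh-horner : ∀ π S N (h : ℕ → ℕ → ℤ) → weigh π S (λ x → horner N (λ i → h i x)) ≡ horner N (λ i → weigh π S (h i))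
  weigh-horner π S zero    h = refl
  weigh-horner π S (suc N) h = trans (weigh-linear π S (+ (b ^ suc N)) (+ d) (h 0) (λ x → horner N (λ i → h (suc i) x)))
    (cong (λ z → + (b ^ suc N) ℤ.* weigh π S (h 0) ℤ.+ + d ℤ.* z) (weigh-horner π S N (λ i → h (suc i))))

  -- (b+d)ˣ b^(N−x), but only for x ≤ N
  power : ℕ → ℕ → ℤ
  power N x = horner N (λ i → binom i x)

  module _ {L π S} (v y : ℕ) (0≤L : 0ℤ ℤ.≤ L) (ws : Weights L π S) (desc : Below (suc (v + y)) S) (len≡ : length S ≡ suc v) where
    private
      N = v + y
      G : ℕ → ℤ
      G i = weigh π S (binom i)
      -- All terms below index `v` vanish, so `d^v` comes out as a factor. This is the source of the
      -- smallness of `W`.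
      scaled : + (v !) ℤ.* weigh π S (power N) ≡ + (d ^ v) ℤ.* horner y (λ j → + (v !) ℤ.* G (v + j))
      scaled = begin
        + (v !) ℤ.* weigh π S (power N) ≡⟨ cong (+ (v !) ℤ.*_) (weigh-horner π S N binom) ⟩
        + (v !) ℤ.* horner N G
          ≡⟨ cong (+ (v !) ℤ.*_) (horner-shift v y G (λ i i<v → weigh-vanish 0≤L i π S ws desc (subst (suc i <_) (sym len≡) (s≤s i<v)))) ⟩
        + (v !) ℤ.* (+ (d ^ v) ℤ.* horner y (λ j → G (v + j))) ≡⟨ lemma (+ (v !)) (+ (d ^ v)) _ ⟩
        + (d ^ v) ℤ.* (+ (v !) ℤ.* horner y (λ j → G (v + j))) ≡⟨ cong (+ (d ^ v) ℤ.*_) (sym (horner-scale y (+ (v !)) (λ j → G (v + j)))) ⟩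
        + (d ^ v) ℤ.* horner y (λ j → + (v !) ℤ.* G (v + j)) ∎
        where
        open ≡-Reasoning
        lemma : ∀ a b c → a ℤ.* (b ℤ.* c) ≡ b ℤ.* (a ℤ.* c)
        lemma = ℤ-solve-∀

    -- Only the term `j = 0` is kept, where `weigh-leading` is exact; the others are nonnegative.
    divided-lower : + (d ^ v * b ^ y) ℤ.* L ℤ.≤ + (v !) ℤ.* weigh π S (power N)
    divided-lower = begin
      + (d ^ v * b ^ y) ℤ.* L ≡⟨ cong (ℤ._* L) (ℤ.pos-* (d ^ v) (b ^ y)) ⟩
      + (d ^ v) ℤ.* + (b ^ y) ℤ.* L ≡⟨ ℤ.*-assoc (+ (d ^ v)) (+ (b ^ y)) L ⟩
      + (d ^ v) ℤ.* (+ (b ^ y) ℤ.* L) ≡⟨ cong (λ z → + (d ^ v) ℤ.* (+ (b ^ y) ℤ.* z)) (sym (trans (cong (λ i → + (v !) ℤ.* G i) (+-identityʳ v)) (weigh-leading 0≤L v π S ws desc len≡))) ⟩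
      + (d ^ v) ℤ.* (+ (b ^ y) ℤ.* (+ (v !) ℤ.* G (v + 0))) ≤⟨ ℤ-*-monoˡ (d ^ v) (horner-lower y (λ j → + (v !) ℤ.* G (v + j)) (λ j → ℤ-*-nonNeg {+ (v !)} (ℤ.+≤+ z≤n) (weigh-nonNeg 0≤L (v + j) π S ws desc))) ⟩
      + (d ^ v) ℤ.* horner y (λ j → + (v !) ℤ.* G (v + j)) ≡⟨ sym scaled ⟩
      + (v !) ℤ.* weigh π S (power N) ∎
      where open ℤ.≤-Reasoning

    -- By `weigh-upper` the coefficients are at most `L C(N,j)`, so the sum is bounded by the
    -- expansion of `(b+d)^N`.
    divided-upper : + (b ^ v) ℤ.* (+ (v !) ℤ.* weigh π S (power N)) ℤ.≤ + (d ^ v * (b + d) ^ N) ℤ.* L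
    divided-upper = begin
      + (b ^ v) ℤ.* (+ (v !) ℤ.* weigh π S (power N)) ≡⟨ cong (+ (b ^ v) ℤ.*_) scaled ⟩
      + (b ^ v) ℤ.* (+ (d ^ v) ℤ.* horner y (λ j → + (v !) ℤ.* G (v + j)))
        ≤⟨ ℤ-*-monoˡ (b ^ v) (ℤ-*-monoˡ (d ^ v) (horner-mono y (λ j → weigh-upper 0≤L v j N π S ws desc len≡))) ⟩
      + (b ^ v) ℤ.* (+ (d ^ v) ℤ.* horner y (λ j → L ℤ.* binom j N)) ≡⟨ cong (λ z → + (b ^ v) ℤ.* (+ (d ^ v) ℤ.* z)) (horner-scale y L (λ j → binom j N)) ⟩
      + (b ^ v) ℤ.* (+ (d ^ v) ℤ.* (L ℤ.* horner y (λ j → binom j N))) ≡⟨ e₁ (+ (b ^ v)) (+ (d ^ v)) L _ ⟩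
      + (d ^ v) ℤ.* (L ℤ.* (+ (b ^ v) ℤ.* horner y (λ j → binom j N)))
        ≤⟨ ℤ-*-monoˡ (d ^ v) (ℤ.*-monoˡ-≤-nonNeg L {{ℤ.nonNegative 0≤L}} (horner-extend v y (λ j → binom j N) (λ j → binom-nonNeg j N))) ⟩
      + (d ^ v) ℤ.* (L ℤ.* horner N (λ j → binom j N))
        ≡⟨ cong (λ z → + (d ^ v) ℤ.* (L ℤ.* z)) (trans (cong (λ M → horner M (λ j → binom j N)) (sym (+-identityʳ N))) (trans (horner-binom N 0) (cong +_ (*-identityʳ ((b + d) ^ N))))) ⟩
      + (d ^ v) ℤ.* (L ℤ.* + ((b + d) ^ N)) ≡⟨ e₂ (+ (d ^ v)) L (+ ((b + d) ^ N)) ⟩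
      + (d ^ v) ℤ.* + ((b + d) ^ N) ℤ.* L ≡⟨ cong (ℤ._* L) (sym (ℤ.pos-* (d ^ v) ((b + d) ^ N))) ⟩
      + (d ^ v * (b + d) ^ N) ℤ.* L ∎
      where
      open ℤ.≤-Reasoning
      e₁ : ∀ a b L H → a ℤ.* (b ℤ.* (L ℤ.* H)) ≡ b ℤ.* (L ℤ.* (a ℤ.* H))
      e₁ = ℤ-solve-∀
      e₂ : ∀ a L H → a ℤ.* (L ℤ.* H) ≡ a ℤ.* H ℤ.* L
      e₂ = ℤ-solve-∀

-- Binomial rows and rising factorials

C-factorial : ∀ h r → ((h + r) C h) * (h ! * r !) ≡ (h + r) !
C-factorial h r = begin
  ((h + r) C h) * (h ! * r !) ≡⟨ cong (λ x → ((h + r) C h) * (h ! * x !)) (sym (m+n∸m≡n h r)) ⟩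
  ((h + r) C h) * (h ! * (h + r ∸ h) !) ≡⟨ cong (_* (h ! * (h + r ∸ h) !)) (nCk≡n!/k![n-k]! (m≤m+n h r)) ⟩
  _ ≡⟨ m/n*n≡m {{h !* (h + r ∸ h) !≢0}} (k![n∸k]!∣n! (m≤m+n h r)) ⟩
  (h + r) ! ∎
  where open ≡-Reasoning

1≤C : ∀ h r → 1 ≤ (h + r) C h
1≤C h r = n≢0⇒n>0 λ C≡0 → <⇒≢ (>-nonZero⁻¹ ((h + r) !) {{(h + r) !≢0}}) (trans (cong (_* (h ! * r !)) (sym C≡0)) (C-factorial h r))

-- Both sides equal the multinomial coefficient `(h+i+b)!/(h! i! b!)`.
C-trinomial : ∀ h i b → ((h + i + b) C h) * ((i + b) C i) ≡ ((h + i + b) C (h + i)) * ((h + i) C h)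
C-trinomial h i b = *-cancelʳ-≡ _ _ (h ! * i ! * b !) {{m*n≢0 (h ! * i !) (b !) {{h !* i !≢0}} {{b !≢0}}}} (begin
  X * Y * (h ! * i ! * b !) ≡⟨ e₁ X Y (h !) (i !) (b !) ⟩
  X * (h ! * (Y * (i ! * b !))) ≡⟨ cong (λ z → X * (h ! * z)) (C-factorial i b) ⟩
  X * (h ! * (i + b) !) ≡⟨ cong (λ n → (n C h) * (h ! * (i + b) !)) (+-assoc h i b) ⟩
  ((h + (i + b)) C h) * (h ! * (i + b) !) ≡⟨ C-factorial h (i + b) ⟩
  (h + (i + b)) ! ≡⟨ cong _! (sym (+-assoc h i b)) ⟩
  (h + i + b) ! ≡⟨ sym (C-factorial (h + i) b) ⟩
  Z * ((h + i) ! * b !) ≡⟨ cong (λ z → Z * (z * b !)) (sym (C-factorial h i)) ⟩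
  Z * (W * (h ! * i !) * b !) ≡⟨ e₂ Z W (h !) (i !) (b !) ⟩
  Z * W * (h ! * i ! * b !) ∎)
  where
  open ≡-Reasoning
  X = (h + i + b) C h
  Y = (i + b) C i
  Z = (h + i + b) C (h + i)
  W = (h + i) C h
  e₁ : ∀ X Y h i b → X * Y * (h * i * b) ≡ X * (h * (Y * (i * b)))
  e₁ = solve-∀
  e₂ : ∀ Z W h i b → Z * (W * (h * i) * b) ≡ Z * W * (h * i * b)
  e₂ = solve-∀

C≤2^n : ∀ n k → n C k ≤ 2 ^ n
C≤2^n zero zero = ≤-refl
C≤2^n zero (suc k) = z≤n
C≤2^n (suc n) zero = m^n>0 2 (suc n)
C≤2^n (suc n) (suc k) = begin
  suc n C suc k ≡⟨ sym (nCk+nC[k+1]≡[n+1]C[k+1] n k) ⟩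
  n C k + n C suc k ≤⟨ +-mono-≤ (C≤2^n n k) (C≤2^n n (suc k)) ⟩
  2 ^ n + 2 ^ n ≡⟨ cong (λ x → 2 ^ n + x) (sym (+-identityʳ (2 ^ n))) ⟩
  2 ^ suc n ∎
  where open ≤-Reasoning

-- A common multiple of the q-th binomial row of exponential size: the row of 2p or 2p+1
-- divides C(q,p) times a common multiple of the row of p.
record RowMultiple (q : ℕ) : Set where
  field
    Λ        : ℕ
    Λ>0      : 1 ≤ Λ
    Λ≤       : Λ ≤ 4 ^ q
    row∣Λ    : ∀ h r → h + r ≡ q → q C h ∣ Λ

rowMultiple-double : ∀ p b → p ≤ b → b ≤ suc p → RowMultiple p → RowMultiple (p + b)
rowMultiple-double p b p≤b b≤sp row = record
  { Λ = ((p + b) C p) * Λ ; Λ>0 = *-mono-≤ (1≤C p b) Λ>0 ; Λ≤ = bound ; row∣Λ = divisible }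
  where
  open RowMultiple row
  bound : ((p + b) C p) * Λ ≤ 4 ^ (p + b)
  bound = begin
    ((p + b) C p) * Λ ≤⟨ *-mono-≤ (C≤2^n (p + b) p) Λ≤ ⟩
    2 ^ (p + b) * 4 ^ p ≡⟨ cong (λ x → 2 ^ (p + b) * x) (^-*-assoc 2 2 p) ⟩
    2 ^ (p + b) * 2 ^ (2 * p) ≤⟨ *-monoʳ-≤ (2 ^ (p + b)) (^-monoʳ-≤ 2 2p≤) ⟩
    2 ^ (p + b) * 2 ^ (p + b) ≡⟨ sym (^-distribˡ-+-* 2 (p + b) (p + b)) ⟩
    2 ^ (p + b + (p + b)) ≡⟨ cong (2 ^_) (cong (λ x → p + b + x) (sym (+-identityʳ (p + b)))) ⟩
    2 ^ (2 * (p + b)) ≡⟨ sym (^-*-assoc 2 2 (p + b)) ⟩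
    4 ^ (p + b) ∎
    where
    open ≤-Reasoning
    2p≤ : 2 * p ≤ p + b
    2p≤ = +-monoʳ-≤ p (≤-trans (≤-reflexive (+-identityʳ p)) p≤b)
  lower : ∀ h i → h + i ≡ p → (p + b) C h ∣ ((p + b) C p) * Λ
  lower h i refl = ∣-trans (divides ((i + b) C i) (trans (sym (C-trinomial h i b)) (*-comm ((h + i + b) C h) ((i + b) C i))))
    (*-monoʳ-∣ ((h + i + b) C (h + i)) (row∣Λ h i refl))
  divisible : ∀ h r → h + r ≡ p + b → (p + b) C h ∣ ((p + b) C p) * Λ
  divisible h r eq with ≤-<-connex h p
  ... | inj₁ h≤p = lower h (p ∸ h) (m+[n∸m]≡n h≤p)
  -- The right half of the row follows by symmetry: `b ≤ p + 1` and `h > p` give `r ≤ p`.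
  ... | inj₂ p<h = subst (_∣ ((p + b) C p) * Λ) (sym symm) (lower r (p ∸ r) (m+[n∸m]≡n r≤p))
    where
    r≡ : p + b ∸ h ≡ r
    r≡ = trans (cong (_∸ h) (sym eq)) (m+n∸m≡n h r)
    symm : (p + b) C h ≡ (p + b) C r
    symm = trans (nCk≡nC[n∸k] (≤-trans (m≤m+n h r) (≤-reflexive eq))) (cong (λ x → (p + b) C x) r≡)
    r≤p : r ≤ p
    r≤p = +-cancelˡ-≤ (suc p) _ _ (begin
      suc p + r ≤⟨ +-monoˡ-≤ r p<h ⟩
      h + r ≡⟨ eq ⟩
      p + b ≤⟨ +-monoʳ-≤ p b≤sp ⟩
      p + suc p ≡⟨ +-comm p (suc p) ⟩
      suc p + p ∎)
      where open ≤-Reasoning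

rowMultiple : ∀ q → RowMultiple q
rowMultiple q = go q q ≤-refl
  where
  half : ∀ q → ∃[ p ] ∃[ b ] (q ≡ p + b × p ≤ b × b ≤ suc p)
  half zero = 0 , 0 , refl , z≤n , z≤n
  half (suc q) with half q
  ... | p , b , refl , p≤b , b≤sp with m≤n⇒m<n∨m≡n p≤b
  ... | inj₁ p<b = suc p , b , refl , p<b , ≤-trans b≤sp (n≤1+n _)
  ... | inj₂ refl = p , suc p , sym (+-suc p p) , n≤1+n p , ≤-refl
  go : ∀ n q → q ≤ n → RowMultiple q
  go _ zero _ = record { Λ = 1 ; Λ>0 = ≤-refl ; Λ≤ = ≤-refl ; row∣Λ = λ { zero zero _ → ∣-refl } }
  go (suc n) (suc q) (s≤s q≤n) with half (suc q)
  ... | p , zero , eq , p≤b , _ = ⊥-elim (1+n≢0 (trans eq (trans (+-identityʳ p) (n≤0⇒n≡0 p≤b))))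
  ... | p , suc b , eq , p≤b , b≤sp = subst RowMultiple (sym eq) (rowMultiple-double p (suc b) p≤b b≤sp (go n p p≤n))
    where
    p≤n : p ≤ n
    p≤n = ≤-trans (≤-trans (m≤m+n p b) (≤-reflexive (sym (suc-injective (trans eq (+-suc p b)))))) q≤n

-- The product `(e+1)(e+2)⋯(e+n)`, that is the Pochhammer symbol `(e+1)ₙ`.
rise : ℕ → ℕ → ℕ
rise e zero    = 1
rise e (suc n) = suc e * rise (suc e) n

rise-snoc : ∀ e n → rise e (suc n) ≡ rise e n * suc (e + n)
rise-snoc e zero    = trans (*-identityʳ (suc e)) (sym (trans (+-identityʳ _) (cong suc (+-identityʳ e))))
rise-snoc e (suc n) = begin
  suc e * rise (suc e) (suc n) ≡⟨ cong (suc e *_) (rise-snoc (suc e) n) ⟩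
  suc e * (rise (suc e) n * suc (suc e + n)) ≡⟨ sym (*-assoc (suc e) (rise (suc e) n) (suc (suc e + n))) ⟩
  rise e (suc n) * suc (suc e + n) ≡⟨ cong (λ x → rise e (suc n) * suc x) (sym (+-suc e n)) ⟩
  rise e (suc n) * suc (e + suc n) ∎
  where open ≡-Reasoning

rise-+ : ∀ e h r → rise e (h + r) ≡ rise e h * rise (e + h) r
rise-+ e zero    r = trans (cong (λ x → rise x r) (sym (+-identityʳ e))) (sym (+-identityʳ _))
rise-+ e (suc h) r = begin
  suc e * rise (suc e) (h + r) ≡⟨ cong (suc e *_) (rise-+ (suc e) h r) ⟩
  suc e * (rise (suc e) h * rise (suc e + h) r) ≡⟨ sym (*-assoc (suc e) (rise (suc e) h) _) ⟩
  rise e (suc h) * rise (suc e + h) r ≡⟨ cong (λ x → rise e (suc h) * rise x r) (sym (+-suc e h)) ⟩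
  rise e (suc h) * rise (e + suc h) r ∎
  where open ≡-Reasoning

rise-factorial : ∀ e n → e ! * rise e n ≡ (e + n) !
rise-factorial e zero    = trans (*-identityʳ (e !)) (cong _! (sym (+-identityʳ e)))
rise-factorial e (suc n) = begin
  e ! * (suc e * rise (suc e) n) ≡⟨ lemma (e !) (suc e) (rise (suc e) n) ⟩
  suc e ! * rise (suc e) n ≡⟨ rise-factorial (suc e) n ⟩
  (suc e + n) ! ≡⟨ cong _! (sym (+-suc e n)) ⟩
  (e + suc n) ! ∎
  where
  open ≡-Reasoning
  lemma : ∀ f s r → f * (s * r) ≡ s * f * r
  lemma = solve-∀

rise-zero : ∀ n → rise 0 n ≡ n !
rise-zero n = trans (sym (+-identityʳ _)) (rise-factorial 0 n)

rise-C : ∀ e n → n ! * ((e + n) C n) ≡ rise e n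
rise-C e n = *-cancelˡ-≡ _ _ (e !) {{e !≢0}} (begin
  e ! * (n ! * ((e + n) C n)) ≡⟨ lemma (e !) (n !) ((e + n) C n) ⟩
  ((e + n) C n) * (n ! * e !) ≡⟨ cong (λ x → (x C n) * (n ! * e !)) (+-comm e n) ⟩
  ((n + e) C n) * (n ! * e !) ≡⟨ C-factorial n e ⟩
  (n + e) ! ≡⟨ cong _! (+-comm n e) ⟩
  (e + n) ! ≡⟨ sym (rise-factorial e n) ⟩
  e ! * rise e n ∎)
  where
  open ≡-Reasoning
  lemma : ∀ a b c → a * (b * c) ≡ c * (b * a)
  lemma = solve-∀

-- The Hermite–Padé weights

sign : ℕ → ℤ
sign zero    = 1ℤ
sign (suc n) = ℤ.- sign n

sign² : ∀ n → sign n ℤ.* sign n ≡ 1ℤ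
sign² zero    = refl
sign² (suc n) = trans (lemma (sign n)) (sign² n)
  where
  lemma : ∀ s → ℤ.- s ℤ.* ℤ.- s ≡ s ℤ.* s
  lemma = ℤ-solve-∀

∣sign∣ : ∀ n → ℤ.∣ sign n ∣ ≡ 1
∣sign∣ zero    = refl
∣sign∣ (suc n) = trans (ℤ.∣-i∣≡∣i∣ (sign n)) (∣sign∣ n)

nodeBlock : ℕ → (ℕ → ℤ) → ℕ → List (ℕ × ℤ) → List (ℕ × ℤ)
nodeBlock o w zero    T = T
nodeBlock o w (suc n) T = (o + n , w n) ∷ nodeBlock o w n T

length-nodeBlock : ∀ o w n T → length (nodeBlock o w n T) ≡ n + length T
length-nodeBlock o w zero    T = refl
length-nodeBlock o w (suc n) T = cong suc (length-nodeBlock o w n T)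

nodeBlock-descending : ∀ o w n T → Below o T → Below (o + n) (nodeBlock o w n T)
nodeBlock-descending o w zero    T desc = Below-≤ T (m≤m+n o 0) desc
nodeBlock-descending o w (suc n) T desc = +-monoʳ-< o ≤-refl , nodeBlock-descending o w n T desc

blockPoly : ℕ → ℕ → ℤ → ℤ
blockPoly o zero    z = 1ℤ
blockPoly o (suc n) z = (z ℤ.- + (o + n)) ℤ.* blockPoly o n z

nodePoly-nodeBlock : ∀ o w n T z → nodePoly (nodeBlock o w n T) z ≡ blockPoly o n z ℤ.* nodePoly T z
nodePoly-nodeBlock o w zero    T z = sym (ℤ.*-identityˡ (nodePoly T z))
nodePoly-nodeBlock o w (suc n) T z = trans (cong (ℤ._*_ (z ℤ.- + (o + n))) (nodePoly-nodeBlock o w n T z))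
  (sym (ℤ.*-assoc (z ℤ.- + (o + n)) (blockPoly o n z) (nodePoly T z)))

abovePoly : ℕ → ℕ → ℤ
abovePoly x zero    = 1ℤ
abovePoly x (suc r) = abovePoly x r ℤ.* (+ x ℤ.- + (x + suc r))

-- When a node is reached, `π` has absorbed all larger nodes. Within the block these are the next
-- `r` integers, collected in `abovePoly`, while `blockPoly` collects the `h` smaller ones. So one
-- closed equation per node suffices.
weights-nodeBlock : ∀ {L} o w n π T →
  (∀ h r → h + suc r ≡ n → let x = o + h in w h ℤ.* (π (+ x) ℤ.* abovePoly x r) ℤ.* (blockPoly o h (+ x) ℤ.* nodePoly T (+ x)) ≡ L) →
  Weights L (λ z → π z ℤ.* blockPoly o n z) T → Weights L π (nodeBlock o w n T)
weights-nodeBlock o w zero π T _ ws = Weights-cong T (λ z → ℤ.*-identityʳ (π z)) ws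
weights-nodeBlock {L} o w (suc n) π T cond ws = head ∷ weights-nodeBlock o w n (π ∙[ o + n ]) T cond'
  (Weights-cong T (λ z → sym (ℤ.*-assoc (π z) (z ℤ.- + (o + n)) (blockPoly o n z))) ws)
  where
  x = o + n
  head : w n ℤ.* π (+ x) ℤ.* nodePoly (nodeBlock o w n T) (+ x) ≡ L
  head = trans (cong₂ (λ y z → w n ℤ.* y ℤ.* z) (sym (ℤ.*-identityʳ (π (+ x)))) (nodePoly-nodeBlock o w n T (+ x)))
    (cond n 0 (+-comm n 1))
  cond' : ∀ h r → h + suc r ≡ n → let y = o + h in
    w h ℤ.* (π (+ y) ℤ.* (+ y ℤ.- + (o + n)) ℤ.* abovePoly y r) ℤ.* (blockPoly o h (+ y) ℤ.* nodePoly T (+ y)) ≡ L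
  cond' h r eq = trans (cong (λ u → w h ℤ.* u ℤ.* (blockPoly o h (+ y) ℤ.* nodePoly T (+ y)))
    (trans (swap (π (+ y)) (+ y ℤ.- + (o + n)) (abovePoly y r)) (cong (λ k → π (+ y) ℤ.* (abovePoly y r ℤ.* (+ y ℤ.- + k))) o+n≡)))
    (cond h (suc r) (trans (+-suc h (suc r)) (cong suc eq)))
    where
    y = o + h
    o+n≡ : o + n ≡ y + suc r
    o+n≡ = trans (cong (λ z → o + z) (sym eq)) (sym (+-assoc o h (suc r)))
    swap : ∀ p d a → p ℤ.* d ℤ.* a ≡ p ℤ.* (a ℤ.* d)
    swap = ℤ-solve-∀

pos-difference : ∀ y d → + (y + d) ℤ.- + y ≡ + d
pos-difference y d = trans (cong (ℤ._- + y) (ℤ.pos-+ y d)) (lemma (+ y) (+ d))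
  where
  lemma : ∀ y d → y ℤ.+ d ℤ.- y ≡ d
  lemma = ℤ-solve-∀

neg-difference : ∀ y d → + y ℤ.- + (y + d) ≡ ℤ.- + d
neg-difference y d = trans (cong (ℤ._-_ (+ y)) (ℤ.pos-+ y d)) (lemma (+ y) (+ d))
  where
  lemma : ∀ y d → y ℤ.- (y ℤ.+ d) ≡ ℤ.- d
  lemma = ℤ-solve-∀

abovePoly-factorial : ∀ x r → abovePoly x r ≡ sign r ℤ.* + (r !)
abovePoly-factorial x zero    = refl
abovePoly-factorial x (suc r) = begin
  abovePoly x r ℤ.* (+ x ℤ.- + (x + suc r)) ≡⟨ cong₂ ℤ._*_ (abovePoly-factorial x r) (neg-difference x (suc r)) ⟩
  sign r ℤ.* + (r !) ℤ.* ℤ.- + suc r ≡⟨ lemma (sign r) (+ (r !)) (+ suc r) ⟩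
  ℤ.- sign r ℤ.* (+ suc r ℤ.* + (r !)) ≡⟨ cong (ℤ._*_ (ℤ.- sign r)) (sym (ℤ.pos-* (suc r) (r !))) ⟩
  sign (suc r) ℤ.* + (suc r !) ∎
  where
  open ≡-Reasoning
  lemma : ∀ s f r → s ℤ.* f ℤ.* ℤ.- r ≡ ℤ.- s ℤ.* (r ℤ.* f)
  lemma = ℤ-solve-∀

blockPoly-above : ∀ o n e → blockPoly o n (+ (o + n + e)) ≡ + rise e n
blockPoly-above o zero    e = refl
blockPoly-above o (suc n) e = begin
  (+ (o + suc n + e) ℤ.- + (o + n)) ℤ.* blockPoly o n (+ (o + suc n + e))
    ≡⟨ cong (λ k → (+ k ℤ.- + (o + n)) ℤ.* blockPoly o n (+ k)) (lemma o n e) ⟩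
  (+ (o + n + suc e) ℤ.- + (o + n)) ℤ.* blockPoly o n (+ (o + n + suc e))
    ≡⟨ cong₂ ℤ._*_ (pos-difference (o + n) (suc e)) (blockPoly-above o n (suc e)) ⟩
  + suc e ℤ.* + rise (suc e) n ≡⟨ sym (ℤ.pos-* (suc e) (rise (suc e) n)) ⟩
  + rise e (suc n) ∎
  where
  open ≡-Reasoning
  lemma : ∀ o n e → o + suc n + e ≡ o + n + suc e
  lemma = solve-∀

blockPoly-self : ∀ o h → blockPoly o h (+ (o + h)) ≡ + (h !)
blockPoly-self o h = trans (cong (λ k → blockPoly o h (+ k)) (sym (+-identityʳ (o + h)))) (trans (blockPoly-above o h 0) (cong +_ (rise-zero h)))

blockPoly-below : ∀ z e n → blockPoly (z + suc e) n (+ z) ≡ sign n ℤ.* + rise e n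
blockPoly-below z e zero    = refl
blockPoly-below z e (suc n) = begin
  (+ z ℤ.- + (z + suc e + n)) ℤ.* blockPoly (z + suc e) n (+ z)
    ≡⟨ cong₂ ℤ._*_ (trans (cong (λ k → + z ℤ.- + k) (+-assoc z (suc e) n)) (neg-difference z (suc e + n))) (blockPoly-below z e n) ⟩
  ℤ.- + suc (e + n) ℤ.* (sign n ℤ.* + rise e n) ≡⟨ lemma (+ suc (e + n)) (sign n) (+ rise e n) ⟩
  ℤ.- sign n ℤ.* (+ rise e n ℤ.* + suc (e + n)) ≡⟨ cong (ℤ._*_ (ℤ.- sign n)) (sym (ℤ.pos-* (rise e n) (suc (e + n)))) ⟩
  sign (suc n) ℤ.* + (rise e n * suc (e + n)) ≡⟨ cong (λ k → sign (suc n) ℤ.* + k) (sym (rise-snoc e n)) ⟩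
  sign (suc n) ℤ.* + rise e (suc n) ∎
  where
  open ≡-Reasoning
  lemma : ∀ a s f → ℤ.- a ℤ.* (s ℤ.* f) ≡ ℤ.- s ℤ.* (f ℤ.* a)
  lemma = ℤ-solve-∀

-- Explicit weights for the three blocks {jm, …, jm+q}, j = 0, 1, 2, where m = q+1+e.
module ThreeBlocks (q e : ℕ) where

  -- There are `e` integers strictly between neighbouring blocks and `e'` between the outer two.
  m e' : ℕ
  m = suc q + e
  e' = e + m

  open RowMultiple (rowMultiple q)

  -- The quotient `Λ/C(q,h)`. It clears the denominator `h! r!` that a block contributes to its own
  -- weights.
  cofac : ℕ → ℕ
  cofac h with h ≤? q
  ... | yes h≤q = quotient (row∣Λ h (q ∸ h) (m+[n∸m]≡n h≤q))
  ... | no  _   = 0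

  cofac-spec : ∀ h r → h + r ≡ q → cofac h * (q C h) ≡ Λ
  cofac-spec h r eq with h ≤? q
  ... | yes h≤q = sym (_∣_.equality (row∣Λ h (q ∸ h) (m+[n∸m]≡n h≤q)))
  ... | no h≰q  = ⊥-elim (h≰q (≤-trans (m≤m+n h r) (≤-reflexive eq)))

  cofac≤Λ : ∀ h r → h + r ≡ q → cofac h ≤ Λ
  cofac≤Λ h r eq = ≤-trans (m≤m*n (cofac h) (q C h) {{C≢0}}) (≤-reflexive (cofac-spec h r eq))
    where
    C≢0 : NonZero (q C h)
    C≢0 = Data.Nat.≢-nonZero λ C≡0 → <⇒≢ Λ>0 (trans (sym (*-zeroʳ (cofac h))) (trans (cong (cofac h *_) (sym C≡0)) (cofac-spec h r eq)))

  -- If `x` integers separate two blocks of length `q + 1`, the differences between their nodes run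
  -- through `x+1, …, x+2q+1`; a single node meets `q + 1` consecutive ones.
  window : ℕ → ℕ
  window x = rise x (suc (q + q))

  binomial : ℕ → ℕ
  binomial x = (x + suc (q + q)) C suc (q + q)

  -- rise x h and rise (x+h+q+1) r are what is left of the window when the block of q+1
  -- consecutive factors at x+h is taken out; flank is their product divided by h! r!.
  flank : ℕ → ℕ → ℕ → ℕ
  flank x h r = ((x + h) C h) * ((x + h + suc q + r) C r)

  flank-spec : ∀ x h r → h + r ≡ q → h ! * r ! * flank x h r * rise (x + h) (suc q) ≡ window x
  flank-spec x h r eq = begin
    h ! * r ! * flank x h r * rise (x + h) (suc q)
      ≡⟨ e₁ (h !) (r !) _ _ _ ⟩
    h ! * ((x + h) C h) * (rise (x + h) (suc q) * (r ! * ((x + h + suc q + r) C r)))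
      ≡⟨ cong₂ (λ a b → a * (rise (x + h) (suc q) * b)) (rise-C x h) (rise-C (x + h + suc q) r) ⟩
    rise x h * (rise (x + h) (suc q) * rise (x + h + suc q) r) ≡⟨ cong (rise x h *_) (sym (rise-+ (x + h) (suc q) r)) ⟩
    rise x h * rise (x + h) (suc q + r) ≡⟨ sym (rise-+ x h (suc q + r)) ⟩
    rise x (h + (suc q + r)) ≡⟨ cong (rise x) (trans (e₂ h q r) (cong (λ k → suc (q + k)) eq)) ⟩
    window x ∎
    where
    open ≡-Reasoning
    e₁ : ∀ a b u v R → a * b * (u * v) * R ≡ a * u * (R * (b * v))
    e₁ = solve-∀
    e₂ : ∀ h q r → h + (suc q + r) ≡ suc (q + (h + r))
    e₂ = solve-∀

  -- This is `Λ((2q+1)!)²/q!` times one `binomial` for each pair of blocks, with gaps `e`, `e`,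
  -- `e'`. Since `window x = (2q+1)! · binomial x`, a node uses up the windows of its own two pairs
  -- and keeps the `binomial` of the third pair in its weight. The form with `C(2q+1,q)` stays in ℕ.
  scale : ℕ
  scale = Λ * (suc q ! * ((q + suc q) C q)) * suc (q + q) ! * (binomial e * binomial e * binomial e')

  q!*scale : q ! * scale ≡ Λ * (suc (q + q) ! * suc (q + q) !) * (binomial e * binomial e * binomial e')
  q!*scale = begin
    q ! * (Λ * (suc q ! * ((q + suc q) C q)) * F * B) ≡⟨ e₁ (q !) Λ (suc q !) ((q + suc q) C q) F B ⟩
    Λ * (((q + suc q) C q) * (q ! * suc q !) * F) * B ≡⟨ cong (λ x → Λ * (x * F) * B) (trans (C-factorial q (suc q)) (cong _! (+-suc q q))) ⟩
    Λ * (F * F) * B ∎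
    where
    open ≡-Reasoning
    F = suc (q + q) !
    B = binomial e * binomial e * binomial e'
    e₁ : ∀ a L s c F B → a * (L * (s * c) * F * B) ≡ L * (c * (a * s) * F) * B
    e₁ = solve-∀

  weight-product : ∀ h r f g c R S x y → h + r ≡ q →
    h ! * r ! * f * R ≡ window x → h ! * r ! * g * S ≡ window y →
    binomial x * binomial y * c ≡ binomial e * binomial e * binomial e' →
    cofac h * f * g * c * (h ! * r !) * (R * S) ≡ scale
  weight-product h r f g c R S x y eq fR gS xyc = *-cancelˡ-≡ _ _ (q !) {{q !≢0}} (begin
    q ! * (cofac h * f * g * c * (h ! * r !) * (R * S))
      ≡⟨ cong (_* (cofac h * f * g * c * (h ! * r !) * (R * S))) (sym q!≡) ⟩
    (q C h) * (h ! * r !) * (cofac h * f * g * c * (h ! * r !) * (R * S))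
      ≡⟨ e₁ (q C h) (h !) (r !) (cofac h) f g c R S ⟩
    cofac h * (q C h) * ((h ! * r ! * f * R) * (h ! * r ! * g * S)) * c
      ≡⟨ cong₂ (λ a b → a * b * c) (cofac-spec h r eq) (cong₂ _*_ (trans fR (sym (window-binomial x))) (trans gS (sym (window-binomial y)))) ⟩
    Λ * (F * binomial x * (F * binomial y)) * c ≡⟨ e₂ Λ F (binomial x) (binomial y) c ⟩
    Λ * (F * F) * (binomial x * binomial y * c) ≡⟨ cong (Λ * (F * F) *_) xyc ⟩
    Λ * (F * F) * (binomial e * binomial e * binomial e') ≡⟨ sym q!*scale ⟩
    q ! * scale ∎)
    where
    open ≡-Reasoning
    F = suc (q + q) !
    window-binomial : ∀ x → F * binomial x ≡ window x
    window-binomial x = rise-C x (suc (q + q))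
    q!≡ : (q C h) * (h ! * r !) ≡ q !
    q!≡ = subst (λ n → (n C h) * (h ! * r !) ≡ n !) eq (C-factorial h r)
    e₁ : ∀ C h r l f g c R S → C * (h * r) * (l * f * g * c * (h * r) * (R * S)) ≡ l * C * ((h * r * f * R) * (h * r * g * S)) * c
    e₁ = solve-∀
    e₂ : ∀ L F x y c → L * (F * x * (F * y)) * c ≡ L * (F * F) * (x * y * c)
    e₂ = solve-∀

  size₀ size₁ size₂ : ℕ → ℕ → ℕ
  size₀ h r = cofac h * flank e' r h * flank e r h * binomial e
  size₁ h r = cofac h * flank e r h * flank e h r * binomial e'
  size₂ h r = cofac h * flank e h r * flank e' h r * binomial e

  -- The sign counts the nodes above: `r = q − h` in the same block, plus `q + 1` for the middle
  -- block and `2(q + 1)`, an even number, for the lowest.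
  weight₀ weight₁ weight₂ : ℕ → ℤ
  weight₀ h = sign (q ∸ h) ℤ.* + size₀ h (q ∸ h)
  weight₁ h = sign (suc q) ℤ.* sign (q ∸ h) ℤ.* + size₁ h (q ∸ h)
  weight₂ h = sign (q ∸ h) ℤ.* + size₂ h (q ∸ h)

  nodes₀ nodes₁ nodes : List (ℕ × ℤ)
  nodes₀ = nodeBlock 0 weight₀ (suc q) []
  nodes₁ = nodeBlock m weight₁ (suc q) nodes₀
  nodes  = nodeBlock (m + m) weight₂ (suc q) nodes₁

  length-nodes : length nodes ≡ suc (q + suc q + suc q)
  length-nodes = trans (length-nodeBlock (m + m) weight₂ (suc q) _)
    (trans (cong (λ z → suc q + z) (trans (length-nodeBlock m weight₁ (suc q) _) (cong (λ z → suc q + z) (trans (length-nodeBlock 0 weight₀ (suc q) []) (+-identityʳ (suc q))))))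
      (lemma q))
    where
    lemma : ∀ q → suc q + (suc q + suc q) ≡ suc (q + suc q + suc q)
    lemma = solve-∀

  nodes-descending : Below (m + m + suc q) nodes
  nodes-descending = nodeBlock-descending (m + m) weight₂ (suc q) nodes₁
    (Below-≤ nodes₁ (+-monoʳ-≤ m (m≤m+n (suc q) e)) (nodeBlock-descending m weight₁ (suc q) nodes₀
      (Below-≤ nodes₀ (m≤m+n (suc q) e) (nodeBlock-descending 0 weight₀ (suc q) [] tt))))

  nodes-weights : Weights (+ scale) (λ _ → 1ℤ) nodes
  nodes-weights = weights-nodeBlock (m + m) weight₂ (suc q) _ _ cond₂
    (weights-nodeBlock m weight₁ (suc q) _ _ cond₁
      (weights-nodeBlock 0 weight₀ (suc q) _ [] cond₀ []))
    where
    open ≡-Reasoning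
    r≡ : ∀ {h r} → h + suc r ≡ suc q → q ∸ h ≡ r
    r≡ {h} {r} eq = trans (cong (_∸ h) (sym (suc-injective (trans (sym (+-suc h r)) eq)))) (m+n∸m≡n h r)
    h+r≡ : ∀ {h r} → h + suc r ≡ suc q → h + r ≡ q
    h+r≡ {h} {r} eq = suc-injective (trans (sym (+-suc h r)) eq)
    r+h≡ : ∀ {h r} → h + suc r ≡ suc q → r + h ≡ q
    r+h≡ {h} {r} eq = trans (+-comm r h) (h+r≡ eq)
    swapped : ∀ {x} h r R → h ! * r ! * R * rise (x + h) (suc q) ≡ window x → r ! * h ! * R * rise (x + h) (suc q) ≡ window x
    swapped {x} h r R = trans (cong (λ z → z * R * rise (x + h) (suc q)) (*-comm (r !) (h !)))
    pos-product : ∀ a b c d f → + a ℤ.* (+ b ℤ.* + c) ℤ.* (+ d ℤ.* + f) ≡ + (a * (b * c) * (d * f))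
    pos-product a b c d f = trans (cong₂ ℤ._*_ (trans (cong (ℤ._*_ (+ a)) (sym (ℤ.pos-* b c))) (sym (ℤ.pos-* a (b * c)))) (sym (ℤ.pos-* d f)))
      (sym (ℤ.pos-* (a * (b * c)) (d * f)))
    above : ∀ o x y h → x ≡ o + suc q + (y + h) → blockPoly o (suc q) (+ x) ≡ + rise (y + h) (suc q)
    above o x y h eq = trans (cong (λ k → blockPoly o (suc q) (+ k)) eq) (blockPoly-above o (suc q) (y + h))
    below : ∀ o x y r → o ≡ x + suc (y + r) → blockPoly o (suc q) (+ x) ≡ sign (suc q) ℤ.* + rise (y + r) (suc q)
    below o x y r eq = trans (cong (λ k → blockPoly k (suc q) (+ x)) eq) (blockPoly-below x (y + r) (suc q))
    cond₂ : ∀ h r → h + suc r ≡ suc q → let x = m + m + h in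
      weight₂ h ℤ.* (1ℤ ℤ.* abovePoly x r) ℤ.* (blockPoly (m + m) h (+ x) ℤ.* nodePoly nodes₁ (+ x)) ≡ + scale
    cond₂ h r eq = begin
      weight₂ h ℤ.* (1ℤ ℤ.* abovePoly x r) ℤ.* (blockPoly (m + m) h (+ x) ℤ.* nodePoly nodes₁ (+ x))
        ≡⟨ cong₂ (λ a b → a ℤ.* (1ℤ ℤ.* abovePoly x r) ℤ.* b) (cong (λ k → sign k ℤ.* + size₂ h k) (r≡ eq))
             (cong₂ ℤ._*_ (blockPoly-self (m + m) h) (trans (nodePoly-nodeBlock m weight₁ (suc q) nodes₀ (+ x)) (cong (ℤ._*_ (blockPoly m (suc q) (+ x))) (nodePoly-nodeBlock 0 weight₀ (suc q) [] (+ x))))) ⟩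
      sign r ℤ.* + size₂ h r ℤ.* (1ℤ ℤ.* abovePoly x r) ℤ.* (+ (h !) ℤ.* (blockPoly m (suc q) (+ x) ℤ.* (blockPoly 0 (suc q) (+ x) ℤ.* 1ℤ)))
        ≡⟨ cong₂ (λ a b → sign r ℤ.* + size₂ h r ℤ.* (1ℤ ℤ.* a) ℤ.* (+ (h !) ℤ.* b)) (abovePoly-factorial x r)
             (cong₂ (λ a b → a ℤ.* (b ℤ.* 1ℤ)) (above m x e h (x₁ q e h)) (above 0 x e' h (x₂ q e h))) ⟩
      sign r ℤ.* + size₂ h r ℤ.* (1ℤ ℤ.* (sign r ℤ.* + (r !))) ℤ.* (+ (h !) ℤ.* (+ rise (e + h) (suc q) ℤ.* (+ rise (e' + h) (suc q) ℤ.* 1ℤ)))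
        ≡⟨ rearrange (sign r) (+ size₂ h r) (+ (r !)) (+ (h !)) (+ rise (e + h) (suc q)) (+ rise (e' + h) (suc q)) ⟩
      (sign r ℤ.* sign r) ℤ.* (+ size₂ h r ℤ.* (+ (h !) ℤ.* + (r !)) ℤ.* (+ rise (e + h) (suc q) ℤ.* + rise (e' + h) (suc q)))
        ≡⟨ cong₂ ℤ._*_ (sign² r) (pos-product (size₂ h r) (h !) (r !) (rise (e + h) (suc q)) (rise (e' + h) (suc q))) ⟩
      1ℤ ℤ.* + (size₂ h r * (h ! * r !) * (rise (e + h) (suc q) * rise (e' + h) (suc q)))
        ≡⟨ trans (ℤ.*-identityˡ _) (cong +_ (weight-product h r (flank e h r) (flank e' h r) (binomial e) (rise (e + h) (suc q)) (rise (e' + h) (suc q)) e e' (h+r≡ eq)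
             (flank-spec e h r (h+r≡ eq)) (flank-spec e' h r (h+r≡ eq)) (c₂ (binomial e) (binomial e')))) ⟩
      + scale ∎
      where
      x = m + m + h
      x₁ : ∀ q e h → suc q + e + (suc q + e) + h ≡ suc q + e + suc q + (e + h)
      x₁ = solve-∀
      x₂ : ∀ q e h → suc q + e + (suc q + e) + h ≡ 0 + suc q + (e + (suc q + e) + h)
      x₂ = solve-∀
      c₂ : ∀ a b → a * b * a ≡ a * a * b
      c₂ = solve-∀
      rearrange : ∀ s w f g R S → s ℤ.* w ℤ.* (1ℤ ℤ.* (s ℤ.* f)) ℤ.* (g ℤ.* (R ℤ.* (S ℤ.* 1ℤ))) ≡ (s ℤ.* s) ℤ.* (w ℤ.* (g ℤ.* f) ℤ.* (R ℤ.* S))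
      rearrange = ℤ-solve-∀
    cond₁ : ∀ h r → h + suc r ≡ suc q → let x = m + h in
      weight₁ h ℤ.* (1ℤ ℤ.* blockPoly (m + m) (suc q) (+ x) ℤ.* abovePoly x r) ℤ.* (blockPoly m h (+ x) ℤ.* nodePoly nodes₀ (+ x)) ≡ + scale
    cond₁ h r eq = begin
      weight₁ h ℤ.* (1ℤ ℤ.* blockPoly (m + m) (suc q) (+ x) ℤ.* abovePoly x r) ℤ.* (blockPoly m h (+ x) ℤ.* nodePoly nodes₀ (+ x))
        ≡⟨ cong₂ (λ a b → a ℤ.* (1ℤ ℤ.* blockPoly (m + m) (suc q) (+ x) ℤ.* abovePoly x r) ℤ.* b) (cong (λ k → σ ℤ.* sign k ℤ.* + size₁ h k) (r≡ eq))
             (cong₂ ℤ._*_ (blockPoly-self m h) (nodePoly-nodeBlock 0 weight₀ (suc q) [] (+ x))) ⟩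
      σ ℤ.* sign r ℤ.* + size₁ h r ℤ.* (1ℤ ℤ.* blockPoly (m + m) (suc q) (+ x) ℤ.* abovePoly x r) ℤ.* (+ (h !) ℤ.* (blockPoly 0 (suc q) (+ x) ℤ.* 1ℤ))
        ≡⟨ cong₂ (λ a b → σ ℤ.* sign r ℤ.* + size₁ h r ℤ.* a ℤ.* (+ (h !) ℤ.* (b ℤ.* 1ℤ)))
             (cong₂ (λ a b → 1ℤ ℤ.* a ℤ.* b) (below (m + m) x e r (trans (cong (λ k → suc k + e + m) (sym (h+r≡ eq))) (x₁ h r e m))) (abovePoly-factorial x r))
             (above 0 x e h (x₂ q e h)) ⟩
      σ ℤ.* sign r ℤ.* + size₁ h r ℤ.* (1ℤ ℤ.* (σ ℤ.* + rise (e + r) (suc q)) ℤ.* (sign r ℤ.* + (r !))) ℤ.* (+ (h !) ℤ.* (+ rise (e + h) (suc q) ℤ.* 1ℤ))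
        ≡⟨ rearrange σ (sign r) (+ size₁ h r) (+ (r !)) (+ (h !)) (+ rise (e + r) (suc q)) (+ rise (e + h) (suc q)) ⟩
      (σ ℤ.* σ) ℤ.* (sign r ℤ.* sign r) ℤ.* (+ size₁ h r ℤ.* (+ (h !) ℤ.* + (r !)) ℤ.* (+ rise (e + r) (suc q) ℤ.* + rise (e + h) (suc q)))
        ≡⟨ cong₂ ℤ._*_ (cong₂ ℤ._*_ (sign² (suc q)) (sign² r)) (pos-product (size₁ h r) (h !) (r !) (rise (e + r) (suc q)) (rise (e + h) (suc q))) ⟩
      1ℤ ℤ.* 1ℤ ℤ.* + (size₁ h r * (h ! * r !) * (rise (e + r) (suc q) * rise (e + h) (suc q)))
        ≡⟨ trans (ℤ.*-identityˡ _) (cong +_ (weight-product h r (flank e r h) (flank e h r) (binomial e') (rise (e + r) (suc q)) (rise (e + h) (suc q)) e e (h+r≡ eq)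
             (swapped r h (flank e r h) (flank-spec e r h (r+h≡ eq))) (flank-spec e h r (h+r≡ eq)) refl)) ⟩
      + scale ∎
      where
      x = m + h
      σ = sign (suc q)
      x₁ : ∀ h r e m → suc (h + r) + e + m ≡ m + h + suc (e + r)
      x₁ = solve-∀
      x₂ : ∀ q e h → suc q + e + h ≡ 0 + suc q + (e + h)
      x₂ = solve-∀
      rearrange : ∀ σ s w f g R S → σ ℤ.* s ℤ.* w ℤ.* (1ℤ ℤ.* (σ ℤ.* R) ℤ.* (s ℤ.* f)) ℤ.* (g ℤ.* (S ℤ.* 1ℤ)) ≡ (σ ℤ.* σ) ℤ.* (s ℤ.* s) ℤ.* (w ℤ.* (g ℤ.* f) ℤ.* (R ℤ.* S))
      rearrange = ℤ-solve-∀
    cond₀ : ∀ h r → h + suc r ≡ suc q →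
      weight₀ h ℤ.* (1ℤ ℤ.* blockPoly (m + m) (suc q) (+ h) ℤ.* blockPoly m (suc q) (+ h) ℤ.* abovePoly h r) ℤ.* (blockPoly 0 h (+ h) ℤ.* 1ℤ) ≡ + scale
    cond₀ h r eq = begin
      weight₀ h ℤ.* (1ℤ ℤ.* blockPoly (m + m) (suc q) (+ h) ℤ.* blockPoly m (suc q) (+ h) ℤ.* abovePoly h r) ℤ.* (blockPoly 0 h (+ h) ℤ.* 1ℤ)
        ≡⟨ cong₂ (λ a b → a ℤ.* (1ℤ ℤ.* blockPoly (m + m) (suc q) (+ h) ℤ.* blockPoly m (suc q) (+ h) ℤ.* abovePoly h r) ℤ.* (b ℤ.* 1ℤ))
             (cong (λ k → sign k ℤ.* + size₀ h k) (r≡ eq)) (blockPoly-self 0 h) ⟩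
      sign r ℤ.* + size₀ h r ℤ.* (1ℤ ℤ.* blockPoly (m + m) (suc q) (+ h) ℤ.* blockPoly m (suc q) (+ h) ℤ.* abovePoly h r) ℤ.* (+ (h !) ℤ.* 1ℤ)
        ≡⟨ cong (λ a → sign r ℤ.* + size₀ h r ℤ.* a ℤ.* (+ (h !) ℤ.* 1ℤ))
             (cong₂ (λ a b → 1ℤ ℤ.* a ℤ.* b ℤ.* abovePoly h r) (below (m + m) h e' r (trans (cong (λ k → suc k + e + m) (sym (h+r≡ eq))) (x₁ h r e m)))
                    (below m h e r (trans (cong (λ k → suc k + e) (sym (h+r≡ eq))) (x₂ h r e)))) ⟩
      sign r ℤ.* + size₀ h r ℤ.* (1ℤ ℤ.* (σ ℤ.* + rise (e' + r) (suc q)) ℤ.* (σ ℤ.* + rise (e + r) (suc q)) ℤ.* abovePoly h r) ℤ.* (+ (h !) ℤ.* 1ℤ)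
        ≡⟨ cong (λ a → sign r ℤ.* + size₀ h r ℤ.* (1ℤ ℤ.* (σ ℤ.* + rise (e' + r) (suc q)) ℤ.* (σ ℤ.* + rise (e + r) (suc q)) ℤ.* a) ℤ.* (+ (h !) ℤ.* 1ℤ)) (abovePoly-factorial h r) ⟩
      sign r ℤ.* + size₀ h r ℤ.* (1ℤ ℤ.* (σ ℤ.* + rise (e' + r) (suc q)) ℤ.* (σ ℤ.* + rise (e + r) (suc q)) ℤ.* (sign r ℤ.* + (r !))) ℤ.* (+ (h !) ℤ.* 1ℤ)
        ≡⟨ rearrange σ (sign r) (+ size₀ h r) (+ (r !)) (+ (h !)) (+ rise (e' + r) (suc q)) (+ rise (e + r) (suc q)) ⟩
      (σ ℤ.* σ) ℤ.* (sign r ℤ.* sign r) ℤ.* (+ size₀ h r ℤ.* (+ (h !) ℤ.* + (r !)) ℤ.* (+ rise (e' + r) (suc q) ℤ.* + rise (e + r) (suc q)))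
        ≡⟨ cong₂ ℤ._*_ (cong₂ ℤ._*_ (sign² (suc q)) (sign² r)) (pos-product (size₀ h r) (h !) (r !) (rise (e' + r) (suc q)) (rise (e + r) (suc q))) ⟩
      1ℤ ℤ.* 1ℤ ℤ.* + (size₀ h r * (h ! * r !) * (rise (e' + r) (suc q) * rise (e + r) (suc q)))
        ≡⟨ trans (ℤ.*-identityˡ _) (cong +_ (weight-product h r (flank e' r h) (flank e r h) (binomial e) (rise (e' + r) (suc q)) (rise (e + r) (suc q)) e' e (h+r≡ eq)
             (swapped r h (flank e' r h) (flank-spec e' r h (r+h≡ eq))) (swapped r h (flank e r h) (flank-spec e r h (r+h≡ eq))) (c₀ (binomial e) (binomial e')))) ⟩
      + scale ∎
      where
      σ = sign (suc q)
      x₁ : ∀ h r e m → suc (h + r) + e + m ≡ h + suc (e + m + r)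
      x₁ = solve-∀
      x₂ : ∀ h r e → suc (h + r) + e ≡ h + suc (e + r)
      x₂ = solve-∀
      c₀ : ∀ a b → b * a * a ≡ a * a * b
      c₀ = solve-∀
      rearrange : ∀ σ s w f g R S → s ℤ.* w ℤ.* (1ℤ ℤ.* (σ ℤ.* R) ℤ.* (σ ℤ.* S) ℤ.* (s ℤ.* f)) ℤ.* (g ℤ.* 1ℤ) ≡ (σ ℤ.* σ) ℤ.* (s ℤ.* s) ℤ.* (w ℤ.* (g ℤ.* f) ℤ.* (R ℤ.* S))
      rearrange = ℤ-solve-∀

-- Exponential bounds on the weights and on their common normalisation

*-≤-2^ : ∀ {x y} i j → x ≤ 2 ^ i → y ≤ 2 ^ j → x * y ≤ 2 ^ (i + j)
*-≤-2^ i j x≤ y≤ = ≤-trans (*-mono-≤ x≤ y≤) (≤-reflexive (sym (^-distribˡ-+-* 2 i j)))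

sumBelow : ℕ → (ℕ → ℤ) → ℤ
sumBelow zero    g = 0ℤ
sumBelow (suc n) g = g n ℤ.+ sumBelow n g

sumBelow-scale : ∀ n K {f g} → (∀ h → h < n → f h ≡ K ℤ.* g h) → sumBelow n f ≡ K ℤ.* sumBelow n g
sumBelow-scale zero    K _ = sym (ℤ.*-zeroʳ K)
sumBelow-scale (suc n) K {f} {g} p = trans (cong₂ ℤ._+_ (p n ≤-refl) (sumBelow-scale n K (λ h h<n → p h (<-trans h<n ≤-refl))))
  (sym (ℤ.*-distribˡ-+ K (g n) (sumBelow n g)))

sumBelow-bound : ∀ n M g → (∀ h → h < n → ℤ.∣ g h ∣ ≤ M) → ℤ.∣ sumBelow n g ∣ ≤ n * M
sumBelow-bound zero    M g _ = z≤n
sumBelow-bound (suc n) M g p = ≤-trans (ℤ.∣i+j∣≤∣i∣+∣j∣ (g n) (sumBelow n g))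
  (+-mono-≤ (p n ≤-refl) (sumBelow-bound n M g (λ h h<n → p h (<-trans h<n ≤-refl))))

weigh-nodeBlock : ∀ o w n T f → weigh (λ _ → 1ℤ) (nodeBlock o w n T) f ≡ sumBelow n (λ h → w h ℤ.* f (o + h)) ℤ.+ weigh (λ _ → 1ℤ) T f
weigh-nodeBlock o w zero    T f = sym (ℤ.+-identityˡ (weigh (λ _ → 1ℤ) T f))
weigh-nodeBlock o w (suc n) T f = trans (cong₂ ℤ._+_ (cong (ℤ._* f (o + n)) (ℤ.*-identityʳ (w n))) (weigh-nodeBlock o w n T f))
  (sym (ℤ.+-assoc (w n ℤ.* f (o + n)) _ _))

module Bounds (q e : ℕ) where
  open ThreeBlocks q e
  open RowMultiple (rowMultiple q)
  open ≤-Reasoning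

  v : ℕ
  v = q + suc q + suc q

  private
    F = suc (q + q) !
    X = (q + v) C q
    Y = (suc (q + q) + suc (q + q)) C suc (q + q)
    B = binomial e * binomial e * binomial e'
    e+2q+1 : e + suc (q + q) ≡ m + q
    e+2q+1 = lemma q e
      where
      lemma : ∀ q e → e + suc (q + q) ≡ suc q + e + q
      lemma = solve-∀
    e'+2q+1 : e' + suc (q + q) ≡ m + m + q
    e'+2q+1 = lemma q e
      where
      lemma : ∀ q e → e + (suc q + e) + suc (q + q) ≡ suc q + e + (suc q + e) + q
      lemma = solve-∀
    binomial≤ : binomial e ≤ 2 ^ (m + q)
    binomial≤ = ≤-trans (C≤2^n (e + suc (q + q)) (suc (q + q))) (≤-reflexive (cong (2 ^_) e+2q+1))
    binomial'≤ : binomial e' ≤ 2 ^ (m + m + q)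
    binomial'≤ = ≤-trans (C≤2^n (e' + suc (q + q)) (suc (q + q))) (≤-reflexive (cong (2 ^_) e'+2q+1))
    1≤binomial : ∀ x → 1 ≤ binomial x
    1≤binomial x = subst (λ n → 1 ≤ n C suc (q + q)) (+-comm (suc (q + q)) x) (1≤C (suc (q + q)) x)
    Λ≤2^ : Λ ≤ 2 ^ (q + q)
    Λ≤2^ = ≤-trans Λ≤ (≤-reflexive (trans (^-*-assoc 2 2 q) (cong (λ x → 2 ^ (q + x)) (+-identityʳ q))))
    4q+2 : q + v ≡ suc (q + q) + suc (q + q)
    4q+2 = lemma q
      where
      lemma : ∀ q → q + (q + suc q + suc q) ≡ suc (q + q) + suc (q + q)
      lemma = solve-∀
    scale-identity : scale * Y ≡ Λ * B * X * v !
    scale-identity = *-cancelˡ-≡ _ _ (q !) {{q !≢0}} (begin-equality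
      q ! * (scale * Y) ≡⟨ sym (*-assoc (q !) scale Y) ⟩
      q ! * scale * Y ≡⟨ cong (_* Y) q!*scale ⟩
      Λ * (F * F) * B * Y ≡⟨ e₁ Λ F B Y ⟩
      Λ * B * (Y * (F * F)) ≡⟨ cong (Λ * B *_) (trans (C-factorial (suc (q + q)) (suc (q + q))) (trans (cong _! (sym 4q+2)) (sym (C-factorial q v)))) ⟩
      Λ * B * (X * (q ! * v !)) ≡⟨ e₂ Λ B X (q !) (v !) ⟩
      q ! * (Λ * B * X * v !) ∎)
      where
      e₁ : ∀ L F B Y → L * (F * F) * B * Y ≡ L * B * (Y * (F * F))
      e₁ = solve-∀
      e₂ : ∀ L B X a b → L * B * (X * (a * b)) ≡ a * (L * B * X * b)
      e₂ = solve-∀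

  -- `C(4q+2,2q+1)((2q+1)!)² = (4q+2)!`, and since `q + v = 4q + 2` this is also `C(q+v,q) q! v!`.
  -- So `scale/v!` is bounded above and below by powers of 2, and no factorial survives in the
  -- estimates for `W`.
  scale-lower : v ! ≤ scale * 2 ^ (q + v)
  scale-lower = begin
    v ! ≤⟨ m≤n*m (v !) (Λ * B * X) {{>-nonZero (*-mono-≤ {1} {Λ * B} (*-mono-≤ Λ>0 (*-mono-≤ {1} {binomial e * binomial e} (*-mono-≤ (1≤binomial e) (1≤binomial e)) (1≤binomial e'))) (1≤C q v))}} ⟩
    Λ * B * X * v ! ≡⟨ sym scale-identity ⟩
    scale * Y ≤⟨ *-monoʳ-≤ scale (≤-trans (C≤2^n _ (suc (q + q))) (≤-reflexive (cong (2 ^_) (sym 4q+2)))) ⟩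
    scale * 2 ^ (q + v) ∎

  scale-upper : scale ≤ v ! * 2 ^ (4 * m + 5 * q + (q + v))
  scale-upper = begin
    scale ≤⟨ m≤m*n scale Y {{>-nonZero (1≤C (suc (q + q)) (suc (q + q)))}} ⟩
    scale * Y ≡⟨ scale-identity ⟩
    Λ * B * X * v !
      ≤⟨ *-monoˡ-≤ (v !) (*-≤-2^ (q + q + (m + q + (m + q) + (m + m + q))) (q + v)
           (*-≤-2^ (q + q) (m + q + (m + q) + (m + m + q)) Λ≤2^ (*-≤-2^ (m + q + (m + q)) (m + m + q) (*-≤-2^ (m + q) (m + q) binomial≤ binomial≤) binomial'≤))
           (C≤2^n (q + v) q)) ⟩
    2 ^ (q + q + (m + q + (m + q) + (m + m + q)) + (q + v)) * v !
      ≡⟨ trans (*-comm (2 ^ (q + q + (m + q + (m + q) + (m + m + q)) + (q + v))) (v !)) (cong (λ z → v ! * 2 ^ (z + (q + v))) (lemma m q)) ⟩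
    v ! * 2 ^ (4 * m + 5 * q + (q + v)) ∎
    where
    lemma : ∀ m q → q + q + (m + q + (m + q) + (m + m + q)) ≡ 4 * m + 5 * q
    lemma = solve-∀

  0<scale : 1 ≤ scale
  0<scale = n≢0⇒n>0 λ scale≡0 → <⇒≱ (>-nonZero⁻¹ (v !) {{v !≢0}}) (subst (λ z → v ! ≤ z * 2 ^ (q + v)) scale≡0 scale-lower)

  private
    flank≤ : ∀ x h r → h + r ≡ q → flank x h r ≤ 2 ^ (x + suc q + (x + suc q + q))
    flank≤ x h r eq = begin
      flank x h r ≤⟨ *-mono-≤ (C≤2^n (x + h) h) (C≤2^n (x + h + suc q + r) r) ⟩
      2 ^ (x + h) * 2 ^ (x + h + suc q + r) ≡⟨ sym (^-distribˡ-+-* 2 (x + h) (x + h + suc q + r)) ⟩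
      2 ^ (x + h + (x + h + suc q + r)) ≤⟨ ^-monoʳ-≤ 2 (+-mono-≤ (+-monoʳ-≤ x (≤-trans (m≤m+n h r) (≤-trans (≤-reflexive eq) (n≤1+n q)))) (≤-reflexive (trans (lemma x h r q) (cong (λ z → x + suc q + z) eq)))) ⟩
      2 ^ (x + suc q + (x + suc q + q)) ∎
      where
      lemma : ∀ x h r q → x + h + suc q + r ≡ x + suc q + (h + r)
      lemma = solve-∀
    product≤ : ∀ {w f g c} i j k → w ≤ Λ → f ≤ 2 ^ i → g ≤ 2 ^ j → c ≤ 2 ^ k → q + q + i + j + k ≤ 7 * m + 5 * q →
               w * f * g * c ≤ 2 ^ (7 * m + 5 * q)
    product≤ i j k w≤ f≤ g≤ c≤ le = ≤-trans
      (*-≤-2^ (q + q + i + j) k (*-≤-2^ (q + q + i) j (*-≤-2^ (q + q) i (≤-trans w≤ Λ≤2^) f≤) g≤) c≤)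
      (^-monoʳ-≤ 2 le)
    exponents : ∀ q e → let m = suc q + e in q + q + (e + suc q + (e + suc q + q)) + (e + m + suc q + (e + m + suc q + q)) + (m + q) ≡ 7 * m + 5 * q
    exponents = solve-∀
    exponents′ : ∀ q e → let m = suc q + e in q + q + (e + suc q + (e + suc q + q)) + (e + suc q + (e + suc q + q)) + (m + m + q) + m ≡ 7 * m + 5 * q
    exponents′ = solve-∀
    exponents″ : ∀ q e → let m = suc q + e in q + q + (e + m + suc q + (e + m + suc q + q)) + (e + suc q + (e + suc q + q)) + (m + q) ≡ 7 * m + 5 * q
    exponents″ = solve-∀
    h+q∸h : ∀ {h} → h < suc q → h + (q ∸ h) ≡ q
    h+q∸h (s≤s h≤q) = m+[n∸m]≡n h≤q
    flip : ∀ h r → h + r ≡ q → r + h ≡ q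
    flip h r eq = trans (+-comm r h) eq
    sign-size : ∀ n w → ℤ.∣ sign n ℤ.* + w ∣ ≡ w
    sign-size n w = trans (ℤ.abs-* (sign n) (+ w)) (trans (cong (_* w) (∣sign∣ n)) (+-identityʳ w))

    flankExponent : ℕ → ℕ
    flankExponent x = x + suc q + (x + suc q + q)

  -- The exponent adds up as `2q` for `cofac`, `2m + q` and `4m + q` for the flanks at gaps `e` and
  -- `e'`, and `m + q` for `binomial e`.
  weight₀≤ : ∀ h → h < suc q → ℤ.∣ weight₀ h ∣ ≤ 2 ^ (7 * m + 5 * q)
  weight₀≤ h h≤q = ≤-trans (≤-reflexive (sign-size r (size₀ h r)))
    (product≤ (flankExponent e') (flankExponent e) (m + q) (cofac≤Λ h r h+r) (flank≤ e' r h (flip h r h+r)) (flank≤ e r h (flip h r h+r))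
      binomial≤ (≤-reflexive (exponents″ q e)))
    where
    r = q ∸ h
    h+r = h+q∸h h≤q

  weight₁≤ : ∀ h → h < suc q → ℤ.∣ weight₁ h ∣ ≤ 2 ^ (7 * m + 5 * q)
  weight₁≤ h h≤q = ≤-trans (≤-reflexive (begin-equality
      ℤ.∣ weight₁ h ∣ ≡⟨ cong ℤ.∣_∣ (ℤ.*-assoc (sign (suc q)) (sign r) (+ size₁ h r)) ⟩
      ℤ.∣ sign (suc q) ℤ.* (sign r ℤ.* + size₁ h r) ∣ ≡⟨ ℤ.abs-* (sign (suc q)) (sign r ℤ.* + size₁ h r) ⟩
      ℤ.∣ sign (suc q) ∣ * ℤ.∣ sign r ℤ.* + size₁ h r ∣ ≡⟨ cong₂ _*_ (∣sign∣ (suc q)) (sign-size r (size₁ h r)) ⟩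
      1 * size₁ h r ≡⟨ *-identityˡ (size₁ h r) ⟩
      size₁ h r ∎))
    (product≤ (flankExponent e) (flankExponent e) (m + m + q) (cofac≤Λ h r h+r) (flank≤ e r h (flip h r h+r)) (flank≤ e h r h+r)
      binomial'≤ (≤-trans (m≤m+n _ m) (≤-reflexive (exponents′ q e))))
    where
    r = q ∸ h
    h+r = h+q∸h h≤q

  weight₂≤ : ∀ h → h < suc q → ℤ.∣ weight₂ h ∣ ≤ 2 ^ (7 * m + 5 * q)
  weight₂≤ h h≤q = ≤-trans (≤-reflexive (sign-size r (size₂ h r)))
    (product≤ (flankExponent e) (flankExponent e') (m + q) (cofac≤Λ h r h+r) (flank≤ e h r h+r) (flank≤ e' h r h+r)
      binomial≤ (≤-reflexive (exponents q e)))
    where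
    r = q ∸ h
    h+r = h+q∸h h≤q

-- The linear form in the powers of `cᵐ` and `bᵐ`

module LinearForm (q e b d : ℕ) where
  open ThreeBlocks q e public
  open Bounds q e public
  open Horner b d public

  c N : ℕ
  c = b + d
  N = v + (e + e)

  N≡ : N ≡ m + m + q
  N≡ = lemma q e
    where
    lemma : ∀ q e → q + suc q + suc q + (e + e) ≡ suc q + e + (suc q + e) + q
    lemma = solve-∀

  W : ℤ
  W = weigh (λ _ → 1ℤ) nodes (power N)

  coeff : (ℕ → ℤ) → ℤ
  coeff w = sumBelow (suc q) (λ h → w h ℤ.* + (c ^ h * b ^ (q ∸ h)))

  private
    block-value : ∀ w o y → o + y ≡ m + m → sumBelow (suc q) (λ h → w h ℤ.* power N (o + h)) ≡ + (c ^ o * b ^ y) ℤ.* coeff w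
    block-value w o y oy = sumBelow-scale (suc q) (+ (c ^ o * b ^ y)) λ h h≤q → begin
      w h ℤ.* power N (o + h) ≡⟨ cong (ℤ._*_ (w h)) (trans (cong (λ n → power n (o + h)) (split h h≤q)) (horner-binom (o + h) (y + (q ∸ h)))) ⟩
      w h ℤ.* + (c ^ (o + h) * b ^ (y + (q ∸ h))) ≡⟨ cong (λ z → w h ℤ.* + z) (trans (cong₂ _*_ (^-distribˡ-+-* c o h) (^-distribˡ-+-* b y (q ∸ h))) (lemma₁ (c ^ o) (c ^ h) (b ^ y) (b ^ (q ∸ h)))) ⟩
      w h ℤ.* + (c ^ o * b ^ y * (c ^ h * b ^ (q ∸ h))) ≡⟨ cong (ℤ._*_ (w h)) (ℤ.pos-* (c ^ o * b ^ y) (c ^ h * b ^ (q ∸ h))) ⟩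
      w h ℤ.* (+ (c ^ o * b ^ y) ℤ.* + (c ^ h * b ^ (q ∸ h))) ≡⟨ lemma₂ (w h) (+ (c ^ o * b ^ y)) (+ (c ^ h * b ^ (q ∸ h))) ⟩
      + (c ^ o * b ^ y) ℤ.* (w h ℤ.* + (c ^ h * b ^ (q ∸ h))) ∎
      where
      open ≡-Reasoning
      split : ∀ h → h < suc q → N ≡ o + h + (y + (q ∸ h))
      split h (s≤s h≤q) = trans N≡ (trans (cong₂ _+_ (sym oy) (sym (m+[n∸m]≡n h≤q))) (lemma o y h (q ∸ h)))
        where
        lemma : ∀ o y h r → o + y + (h + r) ≡ o + h + (y + r)
        lemma = solve-∀
      lemma₁ : ∀ a b c d → a * b * (c * d) ≡ a * c * (b * d)
      lemma₁ = solve-∀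
      lemma₂ : ∀ a b c → a ℤ.* (b ℤ.* c) ≡ b ℤ.* (a ℤ.* c)
      lemma₂ = ℤ-solve-∀

  -- The node `jm + h` carries `c^(jm) b^((2−j)m)` times `c^h b^(q−h)`. The first factor depends on
  -- the block only, so each block collapses to one integer coefficient.
  W-expand : W ≡ + (c ^ m * c ^ m) ℤ.* coeff weight₂ ℤ.+ + (c ^ m * b ^ m) ℤ.* coeff weight₁ ℤ.+ + (b ^ m * b ^ m) ℤ.* coeff weight₀
  W-expand = begin
    W ≡⟨ weigh-nodeBlock (m + m) weight₂ (suc q) nodes₁ f ⟩
    S₂ ℤ.+ weigh (λ _ → 1ℤ) nodes₁ f ≡⟨ cong (ℤ._+_ S₂) (weigh-nodeBlock m weight₁ (suc q) nodes₀ f) ⟩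
    S₂ ℤ.+ (S₁ ℤ.+ weigh (λ _ → 1ℤ) nodes₀ f) ≡⟨ cong (λ z → S₂ ℤ.+ (S₁ ℤ.+ z)) (trans (weigh-nodeBlock 0 weight₀ (suc q) [] f) (ℤ.+-identityʳ S₀)) ⟩
    S₂ ℤ.+ (S₁ ℤ.+ S₀) ≡⟨ sym (ℤ.+-assoc S₂ S₁ S₀) ⟩
    S₂ ℤ.+ S₁ ℤ.+ S₀
      ≡⟨ cong₂ ℤ._+_ (cong₂ ℤ._+_
           (trans (block-value weight₂ (m + m) 0 (+-identityʳ (m + m))) (cong (λ z → + z ℤ.* coeff weight₂) (trans (*-identityʳ _) (^-distribˡ-+-* c m m))))
           (block-value weight₁ m m refl))
           (trans (block-value weight₀ 0 (m + m) refl) (cong (λ z → + z ℤ.* coeff weight₀) (trans (+-identityʳ _) (^-distribˡ-+-* b m m)))) ⟩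
    + (c ^ m * c ^ m) ℤ.* coeff weight₂ ℤ.+ + (c ^ m * b ^ m) ℤ.* coeff weight₁ ℤ.+ + (b ^ m * b ^ m) ℤ.* coeff weight₀ ∎
    where
    open ≡-Reasoning
    f = power N
    S₂ = sumBelow (suc q) (λ h → weight₂ h ℤ.* f (m + m + h))
    S₁ = sumBelow (suc q) (λ h → weight₁ h ℤ.* f (m + h))
    S₀ = sumBelow (suc q) (λ h → weight₀ h ℤ.* f (0 + h))

  coeff≤ : ∀ w → (∀ h → h < suc q → ℤ.∣ w h ∣ ≤ 2 ^ (7 * m + 5 * q)) → ℤ.∣ coeff w ∣ ≤ suc q * (2 ^ (7 * m + 5 * q) * c ^ q)
  coeff≤ w w≤ = sumBelow-bound (suc q) _ (λ h → w h ℤ.* + (c ^ h * b ^ (q ∸ h))) λ { h (s≤s h≤q) → begin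
    ℤ.∣ w h ℤ.* + (c ^ h * b ^ (q ∸ h)) ∣ ≡⟨ ℤ.abs-* (w h) (+ (c ^ h * b ^ (q ∸ h))) ⟩
    ℤ.∣ w h ∣ * (c ^ h * b ^ (q ∸ h)) ≤⟨ *-mono-≤ (w≤ h (s≤s h≤q)) (*-monoʳ-≤ (c ^ h) (^-monoˡ-≤ (q ∸ h) (m≤m+n b d))) ⟩
    2 ^ (7 * m + 5 * q) * (c ^ h * c ^ (q ∸ h)) ≡⟨ cong (λ z → 2 ^ (7 * m + 5 * q) * z) (trans (sym (^-distribˡ-+-* c h (q ∸ h))) (cong (c ^_) (m+[n∸m]≡n h≤q))) ⟩
    2 ^ (7 * m + 5 * q) * c ^ q ∎ }
    where open ≤-Reasoning

  private
    desc : Below (suc N) nodes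
    desc = subst (λ n → Below n nodes) (trans (+-suc (m + m) q) (cong suc (sym N≡))) nodes-descending

  W-lower : + (d ^ v * b ^ (e + e)) ℤ.* + scale ℤ.≤ + (v !) ℤ.* W
  W-lower = divided-lower v (e + e) (ℤ.+≤+ z≤n) nodes-weights desc length-nodes

  W-upper : + (b ^ v) ℤ.* (+ (v !) ℤ.* W) ℤ.≤ + (d ^ v * c ^ N) ℤ.* + scale
  W-upper = divided-upper v (e + e) (ℤ.+≤+ z≤n) nodes-weights desc length-nodes

-- Excluding large bases

^-distribʳ-* : ∀ x y n → (x * y) ^ n ≡ x ^ n * y ^ n
^-distribʳ-* x y zero    = refl
^-distribʳ-* x y (suc n) = trans (cong (x * y *_) (^-distribʳ-* x y n)) (lemma x y (x ^ n) (y ^ n))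
  where
  lemma : ∀ x y p q → x * y * (p * q) ≡ x * p * (y * q)
  lemma = solve-∀

n<2^n : ∀ n → suc n ≤ 2 ^ n
n<2^n zero    = ≤-refl
n<2^n (suc n) = begin
  suc (suc n) ≤⟨ s≤s (m≤n+m (suc n) n) ⟩
  suc n + suc n ≤⟨ +-mono-≤ (n<2^n n) (n<2^n n) ⟩
  2 ^ n + 2 ^ n ≡⟨ cong (λ x → 2 ^ n + x) (sym (+-identityʳ (2 ^ n))) ⟩
  2 ^ suc n ∎
  where open ≤-Reasoning

∣pos-difference∣ : ∀ {P Q K} → P ≤ Q + K → Q ≤ P + K → ℤ.∣ + P ℤ.- + Q ∣ ≤ K
∣pos-difference∣ {P} {Q} {K} P≤ Q≤ with ≤-total P Q
... | inj₁ P≤Q = subst (λ z → ℤ.∣ + P ℤ.- + z ∣ ≤ K) (m+[n∸m]≡n P≤Q)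
  (subst (λ z → ℤ.∣ z ∣ ≤ K) (sym (neg-difference P (Q ∸ P))) (subst (_≤ K) (sym (ℤ.∣-i∣≡∣i∣ (+ (Q ∸ P)))) (m≤n+o⇒m∸n≤o Q P Q≤)))
... | inj₂ Q≤P = subst (λ z → ℤ.∣ + z ℤ.- + Q ∣ ≤ K) (m+[n∸m]≡n Q≤P)
  (subst (λ z → ℤ.∣ z ∣ ≤ K) (sym (pos-difference Q (P ∸ Q))) (m≤n+o⇒m∸n≤o P Q P≤))

2^≤b^ : ∀ {a b} → 2 ^ a ≤ b → ∀ i g → i ≤ a * g → 2 ^ i ≤ b ^ g
2^≤b^ {a} large i g i≤ = ≤-trans (^-monoʳ-≤ 2 i≤) (≤-trans (≤-reflexive (sym (^-*-assoc 2 a g))) (^-monoˡ-≤ g large))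

2^<b^ : ∀ {a b} → 2 ^ a ≤ b → ∀ i g → i < a * g → 2 ^ i < b ^ g
2^<b^ {a} large i g i< = <-≤-trans (^-monoʳ-< 2 ≤-refl i<) (2^≤b^ {a} large (a * g) g ≤-refl)

-- The inequalities `k³ ≤ b²`, `q + 1 ≤ 2^q` and `cⁿ ≤ 2ⁿbⁿ` reduce the left side to `b^(2+m+q)`
-- times a power of 2, and the spare factor `b^g` of `W` pays for that power.
error-estimate : ∀ {k b c W} m q p u g → k * k ≤ b → k ≤ b → 1 ≤ b → (∀ n → c ^ n ≤ 2 ^ n * b ^ n) →
  2 ^ (p + (2 + q + u + (m + q))) < b ^ g → b ^ (2 + (m + q) + g) ≤ 2 ^ p * W →
  k * k * (4 * (k * c ^ m)) * (suc q * (2 ^ u * c ^ q)) < W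
error-estimate {k} {b} {c} {W} m q p u g kk≤b k≤b 1≤b c^≤ small W≥ = *-cancelˡ-< (2 ^ p) _ _ (begin-strict
  2 ^ p * (k * k * (4 * (k * c ^ m)) * (suc q * (2 ^ u * c ^ q))) ≡⟨ e₁ (2 ^ p) k (c ^ m) (suc q) (2 ^ u) (c ^ q) ⟩
  k * k * k * (2 ^ p * (4 * suc q * 2 ^ u) * (c ^ m * c ^ q))
    ≤⟨ *-mono-≤ (*-mono-≤ kk≤b k≤b) (*-mono-≤ (*-monoʳ-≤ (2 ^ p) (*-≤-2^ (2 + q) u (*-≤-2^ 2 q ≤-refl (n<2^n q)) ≤-refl))
         (≤-trans (≤-reflexive (sym (^-distribˡ-+-* c m q))) (c^≤ (m + q)))) ⟩
  b * b * (2 ^ p * 2 ^ (2 + q + u) * (2 ^ (m + q) * b ^ (m + q))) ≡⟨ e₂ b (2 ^ p) (2 ^ (2 + q + u)) (2 ^ (m + q)) (b ^ (m + q)) ⟩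
  b ^ (2 + (m + q)) * (2 ^ p * (2 ^ (2 + q + u) * 2 ^ (m + q)))
    ≤⟨ *-monoʳ-≤ (b ^ (2 + (m + q))) (*-≤-2^ p (2 + q + u + (m + q)) ≤-refl (*-≤-2^ (2 + q + u) (m + q) ≤-refl ≤-refl)) ⟩
  b ^ (2 + (m + q)) * 2 ^ (p + (2 + q + u + (m + q))) <⟨ *-monoʳ-< (b ^ (2 + (m + q))) {{m^n≢0 b (2 + (m + q)) {{>-nonZero 1≤b}}}} small ⟩
  b ^ (2 + (m + q)) * b ^ g ≡⟨ sym (^-distribˡ-+-* b (2 + (m + q)) g) ⟩
  b ^ (2 + (m + q) + g) ≤⟨ W≥ ⟩
  2 ^ p * W ∎)
  where
  open ≤-Reasoning
  e₁ : ∀ p k C q P C' → p * (k * k * (4 * (k * C)) * (q * (P * C'))) ≡ k * k * k * (p * (4 * q * P) * (C * C'))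
  e₁ = solve-∀
  e₂ : ∀ b p x y z → b * b * (p * x * (y * z)) ≡ b * (b * z) * (p * (x * y))
  e₂ = solve-∀

-- Replacing t cᵐ by s bⁿ in t²W turns it into an integer multiple Z of b²ᵐ; the estimates
-- force 0 < Z < 1.
module LargeBase (q e b d k s t ℓ q' r g : ℕ)
  (q≡ : q ≡ 24 + q') (e≡ : e ≡ 3 * q' + 71 + r) (g≡ : g ≡ 20 + q' + r) (r≤3 : r ≤ 3)
  (1≤d : 1 ≤ d) (d≤k : d ≤ k) (kk≤b : k * k ≤ b) (1≤t : 1 ≤ t) (t≤k : t ≤ k) (large : 2 ^ 96 ≤ b) where

  open LinearForm q e b d public

  private
    1≤b : 1 ≤ b
    1≤b = ≤-trans (m^n>0 2 96) large
    b-nonZero = >-nonZero 1≤b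
    b^-nonZero : ∀ n → NonZero (b ^ n)
    b^-nonZero n = m^n≢0 b n {{b-nonZero}}
    1≤k : 1 ≤ k
    1≤k = ≤-trans 1≤t t≤k
    k≤b : k ≤ b
    k≤b = ≤-trans (m≤m*n k k {{>-nonZero 1≤k}}) kk≤b
    b≤c : b ≤ c
    b≤c = m≤m+n b d
    c≤2b : c ≤ 2 * b
    c≤2b = +-monoʳ-≤ b (≤-trans (≤-trans d≤k k≤b) (≤-reflexive (sym (+-identityʳ b))))
    c^≤ : ∀ n → c ^ n ≤ 2 ^ n * b ^ n
    c^≤ n = ≤-trans (^-monoˡ-≤ n c≤2b) (≤-reflexive (^-distribʳ-* 2 b n))
    1≤m : 1 ≤ m
    1≤m = s≤s z≤n
    instance
      scale-nonZero : NonZero scale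
      scale-nonZero = >-nonZero 0<scale
      v!-nonZero : NonZero (v !)
      v!-nonZero = v !≢0

  Wn : ℕ
  Wn = ℤ.∣ W ∣

  private
    W≡ : + Wn ≡ W
    W≡ = ℤ.0≤i⇒+∣i∣≡i (ℤ.*-cancelˡ-≤-pos 0ℤ W (+ (v !)) {{ℤ.positive (ℤ.+<+ (>-nonZero⁻¹ (v !)))}}
      (ℤ.≤-trans (ℤ.≤-reflexive (ℤ.*-zeroʳ (+ (v !)))) (ℤ.≤-trans (ℤ-*-nonNeg {+ (d ^ v * b ^ (e + e))} {+ scale} (ℤ.+≤+ z≤n) (ℤ.+≤+ z≤n)) W-lower)))

    Wn-lower : b ^ (e + e) ≤ 2 ^ (q + v) * Wn
    Wn-lower = *-cancelʳ-≤ _ _ scale (begin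
      b ^ (e + e) * scale ≤⟨ *-monoˡ-≤ scale (m≤n*m (b ^ (e + e)) (d ^ v) {{m^n≢0 d v {{>-nonZero 1≤d}}}}) ⟩
      d ^ v * b ^ (e + e) * scale ≤⟨ ℤ.drop‿+≤+ (subst₂ ℤ._≤_ (sym (ℤ.pos-* (d ^ v * b ^ (e + e)) scale)) (trans (cong (ℤ._*_ (+ (v !))) (sym W≡)) (sym (ℤ.pos-* (v !) Wn))) W-lower) ⟩
      v ! * Wn ≤⟨ *-monoˡ-≤ Wn scale-lower ⟩
      scale * 2 ^ (q + v) * Wn ≡⟨ lemma scale (2 ^ (q + v)) Wn ⟩
      2 ^ (q + v) * Wn * scale ∎)
      where
      open ≤-Reasoning
      lemma : ∀ a b c → a * b * c ≡ b * c * a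
      lemma = solve-∀

    X : ℕ
    X = 4 * m + 5 * q + (q + v)

    Wn-upper : b ^ v * Wn ≤ d ^ v * c ^ N * 2 ^ X
    Wn-upper = *-cancelˡ-≤ (v !) (begin
      v ! * (b ^ v * Wn) ≡⟨ e₁ (v !) (b ^ v) Wn ⟩
      b ^ v * (v ! * Wn)
        ≤⟨ ℤ.drop‿+≤+ (subst₂ ℤ._≤_ (trans (cong (λ z → + (b ^ v) ℤ.* (+ (v !) ℤ.* z)) (sym W≡)) (trans (cong (ℤ._*_ (+ (b ^ v))) (sym (ℤ.pos-* (v !) Wn))) (sym (ℤ.pos-* (b ^ v) (v ! * Wn)))))
             (sym (ℤ.pos-* (d ^ v * c ^ N) scale)) W-upper) ⟩
      d ^ v * c ^ N * scale ≤⟨ *-monoʳ-≤ (d ^ v * c ^ N) scale-upper ⟩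
      d ^ v * c ^ N * (v ! * 2 ^ X) ≡⟨ e₂ (d ^ v * c ^ N) (v !) (2 ^ X) ⟩
      v ! * (d ^ v * c ^ N * 2 ^ X) ∎)
      where
      open ≤-Reasoning
      e₁ : ∀ a b c → a * (b * c) ≡ b * (a * c)
      e₁ = solve-∀
      e₂ : ∀ a b c → a * (b * c) ≡ b * (a * c)
      e₂ = solve-∀

  A-bound : ℕ
  A-bound = suc q * (2 ^ (7 * m + 5 * q) * c ^ q)

  private
    i₁ : ℕ
    i₁ = (q + v) + (2 + q + (7 * m + 5 * q) + (m + q))
    e+e≡ : e + e ≡ 2 + (m + q) + g
    e+e≡ rewrite e≡ | q≡ | g≡ = lemma q' r
      where
      lemma : ∀ q' r → (3 * q' + 71 + r) + (3 * q' + 71 + r) ≡ 2 + (suc (24 + q') + (3 * q' + 71 + r) + (24 + q')) + (20 + q' + r)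
      lemma = solve-∀
    i₁< : i₁ < 96 * g
    i₁< rewrite e≡ | q≡ | g≡ = ≤-trans (m≤m+n _ (883 + 53 * q' + 88 * r)) (≤-reflexive (lemma q' r))
      where
      lemma : ∀ q' r → let q = 24 + q'; e = 3 * q' + 71 + r; m = suc q + e in
        suc ((q + (q + suc q + suc q)) + (2 + q + (7 * m + 5 * q) + (m + q))) + (883 + 53 * q' + 88 * r) ≡ 96 * (20 + q' + r)
      lemma = solve-∀

  error-small : k * k * (4 * (k * c ^ m)) * A-bound < Wn
  error-small = error-estimate m q (q + v) (7 * m + 5 * q) g kk≤b k≤b 1≤b c^≤
    (2^<b^ {96} large i₁ g i₁<) (subst (λ z → b ^ z ≤ 2 ^ (q + v) * Wn) e+e≡ Wn-lower)

  private
    exponent-upper : 2 + ((N + X) + (N + X)) ≤ 96 * q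
    exponent-upper rewrite e≡ | q≡ = ≤-trans (+-monoʳ-≤ 2 (≤-trans (≤-reflexive (lemma q' r)) (+-monoʳ-≤ (1636 + 68 * q') (*-monoʳ-≤ 12 r≤3))))
      (≤-trans (m≤m+n _ (630 + 28 * q')) (≤-reflexive (lemma₂ q')))
      where
      lemma : ∀ q' r → let q = 24 + q'; e = 3 * q' + 71 + r; m = suc q + e; v = q + suc q + suc q; N = v + (e + e); X = 4 * m + 5 * q + (q + v) in
        (N + X) + (N + X) ≡ 1636 + 68 * q' + 12 * r
      lemma = solve-∀
      lemma₂ : ∀ q' → 2 + (1636 + 68 * q' + 12 * 3) + (630 + 28 * q') ≡ 96 * (24 + q')
      lemma₂ = solve-∀
    square-≤ : ∀ {x y} → x * x ≤ y * y → x ≤ y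
    square-≤ {x} {y} p = ≮⇒≥ λ y<x → <⇒≱ (*-mono-< y<x y<x) p

  form-small : 2 * (t * t * Wn) ≤ b ^ m * b ^ m
  -- The inequality is proved squared, since `d` is controlled only through `d² ≤ b`. The power
  -- `b^q` that is left over absorbs all powers of 2.
  form-small = square-≤ (*-cancelˡ-≤ (b ^ q) {{b^-nonZero q}} (*-cancelˡ-≤ (b ^ q * b ^ q) {{m*n≢0 (b ^ q) (b ^ q) {{b^-nonZero q}} {{b^-nonZero q}}}} (begin
    b ^ q * b ^ q * (b ^ q * (2 * (t * t * Wn) * (2 * (t * t * Wn)))) ≡⟨ e₁ (b ^ q) t Wn ⟩
    4 * (b ^ q * b ^ q * (t * t * (t * t) * b ^ q) * (Wn * Wn))
      ≤⟨ *-monoʳ-≤ 4 (*-monoˡ-≤ (Wn * Wn) (*-monoʳ-≤ (b ^ q * b ^ q) (*-monoˡ-≤ (b ^ q) (*-mono-≤ tt≤b tt≤b)))) ⟩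
    4 * (b ^ q * b ^ q * (b * b * b ^ q) * (Wn * Wn)) ≡⟨ cong (λ z → 4 * (z * (Wn * Wn))) bᵛ≡ ⟩
    4 * (b ^ v * (Wn * Wn)) ≤⟨ *-monoʳ-≤ 4 squared ⟩
    4 * (2 ^ (N + X) * b ^ N * (2 ^ (N + X) * b ^ N)) ≡⟨ e₂ (2 ^ (N + X)) (b ^ N) ⟩
    4 * (2 ^ (N + X) * 2 ^ (N + X)) * (b ^ N * b ^ N)
      ≤⟨ *-monoˡ-≤ (b ^ N * b ^ N) (≤-trans (*-≤-2^ 2 ((N + X) + (N + X)) ≤-refl (*-≤-2^ (N + X) (N + X) ≤-refl ≤-refl)) (2^≤b^ {96} large (2 + ((N + X) + (N + X))) q exponent-upper)) ⟩
    b ^ q * (b ^ N * b ^ N) ≡⟨ cong (λ z → b ^ q * (z * z)) bᴺ≡ ⟩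
    b ^ q * (b ^ m * b ^ m * b ^ q * (b ^ m * b ^ m * b ^ q)) ≡⟨ e₃ (b ^ q) (b ^ m * b ^ m) ⟩
    b ^ q * b ^ q * (b ^ q * (b ^ m * b ^ m * (b ^ m * b ^ m))) ∎)))
    where
    open ≤-Reasoning
    tt≤b : t * t ≤ b
    tt≤b = ≤-trans (*-mono-≤ t≤k t≤k) kk≤b
    e₁ : ∀ q t W → q * q * (q * (2 * (t * t * W) * (2 * (t * t * W)))) ≡ 4 * (q * q * (t * t * (t * t) * q) * (W * W))
    e₁ = solve-∀
    e₂ : ∀ p B → 4 * (p * B * (p * B)) ≡ 4 * (p * p) * (B * B)
    e₂ = solve-∀
    e₃ : ∀ q M → q * (M * q * (M * q)) ≡ q * q * (q * (M * M))
    e₃ = solve-∀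
    bᵛ≡ : b ^ q * b ^ q * (b * b * b ^ q) ≡ b ^ v
    bᵛ≡ = trans (e₄ b (b ^ q)) (sym (trans (^-distribˡ-+-* b (q + suc q) (suc q)) (cong (_* (b * b ^ q)) (^-distribˡ-+-* b q (suc q)))))
      where
      e₄ : ∀ b q → q * q * (b * b * q) ≡ q * (b * q) * (b * q)
      e₄ = solve-∀
    bᴺ≡ : b ^ N ≡ b ^ m * b ^ m * b ^ q
    bᴺ≡ = trans (cong (b ^_) N≡) (trans (^-distribˡ-+-* b (m + m) q) (cong (_* b ^ q) (^-distribˡ-+-* b m m)))
    squared : b ^ v * (Wn * Wn) ≤ 2 ^ (N + X) * b ^ N * (2 ^ (N + X) * b ^ N)
    squared = *-cancelˡ-≤ (b ^ v) {{b^-nonZero v}} (begin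
      b ^ v * (b ^ v * (Wn * Wn)) ≡⟨ e₅ (b ^ v) Wn ⟩
      b ^ v * Wn * (b ^ v * Wn) ≤⟨ *-mono-≤ upper upper ⟩
      d ^ v * R * (d ^ v * R) ≡⟨ e₆ (d ^ v) R ⟩
      d ^ v * d ^ v * (R * R) ≤⟨ *-monoˡ-≤ (R * R) (≤-trans (≤-reflexive (sym (^-distribʳ-* d d v))) (^-monoˡ-≤ v (≤-trans (*-mono-≤ d≤k d≤k) kk≤b))) ⟩
      b ^ v * (R * R) ∎)
      where
      R = 2 ^ (N + X) * b ^ N
      e₅ : ∀ b W → b * (b * (W * W)) ≡ b * W * (b * W)
      e₅ = solve-∀
      e₆ : ∀ d R → d * R * (d * R) ≡ d * d * (R * R)
      e₆ = solve-∀
      e₇ : ∀ d p x B → d * (p * B) * x ≡ d * (p * x * B)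
      e₇ = solve-∀
      upper : b ^ v * Wn ≤ d ^ v * R
      upper = begin
        b ^ v * Wn ≤⟨ Wn-upper ⟩
        d ^ v * c ^ N * 2 ^ X ≤⟨ *-monoˡ-≤ (2 ^ X) (*-monoʳ-≤ (d ^ v) (c^≤ N)) ⟩
        d ^ v * (2 ^ N * b ^ N) * 2 ^ X ≡⟨ e₇ (d ^ v) (2 ^ N) (2 ^ X) (b ^ N) ⟩
        d ^ v * (2 ^ N * 2 ^ X * b ^ N) ≡⟨ cong (λ z → d ^ v * (z * b ^ N)) (sym (^-distribˡ-+-* 2 N X)) ⟩
        d ^ v * R ∎

  contradiction : t * c ^ m ≤ s * b ^ (m + ℓ) + k * k → s * b ^ (m + ℓ) ≤ t * c ^ m + k * k → ⊥
  contradiction P≤ Q≤ = cases (ℤ.∣ Z ∣) refl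
    where
    P = t * c ^ m
    Q = s * b ^ (m + ℓ)
    S = s * b ^ ℓ
    A₀ = coeff weight₀
    A₁ = coeff weight₁
    A₂ = coeff weight₂
    T = + t
    Bm = + (b ^ m)
    -- As a quadratic polynomial in `P`, `t²W` changes by a multiple of `P − Q` when `P` is replaced
    -- by `Q`. That change is `E`, and `P − Q` is at most `k²` in absolute value.
    Z E : ℤ
    Z = A₂ ℤ.* (+ S ℤ.* + S) ℤ.+ A₁ ℤ.* (T ℤ.* + S) ℤ.+ A₀ ℤ.* (T ℤ.* T)
    E = (+ P ℤ.- + Q) ℤ.* (A₂ ℤ.* (+ P ℤ.+ + Q) ℤ.+ A₁ ℤ.* (T ℤ.* Bm))
    P≡ : + P ≡ T ℤ.* + (c ^ m)
    P≡ = ℤ.pos-* t (c ^ m)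
    Q≡ : + Q ≡ Bm ℤ.* + S
    Q≡ = trans (cong +_ (trans (cong (s *_) (^-distribˡ-+-* b m ℓ)) (lemma s (b ^ m) (b ^ ℓ)))) (ℤ.pos-* (b ^ m) S)
      where
      lemma : ∀ s x y → s * (x * y) ≡ x * (s * y)
      lemma = solve-∀
    identity : T ℤ.* T ℤ.* W ≡ Bm ℤ.* Bm ℤ.* Z ℤ.+ E
    identity = begin
      T ℤ.* T ℤ.* W ≡⟨ cong (ℤ._*_ (T ℤ.* T)) W-expand ⟩
      T ℤ.* T ℤ.* (+ (c ^ m * c ^ m) ℤ.* A₂ ℤ.+ + (c ^ m * b ^ m) ℤ.* A₁ ℤ.+ + (b ^ m * b ^ m) ℤ.* A₀)
        ≡⟨ cong₂ (λ u w → T ℤ.* T ℤ.* (u ℤ.+ w ℤ.* A₀)) (cong₂ (λ u w → u ℤ.* A₂ ℤ.+ w ℤ.* A₁) (ℤ.pos-* (c ^ m) (c ^ m)) (ℤ.pos-* (c ^ m) (b ^ m))) (ℤ.pos-* (b ^ m) (b ^ m)) ⟩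
      T ℤ.* T ℤ.* (y ℤ.* y ℤ.* A₂ ℤ.+ y ℤ.* Bm ℤ.* A₁ ℤ.+ Bm ℤ.* Bm ℤ.* A₀) ≡⟨ e₁ T y Bm (+ S) A₀ A₁ A₂ ⟩
      Bm ℤ.* Bm ℤ.* Z ℤ.+ (T ℤ.* y ℤ.- Bm ℤ.* + S) ℤ.* (A₂ ℤ.* (T ℤ.* y ℤ.+ Bm ℤ.* + S) ℤ.+ A₁ ℤ.* (T ℤ.* Bm))
        ≡⟨ cong₂ (λ u w → Bm ℤ.* Bm ℤ.* Z ℤ.+ (u ℤ.- w) ℤ.* (A₂ ℤ.* (u ℤ.+ w) ℤ.+ A₁ ℤ.* (T ℤ.* Bm))) (sym P≡) (sym Q≡) ⟩
      Bm ℤ.* Bm ℤ.* Z ℤ.+ E ∎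
      where
      open ≡-Reasoning
      y = + (c ^ m)
      e₁ : ∀ T y B S A₀ A₁ A₂ → T ℤ.* T ℤ.* (y ℤ.* y ℤ.* A₂ ℤ.+ y ℤ.* B ℤ.* A₁ ℤ.+ B ℤ.* B ℤ.* A₀) ≡
        B ℤ.* B ℤ.* (A₂ ℤ.* (S ℤ.* S) ℤ.+ A₁ ℤ.* (T ℤ.* S) ℤ.+ A₀ ℤ.* (T ℤ.* T)) ℤ.+ (T ℤ.* y ℤ.- B ℤ.* S) ℤ.* (A₂ ℤ.* (T ℤ.* y ℤ.+ B ℤ.* S) ℤ.+ A₁ ℤ.* (T ℤ.* B))
      e₁ = ℤ-solve-∀
    c^m≤P : c ^ m ≤ P
    c^m≤P = m≤n*m (c ^ m) t {{>-nonZero 1≤t}}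
    kk≤P : k * k ≤ P
    kk≤P = ≤-trans kk≤b (≤-trans b≤c (≤-trans (≤-trans (≤-reflexive (sym (*-identityʳ c))) (^-monoʳ-≤ c {{>-nonZero (≤-trans 1≤b b≤c)}} 1≤m)) c^m≤P))
    ∣E∣< : ℤ.∣ E ∣ < Wn
    ∣E∣< = ≤-<-trans (begin
      ℤ.∣ E ∣ ≡⟨ ℤ.abs-* (+ P ℤ.- + Q) _ ⟩
      ℤ.∣ + P ℤ.- + Q ∣ * ℤ.∣ A₂ ℤ.* (+ P ℤ.+ + Q) ℤ.+ A₁ ℤ.* (T ℤ.* Bm) ∣
        ≤⟨ *-mono-≤ (∣pos-difference∣ P≤ Q≤) (≤-trans (ℤ.∣i+j∣≤∣i∣+∣j∣ (A₂ ℤ.* (+ P ℤ.+ + Q)) (A₁ ℤ.* (T ℤ.* Bm))) (≤-reflexive (cong₂ _+_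
             (trans (cong (λ z → ℤ.∣ A₂ ℤ.* z ∣) (sym (ℤ.pos-+ P Q))) (ℤ.abs-* A₂ (+ (P + Q))))
             (trans (cong (λ z → ℤ.∣ A₁ ℤ.* z ∣) (sym (ℤ.pos-* t (b ^ m)))) (ℤ.abs-* A₁ (+ (t * b ^ m))))))) ⟩
      k * k * (ℤ.∣ A₂ ∣ * (P + Q) + ℤ.∣ A₁ ∣ * (t * b ^ m))
        ≤⟨ *-monoʳ-≤ (k * k) (+-mono-≤ (*-mono-≤ (coeff≤ weight₂ weight₂≤) (+-monoʳ-≤ P (≤-trans Q≤ (+-monoʳ-≤ P kk≤P)))) (*-mono-≤ (coeff≤ weight₁ weight₁≤) (*-monoʳ-≤ t (^-monoˡ-≤ m b≤c)))) ⟩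
      k * k * (A-bound * (P + (P + P)) + A-bound * P) ≡⟨ lemma k A-bound P ⟩
      k * k * (4 * P) * A-bound ≤⟨ *-monoˡ-≤ A-bound (*-monoʳ-≤ (k * k) (*-monoʳ-≤ 4 (*-monoˡ-≤ (c ^ m) t≤k))) ⟩
      k * k * (4 * (k * c ^ m)) * A-bound ∎) error-small
      where
      open ≤-Reasoning
      lemma : ∀ k A P → k * k * (A * (P + (P + P)) + A * P) ≡ k * k * (4 * P) * A
      lemma = solve-∀
    Wn≤ : Wn ≤ t * t * Wn
    Wn≤ = m≤n*m Wn (t * t) {{m*n≢0 t t {{>-nonZero 1≤t}} {{>-nonZero 1≤t}}}}
    ∣ttW∣ : ℤ.∣ T ℤ.* T ℤ.* W ∣ ≡ t * t * Wn
    ∣ttW∣ = trans (ℤ.abs-* (T ℤ.* T) W) (cong (_* Wn) (ℤ.abs-* T T))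
    ∣BBZ∣ : ℤ.∣ Bm ℤ.* Bm ℤ.* Z ∣ ≡ b ^ m * b ^ m * ℤ.∣ Z ∣
    ∣BBZ∣ = trans (ℤ.abs-* (Bm ℤ.* Bm) Z) (cong (_* ℤ.∣ Z ∣) (ℤ.abs-* Bm Bm))
    -- For `Z = 0` one gets `t²W = E`, impossible by size; for `Z ≠ 0` one gets
    -- `b²ᵐ ≤ t²W + |E| < 2t²W`, against `form-small`.
    cases : ∀ z → ℤ.∣ Z ∣ ≡ z → ⊥
    cases zero ∣Z∣≡0 = <-irrefl refl (≤-<-trans Wn≤ (≤-<-trans (≤-reflexive (trans (sym ∣ttW∣) (cong ℤ.∣_∣ ttW≡E))) ∣E∣<))
      where
      ttW≡E : T ℤ.* T ℤ.* W ≡ E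
      ttW≡E = trans identity (trans (cong (λ u → u ℤ.+ E) (trans (cong (ℤ._*_ (Bm ℤ.* Bm)) (ℤ.∣i∣≡0⇒i≡0 ∣Z∣≡0)) (ℤ.*-zeroʳ (Bm ℤ.* Bm)))) (ℤ.+-identityˡ E))
    cases (suc z) ∣Z∣≡ = <-irrefl refl (begin-strict
      b ^ m * b ^ m ≤⟨ m≤m*n (b ^ m * b ^ m) (suc z) ⟩
      b ^ m * b ^ m * suc z ≡⟨ trans (cong (λ z → b ^ m * b ^ m * z) (sym ∣Z∣≡)) (sym ∣BBZ∣) ⟩
      ℤ.∣ Bm ℤ.* Bm ℤ.* Z ∣ ≡⟨ cong ℤ.∣_∣ (trans (lemma (Bm ℤ.* Bm ℤ.* Z) E) (cong (λ u → u ℤ.+ ℤ.- E) (sym identity))) ⟩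
      ℤ.∣ T ℤ.* T ℤ.* W ℤ.+ ℤ.- E ∣ ≤⟨ ℤ.∣i+j∣≤∣i∣+∣j∣ (T ℤ.* T ℤ.* W) (ℤ.- E) ⟩
      ℤ.∣ T ℤ.* T ℤ.* W ∣ + ℤ.∣ ℤ.- E ∣ ≡⟨ cong₂ _+_ ∣ttW∣ (ℤ.∣-i∣≡∣i∣ E) ⟩
      t * t * Wn + ℤ.∣ E ∣ <⟨ +-monoʳ-< (t * t * Wn) (<-≤-trans ∣E∣< Wn≤) ⟩
      t * t * Wn + t * t * Wn ≡⟨ cong (λ z → t * t * Wn + z) (sym (+-identityʳ (t * t * Wn))) ⟩
      2 * (t * t * Wn) ≤⟨ form-small ⟩
      b ^ m * b ^ m ∎)
      where
      open ≤-Reasoning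
      lemma : ∀ u E → u ≡ (u ℤ.+ E) ℤ.+ ℤ.- E
      lemma = ℤ-solve-∀

-- Division with remainder gives `m = 96 + 4q' + r`, so `q = 24 + q'` is `m/4` rounded down, and all
-- comparisons of exponents become linear in `q'` and `r`.
large-base-impossible : ∀ {k b d s t m n} → 1 ≤ d → d ≤ k → k * k ≤ b → 1 ≤ t → t ≤ k → 2 ^ 96 ≤ b → 96 ≤ m → m ≤ n →
  t * (b + d) ^ m ≤ s * b ^ n + k * k → s * b ^ n ≤ t * (b + d) ^ m + k * k → ⊥
large-base-impossible {k} {b} {d} {s} {t} {m} {n} 1≤d d≤k kk≤b 1≤t t≤k large 96≤m m≤n P≤ Q≤ =
  LargeBase.contradiction (24 + q') (3 * q' + 71 + r) b d k s t (n ∸ m) q' r (20 + q' + r) refl refl refl (≤-pred (m%n<n x 4)) 1≤d d≤k kk≤b 1≤t t≤k large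
    (subst₂ (λ M n → t * (b + d) ^ M ≤ s * b ^ n + k * k) m≡ n≡ P≤)
    (subst₂ (λ M n → s * b ^ n ≤ t * (b + d) ^ M + k * k) m≡ n≡ Q≤)
  where
  x q' r : ℕ
  x = m ∸ 96
  q' = x / 4
  r = x % 4
  m≡ : m ≡ suc (24 + q') + (3 * q' + 71 + r)
  m≡ = trans (sym (m+[n∸m]≡n 96≤m)) (trans (cong (λ z → 96 + z) (m≡m%n+[m/n]*n x 4)) (lemma q' r))
    where
    lemma : ∀ q' r → 96 + (r + q' * 4) ≡ suc (24 + q') + (3 * q' + 71 + r)
    lemma = solve-∀
  n≡ : n ≡ suc (24 + q') + (3 * q' + 71 + r) + (n ∸ m)
  n≡ = trans (sym (m+[n∸m]≡n m≤n)) (cong (_+ (n ∸ m)) m≡)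

-- Arithmetic of t cᵐ − s bⁿ

no-small-multiple : ∀ {c x} → c ∣ x → 0 < x → x < c → ⊥
no-small-multiple c∣x 0<x x<c = <⇒≱ x<c (∣⇒≤ {{>-nonZero 0<x}} c∣x)

[1+h]^m≡1 : ∀ h m → ∃[ u ] suc h ^ m ≡ 1 + h * u
[1+h]^m≡1 h zero = 0 , cong suc (sym (*-zeroʳ h))
[1+h]^m≡1 h (suc m) with [1+h]^m≡1 h m
... | u , eq = 1 + u + h * u , trans (cong (suc h *_) eq) (lemma h u)
  where
  lemma : ∀ h u → suc h * (1 + h * u) ≡ 1 + h * (1 + u + h * u)
  lemma = solve-∀

b^n≡±1 : ∀ {b} → 1 ≤ b → ∀ n → (∃[ w ] b ^ n ≡ 1 + suc b * w) ⊎ (∃[ w ] b ^ n + 1 ≡ suc b * w)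
b^n≡±1 {b} _ zero = inj₁ (0 , cong suc (sym (*-zeroʳ (suc b))))
b^n≡±1 {b} 1≤b (suc n) with b^n≡±1 1≤b n
... | inj₁ (w , eq) = inj₂ (1 + b * w , trans (cong (λ z → b * z + 1) eq) (lemma b w))
  where
  lemma : ∀ b w → b * (1 + suc b * w) + 1 ≡ suc b * (1 + b * w)
  lemma = solve-∀
... | inj₂ (zero , eq) = ⊥-elim (1+n≢0 (trans (+-comm 1 (b ^ n)) (trans eq (*-zeroʳ (suc b)))))
... | inj₂ (suc w , eq) = inj₁ (b * w + (b ∸ 1) , +-cancelʳ-≡ b _ _ (trans (lemma₁ b (b ^ n)) (trans (cong (b *_) eq) (lemma₂ 1≤b w))))
  where
  lemma₁ : ∀ b x → b * x + b ≡ b * (x + 1)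
  lemma₁ = solve-∀
  lemma₂ : ∀ {b} → 1 ≤ b → ∀ w → b * (suc b * suc w) ≡ 1 + suc b * (b * w + (b ∸ 1)) + b
  lemma₂ {suc b} _ w = identity b w
    where
    identity : ∀ b w → suc b * (suc (suc b) * suc w) ≡ 1 + suc (suc b) * (suc b * w + b) + suc b
    identity = solve-∀

-- The powers of 17 are squares modulo 19, and 14 is not.
17ⁿ-nonresidue : ∀ n m → 1 ≤ m → 1 * 17 ^ n + 4 ≡ 3 * 19 ^ m + 18 + 18 * 0 → ⊥
17ⁿ-nonresidue n (suc m) _ eq = from-no (_∈?_ _≟_ 14 squares) (subst (_∈ squares) residue (17ⁿ∈squares n))
  where
  squares : List ℕ
  squares = 1 ∷ 4 ∷ 5 ∷ 6 ∷ 7 ∷ 9 ∷ 11 ∷ 16 ∷ 17 ∷ []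
  17ⁿ∈squares : ∀ n → 17 ^ n % 19 ∈ squares
  17ⁿ∈squares zero    = here refl
  17ⁿ∈squares (suc n) = subst (_∈ squares) (sym (%-distribˡ-* 17 (17 ^ n) 19))
    (All.lookup (from-yes (All.all? (λ r → _∈?_ _≟_ (17 * r % 19) squares) squares)) (17ⁿ∈squares n))
  17ⁿ≡ : 17 ^ n ≡ 14 + (3 * 19 ^ m) * 19
  17ⁿ≡ = +-cancelʳ-≡ 4 _ _ (trans (cong (_+ 4) (sym (*-identityˡ (17 ^ n)))) (trans eq (lemma (19 ^ m))))
    where
    lemma : ∀ y → 3 * (19 * y) + 18 + 18 * 0 ≡ 14 + (3 * y) * 19 + 4
    lemma = solve-∀
  residue : 17 ^ n % 19 ≡ 14
  residue = trans (cong (_% 19) 17ⁿ≡) ([m+kn]%n≡m%n 14 (3 * 19 ^ m) 19)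

module Consequences {k s t m n : ℕ} (near : NearPowers k s t m n) where
  open NearPowers near
  open ≤-Reasoning

  b c P Q : ℕ
  b = k * k + s
  c = k * k + t
  P = t * c ^ m
  Q = s * b ^ n

  1≤k : 1 ≤ k
  1≤k = ≤-trans (s≤s z≤n) 2≤k
  1≤t : 1 ≤ t
  1≤t = ≤-trans 1≤s (<⇒≤ s<t)
  s≤k : s ≤ k
  s≤k = ≤-trans (<⇒≤ s<t) t≤k
  kk<b : k * k < b
  kk<b = m<m+n (k * k) 1≤s
  k≤kk : k ≤ k * k
  k≤kk = m≤m*n k k {{>-nonZero 1≤k}}
  1≤b : 1 ≤ b
  1≤b = ≤-trans (s≤s z≤n) kk<b
  st-nonZero : NonZero (s * t)
  st-nonZero = m*n≢0 s t {{>-nonZero 1≤s}} {{>-nonZero 1≤t}}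

  -- `D` lies within `k` of `−k²(1/s − 1/t)`. This shift is negative, and by `t ≤ k` at most
  -- `k² − k` in size, whence the asymmetric bounds `k` above and `k²` below.
  P≤Q+k : P ≤ Q + k
  P≤Q+k = *-cancelˡ-≤ (s * t) {{st-nonZero}} (+-cancelʳ-≤ (s * (k * k)) _ _ (begin
    s * t * P + s * (k * k) ≤⟨ +-monoʳ-≤ (s * t * P) (*-monoˡ-≤ (k * k) (<⇒≤ s<t)) ⟩
    s * t * P + t * (k * k) ≤⟨ D-upper ⟩
    s * t * Q + (s * (k * k) + s * t * k) ≡⟨ lemma s t Q k ⟩
    s * t * (Q + k) + s * (k * k) ∎))
    where
    lemma : ∀ s t Q k → s * t * Q + (s * (k * k) + s * t * k) ≡ s * t * (Q + k) + s * (k * k)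
    lemma = solve-∀

  Q≤P+kk : Q ≤ P + k * k
  Q≤P+kk = *-cancelˡ-≤ (s * t) {{st-nonZero}} (+-cancelʳ-≤ (s * (k * k)) _ _ (begin
    s * t * Q + s * (k * k) ≤⟨ D-lower ⟩
    s * t * P + (t * (k * k) + s * t * k) ≤⟨ +-monoʳ-≤ (s * t * P) (bound 1≤s) ⟩
    s * t * P + (s * t * (k * k) + s * (k * k)) ≡⟨ lemma s t P k ⟩
    s * t * (P + k * k) + s * (k * k) ∎))
    where
    lemma : ∀ s t P k → s * t * P + (s * t * (k * k) + s * (k * k)) ≡ s * t * (P + k * k) + s * (k * k)
    lemma = solve-∀
    e₁ : ∀ s t k → t * (k * k) + suc s * t * k ≡ s * (t * k) + (t * (k * k) + t * k)
    e₁ = solve-∀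
    e₂ : ∀ s t k → s * (t * (k * k)) + (t * (k * k) + k * k) + s * (k * k) ≡ suc s * t * (k * k) + suc s * (k * k)
    e₂ = solve-∀
    bound : ∀ {s} → 1 ≤ s → t * (k * k) + s * t * k ≤ s * t * (k * k) + s * (k * k)
    bound {suc s} _ = begin
      t * (k * k) + suc s * t * k ≡⟨ e₁ s t k ⟩
      s * (t * k) + (t * (k * k) + t * k)
        ≤⟨ +-mono-≤ (*-monoʳ-≤ s (*-monoʳ-≤ t k≤kk)) (+-monoʳ-≤ (t * (k * k)) (*-monoˡ-≤ k t≤k)) ⟩
      s * (t * (k * k)) + (t * (k * k) + k * k) ≤⟨ m≤m+n _ (s * (k * k)) ⟩
      s * (t * (k * k)) + (t * (k * k) + k * k) + s * (k * k) ≡⟨ e₂ s t k ⟩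
      suc s * t * (k * k) + suc s * (k * k) ∎

  Q-residue : (∃[ w ] Q ≡ s + suc b * w) ⊎ (∃[ w ] Q + s ≡ suc b * w)
  Q-residue with b^n≡±1 1≤b n
  ... | inj₁ (w , eq) = inj₁ (s * w , trans (cong (s *_) eq) (lemma s (suc b) w))
    where
    lemma : ∀ s h w → s * (1 + h * w) ≡ s + h * (s * w)
    lemma = solve-∀
  ... | inj₂ (w , eq) = inj₂ (s * w , trans (e₁ s (b ^ n)) (trans (cong (s *_) eq) (e₂ s (suc b) w)))
    where
    e₁ : ∀ s x → s * x + s ≡ s * (x + 1)
    e₁ = solve-∀
    e₂ : ∀ s h w → s * (h * w) ≡ h * (s * w)
    e₂ = solve-∀

  -- (c/b)ᵐ ≥ k while c/b < (k+1)/k and ((k+1)/k)² ≤ 2.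
  k²<2^m : 3 ≤ k → k * k < 2 ^ m
  k²<2^m 3≤k = ≰⇒> λ 2^m≤kk → <⇒≱ k·kᵐ<[k+1]ᵐ (squares 2^m≤kk)
    where
    2sq : suc k * suc k ≤ 2 * (k * k)
    2sq = go 3≤k
      where
      identity : ∀ j → let k = suc (suc (suc j)) in suc k * suc k + (j * j + 4 * j + 2) ≡ 2 * (k * k)
      identity = solve-∀
      go : ∀ {k} → 3 ≤ k → suc k * suc k ≤ 2 * (k * k)
      go (s≤s (s≤s (s≤s {n = j} _))) = ≤-trans (m≤m+n _ _) (≤-reflexive (identity j))
    squares : 2 ^ m ≤ k * k → suc k ^ m ≤ k * k ^ m
    squares 2^m≤kk = ≮⇒≥ λ lt → <⇒≱ (*-mono-< lt lt) (begin
      suc k ^ m * suc k ^ m ≡⟨ sym (^-distribʳ-* (suc k) (suc k) m) ⟩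
      (suc k * suc k) ^ m ≤⟨ ^-monoˡ-≤ m 2sq ⟩
      (2 * (k * k)) ^ m ≡⟨ trans (^-distribʳ-* 2 (k * k) m) (cong (2 ^ m *_) (^-distribʳ-* k k m)) ⟩
      2 ^ m * (k ^ m * k ^ m) ≤⟨ *-monoˡ-≤ (k ^ m * k ^ m) 2^m≤kk ⟩
      k * k * (k ^ m * k ^ m) ≡⟨ lemma k (k ^ m) ⟩
      k * k ^ m * (k * k ^ m) ∎)
      where
      lemma : ∀ k x → k * k * (x * x) ≡ k * x * (k * x)
      lemma = solve-∀
    1≤m : 1 ≤ m
    1≤m = ≤-trans (s≤s z≤n) 2<m
    kbᵐ<cᵐ : k * b ^ m < c ^ m
    kbᵐ<cᵐ = *-cancelˡ-< k _ _ (+-cancelʳ-< (k * k) _ _ (begin-strict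
      k * (k * b ^ m) + k * k <⟨ +-monoʳ-< (k * (k * b ^ m)) (<-≤-trans kk<b (≤-trans (≤-reflexive (sym (*-identityʳ b))) (^-monoʳ-≤ b {{>-nonZero 1≤b}} 1≤m))) ⟩
      k * (k * b ^ m) + b ^ m ≡⟨ e₁ k (b ^ m) ⟩
      (k * k + 1) * b ^ m ≤⟨ *-monoˡ-≤ (b ^ m) (+-monoʳ-≤ (k * k) 1≤s) ⟩
      b * b ^ m ≤⟨ ^-monoʳ-≤ b {{>-nonZero 1≤b}} m<n ⟩
      b ^ n ≤⟨ m≤n*m (b ^ n) s {{>-nonZero 1≤s}} ⟩
      Q ≤⟨ Q≤P+kk ⟩
      P + k * k ≤⟨ +-monoˡ-≤ (k * k) (*-monoˡ-≤ (c ^ m) t≤k) ⟩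
      k * c ^ m + k * k ∎))
      where
      e₁ : ∀ k x → k * (k * x) + x ≡ (k * k + 1) * x
      e₁ = solve-∀
    ck≤ : c * k ≤ b * suc k
    ck≤ = begin
      (k * k + t) * k ≤⟨ *-monoˡ-≤ k (+-monoʳ-≤ (k * k) t≤k) ⟩
      (k * k + k) * k ≡⟨ e₁ k ⟩
      k * k * suc k ≤⟨ *-monoˡ-≤ (suc k) (m≤m+n (k * k) s) ⟩
      b * suc k ∎
      where
      e₁ : ∀ k → (k * k + k) * k ≡ k * k * suc k
      e₁ = solve-∀
    k·kᵐ<[k+1]ᵐ : k * k ^ m < suc k ^ m
    k·kᵐ<[k+1]ᵐ = *-cancelˡ-< (b ^ m) _ _ (begin-strict
      b ^ m * (k * k ^ m) ≡⟨ e₁ (b ^ m) k (k ^ m) ⟩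
      k * b ^ m * k ^ m <⟨ *-monoˡ-< (k ^ m) {{m^n≢0 k m {{>-nonZero 1≤k}}}} kbᵐ<cᵐ ⟩
      c ^ m * k ^ m ≡⟨ sym (^-distribʳ-* c k m) ⟩
      (c * k) ^ m ≤⟨ ^-monoˡ-≤ m ck≤ ⟩
      (b * suc k) ^ m ≡⟨ ^-distribʳ-* b (suc k) m ⟩
      b ^ m * suc k ^ m ∎)
      where
      e₁ : ∀ x k y → x * (k * y) ≡ k * x * y
      e₁ = solve-∀

  large-base : 2 ^ 96 ≤ b → ⊥
  large-base large = large-base-impossible {s = s} (m<n⇒0<n∸m s<t) (≤-trans (m∸n≤m t s) t≤k) (<⇒≤ kk<b) 1≤t t≤k large 96≤m (<⇒≤ m<n)
      (subst (λ x → t * x ^ m ≤ Q + k * k) c≡ (≤-trans P≤Q+k (+-monoʳ-≤ Q k≤kk)))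
      (subst (λ x → Q ≤ t * x ^ m + k * k) c≡ Q≤P+kk)
    where
    c≡ : c ≡ b + (t ∸ s)
    c≡ = trans (cong (λ z → k * k + z) (sym (m+[n∸m]≡n (<⇒≤ s<t)))) (sym (+-assoc (k * k) s (t ∸ s)))
    -- From `s ≤ k²` comes `b ≤ 2k²`, which costs a factor 2; the strict `k² < 2ᵐ` recovers
    -- `m ≥ 96`.
    2^95≤kk : 2 ^ 95 ≤ k * k
    2^95≤kk = *-cancelˡ-≤ 2 (≤-trans large (+-monoʳ-≤ (k * k) (≤-trans s≤k (≤-trans k≤kk (≤-reflexive (sym (+-identityʳ (k * k))))))))
    3≤k : 3 ≤ k
    3≤k = ≰⇒> λ k≤2 → <⇒≱ (≤ᵇ⇒≤ 5 (2 ^ 95) tt) (≤-trans 2^95≤kk (*-mono-≤ k≤2 k≤2))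
    96≤m : 96 ≤ m
    96≤m = ^-cancel-exponent ≤-refl (≤-<-trans 2^95≤kk (k²<2^m 3≤k))

  -- Both `P` and `Q` are multiples of `gᵐ > k² ≥ |P − Q|`, so `P = Q`. Cancelling `gᵐ` and using
  -- that `b/g` and `c/g` are coprime leaves `(b/g)ᵐ ∣ t`, which is too large.
  common-divisor : 1 < gcd b c → ⊥
  common-divisor 1<g = <⇒≱ (k²<2^m 3≤k) (≤-trans 2^m≤t (≤-trans t≤k k≤kk))
    where
    g b' c' : ℕ
    g = gcd b c
    instance
      g-nonZero : NonZero g
      g-nonZero = >-nonZero (≤-trans (s≤s z≤n) 1<g)
    b' = b / g
    c' = c / g
    b≡ : b' * g ≡ b
    b≡ = m/n*n≡m (gcd[m,n]∣m b c)
    c≡ : c' * g ≡ c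
    c≡ = m/n*n≡m (gcd[m,n]∣n b c)
    coprime : Coprime b' c'
    coprime = coprime-/gcd b c
    3≤k : 3 ≤ k
    -- For `k = 2` the only pair is 5 and 6, which are coprime.
    3≤k = ≤∧≢⇒< 2≤k λ { refl → small s t 1≤s s<t t≤k 1<g }
      where
      small : ∀ s t → 1 ≤ s → s < t → t ≤ 2 → 1 < gcd (4 + s) (4 + t) → ⊥
      small 1 2 _ _ _ (s≤s ())
      small 0 _ () _ _ _
      small 1 0 _ () _ _
      small 1 1 _ (s≤s ()) _ _
      small 1 (suc (suc (suc _))) _ _ (s≤s (s≤s ())) _
      small (suc (suc s)) t _ s<t t≤2 _ = <⇒≱ s<t (≤-trans t≤2 (s≤s (s≤s z≤n)))
    gᵐ∣ : ∀ x x' i → m ≤ i → x' * g ≡ x → g ^ m ∣ x ^ i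
    gᵐ∣ x x' i m≤i eq = divides (x' ^ m * x ^ (i ∸ m)) (begin-equality
      x ^ i ≡⟨ cong (x ^_) (sym (m+[n∸m]≡n m≤i)) ⟩
      x ^ (m + (i ∸ m)) ≡⟨ ^-distribˡ-+-* x m (i ∸ m) ⟩
      x ^ m * x ^ (i ∸ m) ≡⟨ cong (_* x ^ (i ∸ m)) (trans (cong (_^ m) (sym eq)) (^-distribʳ-* x' g m)) ⟩
      x' ^ m * g ^ m * x ^ (i ∸ m) ≡⟨ lemma (x' ^ m) (g ^ m) (x ^ (i ∸ m)) ⟩
      x' ^ m * x ^ (i ∸ m) * g ^ m ∎)
      where
      lemma : ∀ a b c → a * b * c ≡ a * c * b
      lemma = solve-∀
    kk<gᵐ : k * k < g ^ m
    kk<gᵐ = <-≤-trans (k²<2^m 3≤k) (^-monoˡ-≤ m 1<g)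
    gᵐ∣P : g ^ m ∣ P
    gᵐ∣P = ∣-trans (gᵐ∣ c c' m ≤-refl c≡) (n∣m*n t)
    gᵐ∣Q : g ^ m ∣ Q
    gᵐ∣Q = ∣-trans (gᵐ∣ b b' n (<⇒≤ m<n) b≡) (n∣m*n s)
    close : ∀ {x y} → g ^ m ∣ x → g ^ m ∣ y → x < y → y ≤ x + k * k → ⊥
    close {x} {y} ∣x ∣y x<y y≤ = no-small-multiple (∣m+n∣m⇒∣n (subst (g ^ m ∣_) (sym (m+[n∸m]≡n (<⇒≤ x<y))) ∣y) ∣x)
      (m<n⇒0<n∸m x<y) (≤-<-trans (m≤n+o⇒m∸n≤o y x y≤) kk<gᵐ)
    P≡Q : P ≡ Q
    P≡Q = ≤-antisym (≮⇒≥ λ Q<P → close gᵐ∣Q gᵐ∣P Q<P (≤-trans P≤Q+k (+-monoʳ-≤ Q k≤kk))) (≮⇒≥ λ P<Q → close gᵐ∣P gᵐ∣Q P<Q Q≤P+kk)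
    b'^m∣ : b' ^ m ∣ t * c' ^ m
    b'^m∣ = *-cancelˡ-∣ (g ^ m) {{m^n≢0 g m}} (divides (s * b ^ (n ∸ m)) (begin-equality
      g ^ m * (t * c' ^ m) ≡⟨ e₁ (g ^ m) t (c' ^ m) ⟩
      t * (c' ^ m * g ^ m) ≡⟨ cong (t *_) (trans (sym (^-distribʳ-* c' g m)) (cong (_^ m) c≡)) ⟩
      P ≡⟨ P≡Q ⟩
      s * b ^ n ≡⟨ cong (λ i → s * b ^ i) (sym (m+[n∸m]≡n (<⇒≤ m<n))) ⟩
      s * b ^ (m + (n ∸ m)) ≡⟨ cong (s *_) (trans (^-distribˡ-+-* b m (n ∸ m)) (cong (_* b ^ (n ∸ m)) (trans (cong (_^ m) (sym b≡)) (^-distribʳ-* b' g m)))) ⟩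
      s * (b' ^ m * g ^ m * b ^ (n ∸ m)) ≡⟨ e₂ s (b' ^ m) (g ^ m) (b ^ (n ∸ m)) ⟩
      s * b ^ (n ∸ m) * (g ^ m * b' ^ m) ∎))
      where
      e₁ : ∀ g t c → g * (t * c) ≡ t * (c * g)
      e₁ = solve-∀
      e₂ : ∀ s x g y → s * (x * g * y) ≡ s * y * (g * x)
      e₂ = solve-∀
    strip₁ : ∀ i {z} → b' ^ i ∣ c' * z → b' ^ i ∣ z
    strip₁ zero    {z} _ = 1∣ z
    strip₁ (suc i) {z} d with coprime-divisor coprime (∣-trans (m∣m*n (b' ^ i)) d)
    ... | divides w refl = ∣-trans (*-monoʳ-∣ b' (strip₁ i (*-cancelˡ-∣ b' {{b'-nonZero}} (∣-trans d (∣-reflexive (lemma c' w b')))))) (∣-reflexive (*-comm b' w))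
      where
      b'-nonZero : NonZero b'
      b'-nonZero = ≢-nonZero λ b'≡0 → <⇒≢ 1≤b (trans (sym (cong (_* g) b'≡0)) b≡)
      lemma : ∀ c w b → c * (w * b) ≡ b * (c * w)
      lemma = solve-∀
    strip : ∀ j {z} → b' ^ m ∣ c' ^ j * z → b' ^ m ∣ z
    strip zero    {z} d = ∣-trans d (∣-reflexive (+-identityʳ z))
    strip (suc j) {z} d = strip j (strip₁ m (∣-trans d (∣-reflexive (*-assoc c' (c' ^ j) z))))
    -- `b' = 1` would mean `b ∣ c`, hence `b ∣ t − s`, while `0 < t − s < b`.
    2≤b' : 2 ≤ b'
    2≤b' = ≰⇒> λ b'≤1 → no-small-multiple (b∣d b'≤1) (m<n⇒0<n∸m s<t) (≤-<-trans (≤-trans (m∸n≤m t s) (≤-trans t≤k k≤kk)) kk<b)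
      where
      b∣c : b' ≤ 1 → b ∣ c
      b∣c b'≤1 = subst (_∣ c) g≡b (gcd[m,n]∣n b c)
        where
        b'≡1 : b' ≡ 1
        b'≡1 = ≤-antisym b'≤1 (n≢0⇒n>0 λ b'≡0 → <⇒≢ 1≤b (trans (sym (cong (_* g) b'≡0)) b≡))
        g≡b : g ≡ b
        g≡b = trans (sym (*-identityˡ g)) (trans (cong (_* g) (sym b'≡1)) b≡)
      b∣d : b' ≤ 1 → b ∣ t ∸ s
      b∣d b'≤1 = ∣m+n∣m⇒∣n (subst (b ∣_) (trans (cong (λ z → k * k + z) (sym (m+[n∸m]≡n (<⇒≤ s<t)))) (sym (+-assoc (k * k) s (t ∸ s)))) (b∣c b'≤1)) (∣-reflexive refl)
    2^m≤t : 2 ^ m ≤ t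
    2^m≤t = ≤-trans (^-monoˡ-≤ m 2≤b') (∣⇒≤ {{>-nonZero 1≤t}} (strip m (subst (b' ^ m ∣_) (*-comm t (c' ^ m)) b'^m∣)))

  -- D ≡ t modulo b and D ≡ ∓s modulo c leave no room for D = P − Q.
  consecutive : t ≡ suc s → ⊥
  consecutive refl with [1+h]^m≡1 b m
  ... | u , cᵐ≡ = compare U V P≡ Q≡
    where
    c≡ : suc b ≡ c
    c≡ = sym (+-suc (k * k) s)
    U V : ℕ
    U = t * u
    V = s * b ^ (n ∸ 1)
    P≡ : P ≡ t + b * U
    P≡ = trans (cong (t *_) (trans (cong (_^ m) (sym c≡)) cᵐ≡)) (lemma t b u)
      where
      lemma : ∀ t b u → t * (1 + b * u) ≡ t + b * (t * u)
      lemma = solve-∀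
    Q≡ : Q ≡ b * V
    Q≡ = trans (cong (λ i → s * b ^ i) (sym (m+[n∸m]≡n (≤-trans (s≤s z≤n) m<n)))) (lemma s b (b ^ (n ∸ 1)))
      where
      lemma : ∀ s b x → s * (b * x) ≡ b * (s * x)
      lemma = solve-∀
    c∣P : c ∣ P
    c∣P = ∣-trans (≤⇒∣ m (≤-trans (s≤s z≤n) 2<m)) (n∣m*n t)
      where
      ≤⇒∣ : ∀ i → 1 ≤ i → c ∣ c ^ i
      ≤⇒∣ (suc i) _ = m∣m*n (c ^ i)
    4≤kk : 4 ≤ k * k
    4≤kk = *-mono-≤ 2≤k 2≤k
    2k≤kk : 2 * k ≤ k * k
    2k≤kk = *-monoˡ-≤ k 2≤k
    1+s+t<c : suc (s + t) < c
    1+s+t<c = begin-strict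
      t + t ≤⟨ +-mono-≤ t≤k t≤k ⟩
      k + k ≡⟨ cong (λ z → k + z) (sym (+-identityʳ k)) ⟩
      2 * k ≤⟨ 2k≤kk ⟩
      k * k <⟨ m<m+n (k * k) 1≤t ⟩
      c ∎
    2<c : 2 < c
    2<c = ≤-<-trans (≤-trans (s≤s (s≤s z≤n)) 4≤kk) (m<m+n (k * k) 1≤t)
    shifted : P + suc b ≡ P + c
    shifted = cong (λ z → P + z) c≡
    -- The parity of `n` decides whether `Q` is `s` or `−s` modulo `c = b + 1`, and `c ∣ P`. If
    -- `D = t`, then `c` divides `s + t` or `t − s = 1`; if `D = t − b`, adding 1 shows that it
    -- divides `s + t + 1` or 2. All four numbers lie strictly between 0 and `c`.
    module Residue (W : ℕ) where
      even-equal : Q ≡ s + c * W → P ≡ Q + t → ⊥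
      even-equal q p = no-small-multiple (∣m+n∣m⇒∣n (subst (c ∣_) (trans p (trans (cong (_+ t) q) (lemma s (c * W) t))) c∣P) (m∣m*n W))
        (≤-trans 1≤s (m≤m+n s t)) (<-trans (n<1+n (s + t)) 1+s+t<c)
        where
        lemma : ∀ s x t → s + x + t ≡ x + (s + t)
        lemma = solve-∀
      odd-equal : Q + s ≡ c * W → P ≡ Q + t → ⊥
      odd-equal q p = no-small-multiple (∣m+n∣m⇒∣n (subst (c ∣_) (trans p (trans (lemma Q s) (cong (_+ 1) q))) c∣P) (m∣m*n W))
        (s≤s z≤n) (<-trans (n<1+n 1) 2<c)
        where
        lemma : ∀ Q s → Q + suc s ≡ Q + s + 1
        lemma = solve-∀
      c∣P+c : c ∣ P + c
      c∣P+c = ∣m∣n⇒∣m+n c∣P (∣-reflexive refl)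
      even-next : Q ≡ s + c * W → Q + t ≡ P + b → ⊥
      even-next q p = no-small-multiple (∣m+n∣m⇒∣n (subst (c ∣_) (trans (sym shifted) (trans (+-suc P b) (trans (cong suc (sym p)) (trans (cong (λ z → suc (z + t)) q) (lemma s (c * W) t))))) c∣P+c) (m∣m*n W))
        (s≤s z≤n) 1+s+t<c
        where
        lemma : ∀ s x t → suc (s + x + t) ≡ x + suc (s + t)
        lemma = solve-∀
      odd-next : Q + s ≡ c * W → Q + t ≡ P + b → ⊥
      odd-next q p = no-small-multiple (∣m+n∣m⇒∣n (subst (c ∣_) (trans (sym shifted) (trans (+-suc P b) (trans (cong suc (sym p)) (trans (lemma Q s) (cong (_+ 2) q))))) c∣P+c) (m∣m*n W))
        (s≤s z≤n) 2<c
        where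
        lemma : ∀ Q s → suc (Q + suc s) ≡ Q + s + 2
        lemma = solve-∀
    equal : P ≡ Q + t → ⊥
    equal p with Q-residue
    ... | inj₁ (w , eq) = Residue.even-equal w (trans eq (cong (λ z → s + z * w) c≡)) p
    ... | inj₂ (w , eq) = Residue.odd-equal w (trans eq (cong (_* w) c≡)) p
    next : Q + t ≡ P + b → ⊥
    next p with Q-residue
    ... | inj₁ (w , eq) = Residue.even-next w (trans eq (cong (λ z → s + z * w) c≡)) p
    ... | inj₂ (w , eq) = Residue.odd-next w (trans eq (cong (_* w) c≡)) p
    -- Here `D = t + b(U − V)`. Since `t − 2b < D ≤ k < b`, only `V = U` and `V = U + 1` survive.
    compare : ∀ U V → P ≡ t + b * U → Q ≡ b * V → ⊥
    compare U V p q with <-cmp U V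
    ... | tri> _ _ V<U = <⇒≱ (begin-strict
      Q + k ≤⟨ +-monoʳ-≤ Q k≤kk ⟩
      Q + k * k <⟨ +-monoʳ-< Q kk<b ⟩
      Q + b ≡⟨ trans (cong (_+ b) q) (trans (+-comm (b * V) b) (sym (*-suc b V))) ⟩
      b * suc V ≤⟨ *-monoʳ-≤ b V<U ⟩
      b * U ≤⟨ m≤n+m (b * U) t ⟩
      t + b * U ≡⟨ sym p ⟩
      P ∎) P≤Q+k
    ... | tri≈ _ refl _ = equal (trans p (trans (+-comm t (b * U)) (cong (_+ t) (sym q))))
    ... | tri< U<V _ _ with m≤n⇒m<n∨m≡n U<V
    ... | inj₂ refl = next (trans (cong (_+ t) q) (trans (lemma b U t) (cong (_+ b) (sym p))))
      where
      lemma : ∀ b U t → b * suc U + t ≡ t + b * U + b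
      lemma = solve-∀
    ... | inj₁ 1+U<V = <⇒≱ (begin-strict
      s * t * Q + s * (k * k) + s * t * t ≤⟨ +-monoˡ-≤ (s * t * t) D-lower ⟩
      s * t * P + (t * (k * k) + s * t * k) + s * t * t ≡⟨ e₁ s P k ⟩
      s * t * P + s * (k * k) + (k * k + s * t * k + s * t * t)
        ≤⟨ +-monoʳ-≤ (s * t * P + s * (k * k)) (+-mono-≤ (+-mono-≤ (m≤n*m (k * k) (s * t) {{st-nonZero}}) ≤-refl) (*-monoʳ-≤ (s * t) t≤k)) ⟩
      s * t * P + s * (k * k) + (s * t * (k * k) + s * t * k + s * t * k) ≡⟨ e₂ (s * t) P (s * (k * k)) k ⟩
      s * t * P + s * (k * k) + (s * t * (k * k) + s * t * (2 * k)) ≤⟨ +-monoʳ-≤ (s * t * P + s * (k * k)) (+-monoʳ-≤ (s * t * (k * k)) (*-monoʳ-≤ (s * t) 2k≤kk)) ⟩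
      s * t * P + s * (k * k) + (s * t * (k * k) + s * t * (k * k))
        <⟨ +-monoʳ-< (s * t * P + s * (k * k)) (+-mono-< (*-monoʳ-< (s * t) {{st-nonZero}} kk<b) (*-monoʳ-< (s * t) {{st-nonZero}} kk<b)) ⟩
      s * t * P + s * (k * k) + (s * t * b + s * t * b) ≡⟨ e₃ (s * t) P (s * (k * k)) b ⟩
      s * t * (P + b + b) + s * (k * k) ≤⟨ +-monoˡ-≤ (s * (k * k)) (*-monoʳ-≤ (s * t) far) ⟩
      s * t * (Q + t) + s * (k * k) ≡⟨ e₄ (s * t) Q t (s * (k * k)) ⟩
      s * t * Q + s * (k * k) + s * t * t ∎) ≤-refl
      where
      far : P + b + b ≤ Q + t
      far = begin
        P + b + b ≡⟨ trans (cong (λ z → z + b + b) p) (lemma t b U) ⟩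
        b * suc (suc U) + t ≤⟨ +-monoˡ-≤ t (*-monoʳ-≤ b 1+U<V) ⟩
        b * V + t ≡⟨ cong (_+ t) (sym q) ⟩
        Q + t ∎
        where
        lemma : ∀ t b U → t + b * U + b + b ≡ b * suc (suc U) + t
        lemma = solve-∀
      e₁ : ∀ s P k → s * suc s * P + (suc s * (k * k) + s * suc s * k) + s * suc s * suc s ≡ s * suc s * P + s * (k * k) + (k * k + s * suc s * k + s * suc s * suc s)
      e₁ = solve-∀
      e₂ : ∀ x P y k → x * P + y + (x * (k * k) + x * k + x * k) ≡ x * P + y + (x * (k * k) + x * (2 * k))
      e₂ = solve-∀
      e₃ : ∀ x P y b → x * P + y + (x * b + x * b) ≡ x * (P + b + b) + y
      e₃ = solve-∀
      e₄ : ∀ x Q t y → x * (Q + t) + y ≡ x * Q + y + x * t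
      e₄ = solve-∀

  -- Here D ≡ −1 modulo k².
  extremes : s ≡ 1 → t ≡ k → ⊥
  extremes refl refl with k ≟ 2
  -- For `k = 2` the bases are 5 and 6; the estimate below needs `k ≥ 3`.
  ... | yes refl = consecutive refl
  ... | no k≢2 with [1+h]^m≡1 (k * k) n
  ... | v , bⁿ≡ = <⇒≱ 3≤k (≤-trans k≤1 (s≤s z≤n))
    where
    3≤k : 3 ≤ k
    3≤k = ≤∧≢⇒< 2≤k (λ 2≡k → k≢2 (sym 2≡k))
    U : ℕ
    U = suc k * c ^ (m ∸ 1)
    P≡ : P ≡ k * k * U
    P≡ = trans (cong (λ i → k * c ^ i) (sym (m+[n∸m]≡n (≤-trans (s≤s z≤n) 2<m)))) (lemma k (c ^ (m ∸ 1)))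
      where
      lemma : ∀ k x → k * ((k * k + k) * x) ≡ k * k * (suc k * x)
      lemma = solve-∀
    Q≡ : Q ≡ 1 + k * k * v
    Q≡ = trans (+-identityʳ (b ^ n)) (trans (cong (_^ n) (+-comm (k * k) 1)) bⁿ≡)
    -- `D = k²(U − v) − 1` and `D ≥ −k²` give `D ≥ −1`, whereas `upper` says `D ≤ 2k − k²`, which is
    -- at most `−k`.
    v≤U : v ≤ U
    v≤U = ≤-pred (*-cancelˡ-< (k * k) _ _ (begin-strict
      k * k * v <⟨ n<1+n (k * k * v) ⟩
      1 + k * k * v ≡⟨ sym Q≡ ⟩
      Q ≤⟨ Q≤P+kk ⟩
      P + k * k ≡⟨ cong (_+ k * k) P≡ ⟩
      k * k * U + k * k ≡⟨ trans (+-comm (k * k * U) (k * k)) (sym (*-suc (k * k) U)) ⟩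
      k * k * suc U ∎))
    upper : P + k * k ≤ Q + 2 * k
    upper = *-cancelˡ-≤ k {{>-nonZero 1≤k}} (begin
      k * (P + k * k) ≡⟨ e₁ k P ⟩
      1 * k * P + k * (k * k) ≤⟨ D-upper ⟩
      1 * k * Q + (1 * (k * k) + 1 * k * k) ≡⟨ e₂ k Q ⟩
      k * (Q + 2 * k) ∎)
      where
      e₁ : ∀ k P → k * (P + k * k) ≡ 1 * k * P + k * (k * k)
      e₁ = solve-∀
      e₂ : ∀ k Q → 1 * k * Q + (1 * (k * k) + 1 * k * k) ≡ k * (Q + 2 * k)
      e₂ = solve-∀
    k≤1 : k ≤ 1
    k≤1 = +-cancelʳ-≤ (2 * k) _ _ (+-cancelˡ-≤ P _ _ (begin
      P + (k + 2 * k) ≤⟨ +-monoʳ-≤ P (*-monoˡ-≤ k 3≤k) ⟩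
      P + k * k ≤⟨ upper ⟩
      Q + 2 * k ≡⟨ cong (_+ 2 * k) Q≡ ⟩
      1 + k * k * v + 2 * k ≤⟨ +-monoˡ-≤ (2 * k) (s≤s (≤-trans (*-monoʳ-≤ (k * k) v≤U) (≤-reflexive (sym P≡)))) ⟩
      1 + P + 2 * k ≡⟨ lemma P k ⟩
      P + (1 + 2 * k) ∎))
      where
      lemma : ∀ P k → 1 + P + 2 * k ≡ P + (1 + 2 * k)
      lemma = solve-∀

  -- Here D is determined modulo b + 1, and D ≤ 2 with strict inequality.
  gap-two : t ≡ s + 2 → s * t * (k ∸ 2) ≤ 2 * (k * k) → ⊥
  gap-two refl cond with [1+h]^m≡1 (suc b) m
  ... | u , cᵐ≡ = cases Q-residue
    where
    h j A : ℕ
    h = suc b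
    j = k ∸ 2
    A = t * u
    k≡ : k ≡ 2 + j
    k≡ = sym (m+[n∸m]≡n 2≤k)
    P≡ : P ≡ t + h * A
    P≡ = trans (cong (t *_) (trans (cong (_^ m) (c≡ (k * k) s)) cᵐ≡)) (lemma t h u)
      where
      c≡ : ∀ x s → x + (s + 2) ≡ suc (suc (x + s))
      c≡ = solve-∀
      lemma : ∀ t h u → t * (1 + h * u) ≡ t + h * (t * u)
      lemma = solve-∀
    upper : s * t * P + 2 * (k * k) ≤ s * t * Q + s * t * k
    upper = +-cancelʳ-≤ (s * (k * k)) _ _ (begin
      s * t * P + 2 * (k * k) + s * (k * k) ≡⟨ e₁ (s * t) P k s ⟩
      s * t * P + t * (k * k) ≤⟨ D-upper ⟩
      s * t * Q + (s * (k * k) + s * t * k) ≡⟨ e₂ (s * t) Q k s ⟩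
      s * t * Q + s * t * k + s * (k * k) ∎)
      where
      e₁ : ∀ x P k s → x * P + 2 * (k * k) + s * (k * k) ≡ x * P + (s + 2) * (k * k)
      e₁ = solve-∀
      e₂ : ∀ x Q k s → x * Q + (s * (k * k) + x * k) ≡ x * Q + x * k + s * (k * k)
      e₂ = solve-∀
    lower : s * t * Q ≤ s * t * P + (2 * (k * k) + s * t * k)
    lower = +-cancelʳ-≤ (s * (k * k)) _ _ (≤-trans D-lower (≤-reflexive (e₁ (s * t) P k s)))
      where
      e₁ : ∀ x P k s → x * P + ((s + 2) * (k * k) + x * k) ≡ x * P + (2 * (k * k) + x * k) + s * (k * k)
      e₁ = solve-∀
    split-k : s * t * k ≡ s * t * 2 + s * t * j
    split-k = trans (cong (s * t *_) k≡) (*-distribˡ-+ (s * t) 2 j)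
    -- The upper bound reads `D ≤ k − 2k²/(st)`, and `cond` says that `2k²/(st) ≥ k − 2`.
    P≤Q+2 : P ≤ Q + 2
    P≤Q+2 = *-cancelˡ-≤ (s * t) {{st-nonZero}} (+-cancelʳ-≤ (s * t * j) _ _ (begin
      s * t * P + s * t * j ≤⟨ +-monoʳ-≤ (s * t * P) cond ⟩
      s * t * P + 2 * (k * k) ≤⟨ upper ⟩
      s * t * Q + s * t * k ≡⟨ cong (λ z → s * t * Q + z) split-k ⟩
      s * t * Q + (s * t * 2 + s * t * j) ≡⟨ lemma (s * t) Q j ⟩
      s * t * (Q + 2) + s * t * j ∎))
      where
      lemma : ∀ x Q j → x * Q + (x * 2 + x * j) ≡ x * (Q + 2) + x * j
      lemma = solve-∀
    -- `D = 2` forces `stj = 2(j+2)²` with `j = k − 2`, so `j ∣ 8`. Then `j ≤ 8` and `s ≤ k ≤ 10`,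
    -- and the finite search finds no solution.
    not-equal : P ≢ Q + 2
    not-equal eq = from-no (anyUpTo? (λ j → anyUpTo? (λ s → s * (s + 2) * j ≟ 2 * ((2 + j) * (2 + j))) 11) 9)
      (j , s≤s j≤8 , s , s≤s (≤-trans s≤k (≤-trans (≤-reflexive k≡) (+-monoʳ-≤ 2 j≤8))) , equation)
      where
      2kk≤ : 2 * (k * k) ≤ s * t * j
      2kk≤ = +-cancelˡ-≤ (s * t * (Q + 2)) _ _ (begin
        s * t * (Q + 2) + 2 * (k * k) ≡⟨ cong (λ z → s * t * z + 2 * (k * k)) (sym eq) ⟩
        s * t * P + 2 * (k * k) ≤⟨ upper ⟩
        s * t * Q + s * t * k ≡⟨ cong (λ z → s * t * Q + z) split-k ⟩
        s * t * Q + (s * t * 2 + s * t * j) ≡⟨ lemma (s * t) Q j ⟩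
        s * t * (Q + 2) + s * t * j ∎)
        where
        lemma : ∀ x Q j → x * Q + (x * 2 + x * j) ≡ x * (Q + 2) + x * j
        lemma = solve-∀
      equation : s * t * j ≡ 2 * ((2 + j) * (2 + j))
      equation = trans (≤-antisym cond 2kk≤) (cong (λ z → 2 * (z * z)) k≡)
      j∣8 : j ∣ 8
      j∣8 = ∣m+n∣m⇒∣n (divides (s * t) (trans (lemma j) (sym equation))) (m∣m*n (2 * j + 8))
        where
        lemma : ∀ j → j * (2 * j + 8) + 8 ≡ 2 * ((2 + j) * (2 + j))
        lemma = solve-∀
      j≤8 : j ≤ 8
      j≤8 = ∣⇒≤ j∣8
    scaled : ∀ x y → P + y ≤ Q + x → s * t * y ≤ 2 * (k * k) + s * t * k + s * t * x
    scaled x y p = +-cancelˡ-≤ (s * t * P) _ _ (begin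
      s * t * P + s * t * y ≡⟨ sym (*-distribˡ-+ (s * t) P y) ⟩
      s * t * (P + y) ≤⟨ *-monoʳ-≤ (s * t) p ⟩
      s * t * (Q + x) ≡⟨ *-distribˡ-+ (s * t) Q x ⟩
      s * t * Q + s * t * x ≤⟨ +-monoˡ-≤ (s * t * x) lower ⟩
      s * t * P + (2 * (k * k) + s * t * k) + s * t * x ≡⟨ +-assoc (s * t * P) _ _ ⟩
      s * t * P + (2 * (k * k) + s * t * k + s * t * x) ∎)
    -- Putting `D ≤ s + t − h` into the lower bound leaves only the bases 10, 12 and 17, 19.
    small : ∀ {s k} → 1 ≤ s → s + 2 ≤ k → let t = s + 2 in
      s * t * suc (k * k + s) ≤ 2 * (k * k) + s * t * k + s * t * (s + t) → s ≡ 1 × (k ≡ 3 ⊎ k ≡ 4)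
    small {1} {k} _ 3≤k p with m≤n⇒m<n∨m≡n 3≤k
    ... | inj₂ refl = refl , inj₁ refl
    ... | inj₁ 4≤k with m≤n⇒m<n∨m≡n 4≤k
    ... | inj₂ refl = refl , inj₂ refl
    ... | inj₁ 5≤k = ⊥-elim (go 5≤k p)
      where
      identity : ∀ i → let k = 5 + i in 1 * 3 * suc (k * k + 1) ≡ 2 * (k * k) + 1 * 3 * k + 1 * 3 * 4 + suc (3 + 7 * i + i * i)
      identity = solve-∀
      go : ∀ {k} → 5 ≤ k → 1 * 3 * suc (k * k + 1) ≤ 2 * (k * k) + 1 * 3 * k + 1 * 3 * 4 → ⊥
      go (s≤s (s≤s (s≤s (s≤s (s≤s {n = i} _))))) = excess-absurd _ (identity i)
    small {suc (suc u)} {k} _ t≤k p = ⊥-elim (go (k ∸ (suc (suc u) + 2)) (sym (m+[n∸m]≡n t≤k)))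
      where
      identity : ∀ u j → let s = suc (suc u); t = s + 2; k = t + j in
        s * t * suc (k * k + s) ≡ 2 * (k * k) + s * t * k + s * t * (s + t) + suc (39 + 40 * j + 6 * j * j + 86 * u + 54 * u * j + 6 * u * j * j + 51 * u * u + 19 * u * u * j + 1 * u * u * j * j + 12 * u * u * u + 2 * u * u * u * j + 1 * u * u * u * u)
      identity = solve-∀
      go : ∀ j → k ≡ suc (suc u) + 2 + j → ⊥
      go j refl = excess-absurd _ (identity u j) p
    -- 10 and 12 have the common factor 2. For 17 and 19 the size of `D` leaves only `D = 4 − 18`,
    -- where the residue modulo 19 decides.
    beyond : P + h ≤ Q + (s + t) → (P + h ≤ Q + 2 ⊎ ∃[ x ] Q + (s + t) ≡ P + h + h * x) → ⊥
    beyond p alternative with small 1≤s t≤k (scaled (s + t) h p)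
    ... | s≡1 , inj₁ k≡3 = common-divisor (subst₂ (λ s k → 1 < gcd (k * k + s) (k * k + (s + 2))) (sym s≡1) (sym k≡3) (s≤s (s≤s z≤n)))
    ... | s≡1 , inj₂ k≡4 = last alternative
      where
      last : (P + h ≤ Q + 2 ⊎ ∃[ x ] Q + (s + t) ≡ P + h + h * x) → ⊥
      last (inj₁ close) = from-no (54 ≤? 50)
        (subst₂ (λ s k → s * (s + 2) * suc (k * k + s) ≤ 2 * (k * k) + s * (s + 2) * k + s * (s + 2) * 2) s≡1 k≡4 (scaled 2 h close))
      last (inj₂ (zero , exact)) = 17ⁿ-nonresidue n m (≤-trans (s≤s z≤n) 2<m)
        (subst₂ (λ s k → s * (k * k + s) ^ n + (s + (s + 2)) ≡ (s + 2) * (k * k + (s + 2)) ^ m + suc (k * k + s) + suc (k * k + s) * 0) s≡1 k≡4 exact)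
      last (inj₂ (suc x , exact)) = from-no (108 ≤? 56)
        (subst₂ (λ s k → s * (s + 2) * (suc (k * k + s) + suc (k * k + s)) ≤ 2 * (k * k) + s * (s + 2) * k + s * (s + 2) * (s + (s + 2))) s≡1 k≡4
          (scaled (s + t) (h + h) (≤-trans (≤-trans (≤-reflexive (sym (+-assoc P h h))) (+-monoʳ-≤ (P + h) (m≤m*n h (suc x)))) (≤-reflexive (sym exact)))))
    -- Modulo `h = b + 1` one has `c ≡ 1` and `b ≡ −1`, so `D` is 2 or `s + t` according to the
    -- parity of `n`. Because `D ≤ 2` and `D ≠ 2`, it lies lower by at least one multiple of `h`.
    cases : (∃[ B ] Q ≡ s + h * B) ⊎ (∃[ B ] Q + s ≡ h * B) → ⊥
    cases (inj₁ (B , eq)) = even B eq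
      where
      even : ∀ B → Q ≡ s + h * B → ⊥
      even B q with <-cmp A B
      ... | tri> _ _ B<A = <⇒≱ (begin-strict
        Q + 2 <⟨ m<m+n (Q + 2) (s≤s z≤n) ⟩
        Q + 2 + h ≡⟨ trans (cong (λ z → z + 2 + h) q) (lemma₂ s h B) ⟩
        t + h * suc B ≤⟨ +-monoʳ-≤ t (*-monoʳ-≤ h B<A) ⟩
        t + h * A ≡⟨ sym P≡ ⟩
        P ∎) P≤Q+2
        where
        lemma₂ : ∀ s h B → s + h * B + 2 + h ≡ s + 2 + h * suc B
        lemma₂ = solve-∀
      ... | tri≈ _ A≡B _ = not-equal (trans P≡ (trans (cong (λ z → t + h * z) A≡B) (trans (lemma₂ s h B) (cong (_+ 2) (sym q)))))
        where
        lemma₂ : ∀ s h B → s + 2 + h * B ≡ s + h * B + 2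
        lemma₂ = solve-∀
      ... | tri< A<B _ _ = beyond (≤-trans close (+-monoʳ-≤ Q (≤-trans (m≤n+m 2 s) (m≤n+m t s)))) (inj₁ close)
        where
        lemma₂ : ∀ s h A → s + 2 + h * A + h ≡ s + h * suc A + 2
        lemma₂ = solve-∀
        close : P + h ≤ Q + 2
        close = begin
          P + h ≡⟨ trans (cong (_+ h) P≡) (lemma₂ s h A) ⟩
          s + h * suc A + 2 ≤⟨ +-monoˡ-≤ 2 (+-monoʳ-≤ s (*-monoʳ-≤ h A<B)) ⟩
          s + h * B + 2 ≡⟨ cong (_+ 2) (sym q) ⟩
          Q + 2 ∎
    cases (inj₂ (B , eq)) = odd B eq
      where
      odd : ∀ B → Q + s ≡ h * B → ⊥
      odd B q with ≤-<-connex B A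
      ... | inj₁ B≤A = <⇒≱ (begin-strict
        Q + 2 <⟨ +-monoʳ-< Q (≤-trans (s≤s (m≤n+m 2 s)) (+-monoˡ-≤ t 1≤s)) ⟩
        Q + (s + t) ≡⟨ trans (sym (+-assoc Q s t)) (cong (_+ t) q) ⟩
        h * B + t ≤⟨ +-monoˡ-≤ t (*-monoʳ-≤ h B≤A) ⟩
        h * A + t ≡⟨ trans (+-comm (h * A) t) (sym P≡) ⟩
        P ∎) P≤Q+2
      ... | inj₂ A<B = beyond (≤-trans (m≤m+n (P + h) (h * x)) (≤-reflexive (sym exact))) (inj₂ (x , exact))
        where
        x = B ∸ suc A
        exact : Q + (s + t) ≡ P + h + h * x
        exact = begin-equality
          Q + (s + t) ≡⟨ trans (sym (+-assoc Q s t)) (cong (_+ t) (trans q (cong (h *_) (sym (m+[n∸m]≡n A<B))))) ⟩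
          h * (suc A + x) + t ≡⟨ lemma₃ h A x t ⟩
          t + h * A + h + h * x ≡⟨ cong (λ z → z + h + h * x) (sym P≡) ⟩
          P + h + h * x ∎
          where
          lemma₃ : ∀ h A x t → h * (suc A + x) + t ≡ t + h * A + h + h * x
          lemma₃ = solve-∀

theorem1p5 : (b c : ℕ) → InΓ b → InΓ c → b < c → Cond b c →
    ¬ (∃[ a ] (IsTrottCF b a × IsTrottCF c a))
theorem1p5 b c Γb Γc b<c cond (a , trottB , trottC) with common-trott Γb Γc b<c trottB trottC
... | isqrt≡ , k , s , t , m , n , refl , refl , near = conclude cond
  where
  open Consequences near using (1≤k; s≤k; kk<b; consecutive; extremes; gap-two; common-divisor; large-base)
  open NearPowers near using (1≤s)
  offset : ∀ i → k * k + t ≡ k * k + s + i → t ≡ s + i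
  offset i eq = +-cancelˡ-≡ (k * k) _ _ (trans eq (+-assoc (k * k) s i))
  b<[k+1]² : k * k + s < suc k * suc k
  b<[k+1]² = Γ-upper 1≤k (inj₁ s≤k)
  conclude : Cond (k * k + s) (k * k + t) → ⊥
  conclude (inj₁ isqrt≢) = isqrt≢ isqrt≡
  conclude (inj₂ (inj₁ 1<gcd)) = common-divisor 1<gcd
  conclude (inj₂ (inj₂ (inj₁ c≡b+1))) = consecutive (trans (offset 1 c≡b+1) (+-comm s 1))
  conclude (inj₂ (inj₂ (inj₂ (inj₁ (c≡b+2 , l , 3≤l , ll<b , bound))))) = gap-two (offset 2 c≡b+2) bound′
    where
    open ≤-Reasoning
    l≤k : l ≤ k
    l≤k = ≤-pred (square-cancel-< (<-trans ll<b b<[k+1]²))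
    -- For l < k the excess b − l² is at least 2l + 2, too large for the bound.
    k≤l : k ≤ l
    k≤l = ≮⇒≥ λ l<k → <⇒≱ (begin-strict
      2 * (l * l) <⟨ m<m+n (2 * (l * l)) (s≤s z≤n) ⟩
      2 * (l * l) + suc (2 * (l * l) + 12 * l + 7) ≡⟨ lemma l ⟩
      (2 * l + 2) * (2 * l + 2 + 2) ≤⟨ *-mono-≤ (excess l<k) (+-monoˡ-≤ 2 (excess l<k)) ⟩
      (k * k + s ∸ l * l) * (k * k + s ∸ l * l + 2) ≤⟨ m≤m*n _ (l ∸ 2) {{>-nonZero (m<n⇒0<n∸m 3≤l)}} ⟩
      (k * k + s ∸ l * l) * (k * k + s ∸ l * l + 2) * (l ∸ 2) ∎) bound
      where
      lemma : ∀ l → 2 * (l * l) + suc (2 * (l * l) + 12 * l + 7) ≡ (2 * l + 2) * (2 * l + 2 + 2)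
      lemma = solve-∀
      excess : l < k → 2 * l + 2 ≤ k * k + s ∸ l * l
      excess l<k = +-cancelˡ-≤ (l * l) _ _ (begin
        l * l + (2 * l + 2) ≡⟨ lemma₂ l ⟩
        suc l * suc l + 1 ≤⟨ +-mono-≤ (*-mono-≤ l<k l<k) 1≤s ⟩
        k * k + s ≡⟨ sym (m+[n∸m]≡n (<⇒≤ ll<b)) ⟩
        l * l + (k * k + s ∸ l * l) ∎)
        where
        lemma₂ : ∀ l → l * l + (2 * l + 2) ≡ suc l * suc l + 1
        lemma₂ = solve-∀
    l≡k : l ≡ k
    l≡k = ≤-antisym l≤k k≤l
    t≡ : t ≡ s + 2
    t≡ = offset 2 c≡b+2
    bound′ : s * t * (k ∸ 2) ≤ 2 * (k * k)
    bound′ = subst₂ (λ x y → s * x * (y ∸ 2) ≤ 2 * (y * y)) (sym t≡) l≡k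
      (subst (λ x → x * (x + 2) * (l ∸ 2) ≤ 2 * (l * l)) (trans (cong (λ y → k * k + s ∸ y * y) l≡k) (m+n∸m≡n (k * k) s)) bound)
  conclude (inj₂ (inj₂ (inj₂ (inj₂ (inj₁ (l , 2≤l , b≡ , c≡)))))) = extremes
    (+-cancelˡ-≡ (k * k) _ _ (trans b≡ (cong (λ y → y * y + 1) l≡k)))
    (+-cancelˡ-≡ (k * k) _ _ (trans c≡ (cong (λ y → y * y + y) l≡k)))
    where
    l≡k : l ≡ k
    l≡k = sqrt-unique (<⇒≤ kk<b) b<[k+1]² (≤-trans (m≤m+n (l * l) 1) (≤-reflexive (sym b≡)))
      (subst (_< suc l * suc l) (sym b≡) (Γ-upper (≤-trans (s≤s z≤n) 2≤l) (inj₁ (≤-trans (s≤s z≤n) 2≤l))))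
  -- `2⁹⁶` is the largest power of 2 below `1185 · 10²⁶`; the comparison is evaluated.
  conclude (inj₂ (inj₂ (inj₂ (inj₂ (inj₂ huge))))) = large-base (≤-trans (≤ᵇ⇒≤ (2 ^ 96) (1185 * 10 ^ 26) tt) (<⇒≤ huge))
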